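{- (1) For every finite $n>2$ and every $\mathsf K$ between $\mathsf{Sc}$ and $\mathsf{PEA}$, the variety $S\mathfrak{Nr}_n\mathsf K_{n+4}$ is not atom-canonical. In more detail, there exists an atomic countable $\mathfrak A\in\mathsf{PEA}_n$ such that $\mathfrak{Tm}\mathrm{At}\mathfrak A\in\mathsf{RPEA}_n$, but the $\mathsf{Sc}$-reduct $\mathfrak{Rd}_{sc}\mathfrak{Cm}\mathrm{At}\mathfrak A$ is not in $S\mathfrak{Nr}_n\mathsf{Sc}_{n+4}$, and the diagonal-free reduct $\mathfrak{Rd}_{df}\mathfrak{Cm}\mathrm{At}\mathfrak A$ is not in $\mathsf{RDf}_n$. In particular, $S\mathfrak{Nr}_n\mathsf K_{n+k}$ is not atom-canonical for any $k\ge4$ and any $\mathsf K$ between $\mathsf{Sc}$ and $\mathsf{PEA}$. (2) For every finite $n>2$, the variety $\mathsf{CB}_{n,n+4}$ is not atom-canonical; and the same holds for the analogously defined variety $\mathsf{CB}^{\mathsf K}_{n,n+4}$ for each $\mathsf K\in\{\mathsf{Sc},\mathsf{QA},\mathsf{CA},\mathsf{PEA}\}$.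
   Context: Algebras. All are Boolean algebras with operators indexed by $i,j,k<\alpha$ ($\alpha$ finite here). $\mathsf{PEA}_\alpha$: operations $c_i,s^i_j,s_{ij},d_{ij}$ with axioms: $s^i_ix=s_{ii}x=x$, $d_{ii}=1$, $s_{ij}=s_{ji}$; $x\le c_ix$; $c_i(x+y)=c_ix+c_iy$; $s^i_jc_ix=c_ix$; $c_is^i_jx=s^i_jx$ ($i\ne j$); $s^i_jc_kx=c_ks^i_jx$ ($k\notin\{i,j\}$); $s^i_j,s_{ij}$ are Boolean endomorphisms; $s_{ij}s_{ij}x=x$; $s_{ij}s_{ik}x=s_{jk}s_{ij}x$ ($i,j,k$ distinct); $s_{ij}s^i_jx=s^j_ix$; $s^i_jd_{ij}=1$; $x\cdot d_{ij}\le s^i_jx$. $\mathsf{QA}_\alpha$ ($=\mathsf{PA}_\alpha$ for finite $\alpha$): operations $c_i,s^i_j,s_{ij}$ with axioms: $s^i_ix=s_{ii}x=x$, $s_{ij}=s_{ji}$; $x\le c_ix$; $c_i(x+y)=c_ix+c_iy$; $s^i_jc_ix=c_ix$; $c_is^i_jx=s^i_jx$ ($i\ne j$); $s^i_jc_kx=c_ks^i_jx$ ($k\notin\{i,j\}$); $s^i_j,s_{ij}$ are Boolean endomorphisms; $s_{ij}s_{ij}x=x$; $s_{ij}s_{ik}x=s_{jk}s_{ij}x$ ($i,j,k$ distinct); $s_{ij}s^i_jx=s^j_ix$. $\mathsf{CA}_\alpha$: cylindric algebras (operations $c_i,d_{ij}$; in them $s^i_jx=c_i(d_{ij}\cdot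 x)$ for $i\ne j$). $\mathsf{Sc}_\alpha$ (Pinter's substitution algebras): operations $c_i,s^i_j$ with $c_i0=0$, $x\le c_ix$, $c_i(x\cdot c_iy)=c_ix\cdot c_iy$, $c_ic_jx=c_jc_ix$, $s^i_ix=x$, $s^i_j$ Boolean endomorphisms, $s^i_jc_ix=c_ix$, $c_is^i_jx=s^i_jx$ ($i\neq j$), $s^i_jc_kx=c_ks^i_jx$ ($k\notin\{i,j\}$), $c_is^j_ix=c_js^i_jx$, $s^j_is^l_kx=s^l_ks^j_ix$ ($|\{i,j,k,l\}|=4$), $s^l_is^j_lx=s^l_is^j_ix$. $\mathsf{Df}_\alpha$: only the $c_i$. "$\mathsf K$ between $\mathsf{Sc}$ and $\mathsf{PEA}$" means $\mathsf K\in\{\mathsf{Sc},\mathsf{QA},\mathsf{CA},\mathsf{PEA}\}$. $\mathfrak{Rd}$ denotes the indicated reduct. Representable algebras ($\mathsf{RPEA}_n$, $\mathsf{RDf}_n$): isomorphic to subalgebras of products of set algebras; a set algebra with unit ${}^nU$ ($U_0\times\dots\times U_{n-1}$ for $\mathsf{Df}_n$) has the operations $c_iX=\{s:\exists t\in X,\ t\equiv_is\}$ (where $t\equiv_i s$ means $t_j=s_j$ for $j\neq i$), $d_{ij}=\{s:s_i=s_j\}$, $s^i_jX=\{s:s\circ[i|j]\in X\}$, $s_{ij}X=\{s:s\circ[i,j]\in X\}$, with $[i|j]$ the map sending $i$ to $j$ and fixing the rest and $[i,j]$ the transposition. Neat reducts. For $\mathfrak B\in\mathsf K_m$, $n\le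 m$, $\mathfrak{Nr}_n\mathfrak B\in\mathsf K_n$ has universe $\{b: c_ib=b\text{ for }n\le i<m\}$ and operations with indices $<n$; $S$ is closure under isomorphic copies of subalgebras. Atom structures. $\mathrm{At}\mathfrak A$ is the atom structure of an atomic algebra $\mathfrak A$; $\mathfrak{Cm}$ is the complex algebra, $\mathfrak{Tm}$ the subalgebra of the complex algebra generated by the atoms. A variety is atom-canonical if $\mathfrak{Cm}\mathrm{At}\mathfrak A$ is in it for each atomic member $\mathfrak A$. $\mathsf{CB}^{\mathsf K}_{n,m}$ ($m>n$), with $\mathsf{CB}_{n,m}=\mathsf{CB}^{\mathsf{CA}}_{n,m}$: for an atomic $\mathfrak B\in\mathsf K_n$, an $m$-dimensional network is $N:{}^nm\to\mathrm{At}\mathfrak B$ with $N(\delta[i\to d])\le c_iN(\delta)$ for all $\delta\in{}^nm,i<n,d<m$ ($\delta[i\to d]$ is $\delta$ with $i$th entry replaced by $d$); $N(\delta[i\to\delta_j])\le d_{ij}$ if diagonals are in the signature, otherwise $N(\delta)\le s^i_jN(\delta\circ[i|j])$; and $N(\delta\circ[i,j])=s_{ij}N(\delta)$ if transpositions are in the signature. An $m$-dimensional basis is a set $H$ of such networks such that every atom $a$ is $N(0,\dots,n-1)$ for some $N\in H$, and whenever $N\in H$, $\bar x\in{}^nm$, $i<n$, $a$ an atom, $N(\bar x)\le c_ia$, $z\in m\setminus\{x_j:j\ne i\}$, there is $M\in H$ agreeing with $N$ on all tuples avoiding $z$ with $M(\bar x[i\to z])=a$. $\mathsf{CB}^{\mathsf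 K}_{n,m}$ is the class of subalgebras of complete atomic algebras in $\mathsf K_n$ having an $m$-dimensional basis. -}

module Defs where

open import Level using (Level; _⊔_; suc; Lift; lift; Setω)
open import Data.Bool using (Bool; true; false; T)
open import Data.Empty.Polymorphic using (⊥)
open import Data.Fin using (Fin; toℕ; inject≤)
open import Data.Fin.Permutation.Components using (transpose)
open import Data.Nat using (ℕ; _≤_; _<_)
open import Data.Nat.Properties using (<⇒≤)
open import Data.Product using (Σ; ∃; Σ-syntax; ∃-syntax; _×_; _,_; proj₁; proj₂)
open import Data.Sum using (_⊎_; inj₁; inj₂)
open import Data.Unit.Polymorphic using (⊤; tt)
open import Data.Vec.Functional using (updateAt)
open import Function using (_∘_; const; id)
open import Function.Definitions using (Injective; Surjective)
open import Algebra.Lattice.Structures using (IsBooleanAlgebra)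
open import Relation.Binary.Bundles using (Setoid)
open import Relation.Binary.Definitions using (_Respects_)
open import Relation.Binary.PropositionalEquality using (_≡_; _≢_; _≗_; refl; sym; trans)
open import Relation.Binary.Structures using (IsEquivalence)
open import Relation.Nullary using (¬_)
open import Relation.Unary using (Pred; _∈_; _∪_; _∩_; ∁; _≐_)
open import Relation.Unary.Properties using (≐-refl; ≐-sym; ≐-trans)

-- Every algebra has the cylindrifications; a similarity type records
-- which of sⁱⱼ, sᵢⱼ and dᵢⱼ are present as well.

record SimType : Set where
  constructor simType
  field
    hasSub  : Bool
    hasTra  : Bool
    hasDiag : Bool

open SimType public

dfType scType qaType caType peaType : SimType
dfType  = simType false false false
scType  = simType true  false false
qaType  = simType true  true  false
caType  = simType false false true
peaType = simType true  true  true

data Op (σ : SimType) (α : ℕ) : Set where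
  cyl : Fin α → Op σ α
  sub : {p : T (hasSub σ)} → Fin α → Fin α → Op σ α
  tra : {p : T (hasTra σ)} → Fin α → Fin α → Op σ α

data Con (σ : SimType) (α : ℕ) : Set where
  dia : {p : T (hasDiag σ)} → Fin α → Fin α → Con σ α

record _⊑_ (σ τ : SimType) : Set where
  field
    sub⊑  : T (hasSub σ)  → T (hasSub τ)
    tra⊑  : T (hasTra σ)  → T (hasTra τ)
    diag⊑ : T (hasDiag σ) → T (hasDiag τ)

open _⊑_

⊑-refl : ∀ {σ} → σ ⊑ σ
⊑-refl = record { sub⊑ = id ; tra⊑ = id ; diag⊑ = id }

df⊑pea : dfType ⊑ peaType
df⊑pea = record { sub⊑ = λ () ; tra⊑ = λ () ; diag⊑ = λ () }

sc⊑pea : scType ⊑ peaType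
sc⊑pea = record { sub⊑ = id ; tra⊑ = λ () ; diag⊑ = λ () }

qa⊑pea : qaType ⊑ peaType
qa⊑pea = record { sub⊑ = id ; tra⊑ = id ; diag⊑ = λ () }

mapOp : ∀ {σ τ m n} → σ ⊑ τ → (Fin m → Fin n) → Op σ m → Op τ n
mapOp le f (cyl i)       = cyl (f i)
mapOp le f (sub {p} i j) = sub {p = sub⊑ le p} (f i) (f j)
mapOp le f (tra {p} i j) = tra {p = tra⊑ le p} (f i) (f j)

mapCon : ∀ {σ τ m n} → σ ⊑ τ → (Fin m → Fin n) → Con σ m → Con τ n
mapCon le f (dia {p} i j) = dia {p = diag⊑ le p} (f i) (f j)

-- Algebras of a given type, over a setoid; no laws beyond congruence.

record Algebra (σ : SimType) (α : ℕ) (a ℓ : Level) : Set (suc (a ⊔ ℓ)) where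
  infix  4 _≈_ _≲_
  infixl 6 _+_
  infixl 7 _·_
  infix  8 -_
  field
    Carrier       : Set a
    _≈_           : Carrier → Carrier → Set ℓ
    isEquivalence : IsEquivalence _≈_
    _+_           : Carrier → Carrier → Carrier
    _·_           : Carrier → Carrier → Carrier
    -_            : Carrier → Carrier
    𝟘             : Carrier
    𝟙             : Carrier
    op            : Op σ α → Carrier → Carrier
    con           : Con σ α → Carrier
    +-cong        : ∀ {x x′ y y′} → x ≈ x′ → y ≈ y′ → x + y ≈ x′ + y′
    ·-cong        : ∀ {x x′ y y′} → x ≈ x′ → y ≈ y′ → x · y ≈ x′ · y′
    -‿cong        : ∀ {x x′} → x ≈ x′ → - x ≈ - x′
    op-cong       : ∀ o {x x′} → x ≈ x′ → op o x ≈ op o x′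

  setoid : Setoid a ℓ
  setoid = record { isEquivalence = isEquivalence }

  _≲_ : Carrier → Carrier → Set ℓ
  x ≲ y = x · y ≈ x

  c : Fin α → Carrier → Carrier
  c i = op (cyl i)

  -- s i j is sⁱⱼ, t i j is sᵢⱼ.

  s : {p : T (hasSub σ)} → Fin α → Fin α → Carrier → Carrier
  s {p} i j = op (sub {p = p} i j)

  t : {p : T (hasTra σ)} → Fin α → Fin α → Carrier → Carrier
  t {p} i j = op (tra {p = p} i j)

  d : {p : T (hasDiag σ)} → Fin α → Fin α → Carrier
  d {p} i j = con (dia {p = p} i j)

  IsAtom : Pred Carrier (a ⊔ ℓ)
  IsAtom x = ¬ (x ≈ 𝟘) × (∀ y → y ≲ x → y ≈ 𝟘 ⊎ y ≈ x)

  Atom : Set (a ⊔ ℓ)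
  Atom = Σ Carrier IsAtom

  Atomic : Set (a ⊔ ℓ)
  Atomic = ∀ x → ¬ (x ≈ 𝟘) → ∃[ y ] IsAtom y × y ≲ x

  IsSupremum : ∀ {p} → Pred Carrier p → Carrier → Set (a ⊔ ℓ ⊔ p)
  IsSupremum P z =
    (∀ x → x ∈ P → x ≲ z) × (∀ y → (∀ x → x ∈ P → x ≲ y) → z ≲ y)

  Complete : Set (suc (a ⊔ ℓ))
  Complete = (P : Pred Carrier (a ⊔ ℓ)) → ∃ (IsSupremum P)

  Countable : Set (a ⊔ ℓ)
  Countable = Σ[ f ∈ (ℕ → Carrier) ] Surjective _≡_ _≈_ f

Reduct : ∀ {σ τ m n a ℓ} → σ ⊑ τ → (Fin m → Fin n) →
         Algebra τ n a ℓ → Algebra σ m a ℓ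
Reduct le f A = record
  { Carrier = Carrier ; _≈_ = _≈_ ; isEquivalence = isEquivalence
  ; _+_ = _+_ ; _·_ = _·_ ; -_ = -_ ; 𝟘 = 𝟘 ; 𝟙 = 𝟙
  ; op = λ o → op (mapOp le f o) ; con = λ k → con (mapCon le f k)
  ; +-cong = +-cong ; ·-cong = ·-cong ; -‿cong = -‿cong
  ; op-cong = λ o → op-cong (mapOp le f o)
  }
  where open Algebra A

module _ {α : ℕ} {a ℓ : Level} (A : Algebra peaType α a ℓ) where

  Rd-df : Algebra dfType α a ℓ
  Rd-df = Reduct df⊑pea id A

  Rd-sc : Algebra scType α a ℓ
  Rd-sc = Reduct sc⊑pea id A

  Rd-qa : Algebra qaType α a ℓ
  Rd-qa = Reduct qa⊑pea id A

-- Embeddings; "A is isomorphic to a subalgebra of B" is A ↪ B.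

record _↪_ {σ α a ℓ b ℓ′} (A : Algebra σ α a ℓ) (B : Algebra σ α b ℓ′) :
           Set (a ⊔ ℓ ⊔ b ⊔ ℓ′) where
  private
    module A = Algebra A
    module B = Algebra B
  field
    ⟦_⟧       : A.Carrier → B.Carrier
    ⟦⟧-cong   : ∀ {x y} → x A.≈ y → ⟦ x ⟧ B.≈ ⟦ y ⟧
    injective : Injective A._≈_ B._≈_ ⟦_⟧
    +-homo    : ∀ x y → ⟦ x A.+ y ⟧ B.≈ ⟦ x ⟧ B.+ ⟦ y ⟧
    ·-homo    : ∀ x y → ⟦ x A.· y ⟧ B.≈ ⟦ x ⟧ B.· ⟦ y ⟧
    -‿homo    : ∀ x → ⟦ A.- x ⟧ B.≈ B.- ⟦ x ⟧
    𝟘-homo    : ⟦ A.𝟘 ⟧ B.≈ B.𝟘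
    𝟙-homo    : ⟦ A.𝟙 ⟧ B.≈ B.𝟙
    op-homo   : ∀ o x → ⟦ A.op o x ⟧ B.≈ B.op o ⟦ x ⟧
    con-homo  : ∀ k → ⟦ A.con k ⟧ B.≈ B.con k

module _ {σ : SimType} {α : ℕ} {a ℓ : Level} (A : Algebra σ α a ℓ) where
  open Algebra A

  IsBoolean : Set (a ⊔ ℓ)
  IsBoolean = IsBooleanAlgebra _≈_ _+_ _·_ -_ 𝟙 𝟘

  record IsBooleanEndo (f : Carrier → Carrier) : Set (a ⊔ ℓ) where
    field
      +-homo : ∀ x y → f (x + y) ≈ f x + f y
      ·-homo : ∀ x y → f (x · y) ≈ f x · f y
      -‿homo : ∀ x → f (- x) ≈ - f x
      𝟘-homo : f 𝟘 ≈ 𝟘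
      𝟙-homo : f 𝟙 ≈ 𝟙

module _ {α : ℕ} {a ℓ : Level} where

  record IsSc (A : Algebra scType α a ℓ) : Set (a ⊔ ℓ) where
    open Algebra A
    field
      isBoolean  : IsBoolean A
      c-𝟘        : ∀ i → c i 𝟘 ≈ 𝟘
      c-ext      : ∀ i x → x ≲ c i x
      c-·c       : ∀ i x y → c i (x · c i y) ≈ c i x · c i y
      c-comm     : ∀ i j x → c i (c j x) ≈ c j (c i x)
      s-id       : ∀ i x → s i i x ≈ x
      s-endo     : ∀ i j → IsBooleanEndo A (s i j)
      s-c        : ∀ i j x → s i j (c i x) ≈ c i x
      c-s        : ∀ i j x → i ≢ j → c i (s i j x) ≈ s i j x
      s-c-comm   : ∀ i j k x → k ≢ i → k ≢ j → s i j (c k x) ≈ c k (s i j x)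
      c-s-swap   : ∀ i j x → c i (s j i x) ≈ c j (s i j x)
      s-s-comm   : ∀ i j k l x → i ≢ j → i ≢ k → i ≢ l → j ≢ k → j ≢ l → k ≢ l →
                   s j i (s l k x) ≈ s l k (s j i x)
      s-s        : ∀ i j l x → s l i (s j l x) ≈ s l i (s j i x)

  record IsQA (A : Algebra qaType α a ℓ) : Set (a ⊔ ℓ) where
    open Algebra A
    field
      isBoolean  : IsBoolean A
      s-id       : ∀ i x → s i i x ≈ x
      t-id       : ∀ i x → t i i x ≈ x
      t-sym      : ∀ i j x → t i j x ≈ t j i x
      c-ext      : ∀ i x → x ≲ c i x
      c-+        : ∀ i x y → c i (x + y) ≈ c i x + c i y
      s-c        : ∀ i j x → s i j (c i x) ≈ c i x
      c-s        : ∀ i j x → i ≢ j → c i (s i j x) ≈ s i j x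
      s-c-comm   : ∀ i j k x → k ≢ i → k ≢ j → s i j (c k x) ≈ c k (s i j x)
      s-endo     : ∀ i j → IsBooleanEndo A (s i j)
      t-endo     : ∀ i j → IsBooleanEndo A (t i j)
      t-invol    : ∀ i j x → t i j (t i j x) ≈ x
      t-t        : ∀ i j k x → i ≢ j → i ≢ k → j ≢ k →
                   t i j (t i k x) ≈ t j k (t i j x)
      t-s        : ∀ i j x → t i j (s i j x) ≈ s j i x

  record IsCA (A : Algebra caType α a ℓ) : Set (a ⊔ ℓ) where
    open Algebra A
    field
      isBoolean  : IsBoolean A
      c-𝟘        : ∀ i → c i 𝟘 ≈ 𝟘
      c-ext      : ∀ i x → x ≲ c i x
      c-·c       : ∀ i x y → c i (x · c i y) ≈ c i x · c i y
      c-comm     : ∀ i j x → c i (c j x) ≈ c j (c i x)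
      d-refl     : ∀ i → d i i ≈ 𝟙
      d-d        : ∀ i j k → k ≢ i → k ≢ j → d i j ≈ c k (d i k · d k j)
      d-c        : ∀ i j x → i ≢ j → c i (d i j · x) · c i (d i j · - x) ≈ 𝟘


  record IsPEA (A : Algebra peaType α a ℓ) : Set (a ⊔ ℓ) where
    open Algebra A
    field
      isQA       : IsQA (Rd-qa A)
      d-refl     : ∀ i → d i i ≈ 𝟙
      s-d        : ∀ i j → s i j (d i j) ≈ 𝟙
      ·d-s       : ∀ i j x → x · d i j ≲ s i j x

data Kind : Set where
  Sc QA CA PEA : Kind

type : Kind → SimType
type Sc  = scType
type QA  = qaType
type CA  = caType
type PEA = peaType

Is : ∀ {α a ℓ} (K : Kind) → Algebra (type K) α a ℓ → Set (a ⊔ ℓ)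
Is Sc  = IsSc
Is QA  = IsQA
Is CA  = IsCA
Is PEA = IsPEA

-- Classes are level-polymorphic because Cm (At A) lives one universe above
-- A.  A class below that asserts the existence of further data (an algebra
-- B, the bases of a representation) takes it from the universe of its
-- argument; under excluded middle this is no restriction.

Class : SimType → ℕ → Setω
Class σ α = ∀ {a ℓ} → Algebra σ α a ℓ → Set (suc (a ⊔ ℓ))

module _ {w r : Level} (W : Setoid w r) where
  private module W = Setoid W

  ℘ : Set (suc (w ⊔ r))
  ℘ = Σ[ X ∈ Pred W.Carrier (w ⊔ r) ] X Respects W._≈_

  _≃_ : ℘ → ℘ → Set (w ⊔ r)
  X ≃ Y = proj₁ X ≐ proj₁ Y

  -- The Boolean part satisfies the laws of Boolean algebra only under
  -- excluded middle.
  ℘-algebra : ∀ {σ α} (op : Op σ α → ℘ → ℘) →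
              (∀ o {X Y} → X ≃ Y → op o X ≃ op o Y) →
              (Con σ α → ℘) → Algebra σ α (suc (w ⊔ r)) (w ⊔ r)
  ℘-algebra op op-cong con = record
    { Carrier = ℘
    ; _≈_ = _≃_
    ; isEquivalence = record { refl = ≐-refl ; sym = ≐-sym ; trans = ≐-trans }
    ; _+_ = λ (X , p) (Y , q) → X ∪ Y ,
        λ { e (inj₁ x) → inj₁ (p e x) ; e (inj₂ y) → inj₂ (q e y) }
    ; _·_ = λ (X , p) (Y , q) → X ∩ Y , λ e (x , y) → p e x , q e y
    ; -_ = λ (X , p) → ∁ X , λ e ¬x x → ¬x (p (W.sym e) x)
    ; 𝟘 = (λ _ → ⊥) , λ _ ()
    ; 𝟙 = (λ _ → ⊤) , λ _ _ → tt
    ; op = op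
    ; con = con
    ; +-cong = λ (f , g) (h , k) →
        (λ { (inj₁ x) → inj₁ (f x) ; (inj₂ y) → inj₂ (h y) }) ,
        (λ { (inj₁ x) → inj₁ (g x) ; (inj₂ y) → inj₂ (k y) })
    ; ·-cong = λ (f , g) (h , k) → (λ (x , y) → f x , h y) , (λ (x , y) → g x , k y)
    ; -‿cong = λ (f , g) → (λ ¬x y → ¬x (g y)) , (λ ¬y x → ¬y (f x))
    ; op-cong = op-cong
    }

-- R o x y stands for "x ∈ o {y}", and C k x for "x ∈ k".

record AtomStructure (σ : SimType) (α : ℕ) (w r : Level) : Set (suc (w ⊔ r)) where
  field
    points : Setoid w r
  open Setoid points using (Carrier; _≈_)
  field
    R      : Op σ α → Carrier → Carrier → Set r
    R-resp : ∀ o {x x′ y} → x ≈ x′ → R o x y → R o x′ y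
    C      : Con σ α → Carrier → Set r
    C-resp : ∀ k {x x′} → x ≈ x′ → C k x → C k x′

At : ∀ {σ α a ℓ} → Algebra σ α a ℓ → AtomStructure σ α (a ⊔ ℓ) ℓ
At A = record
  { points = record
      { Carrier = Atom
      ; _≈_ = λ x y → proj₁ x ≈ proj₁ y
      ; isEquivalence = record { refl = ≈.refl ; sym = ≈.sym ; trans = ≈.trans }
      }
  ; R = λ o x y → proj₁ x ≲ op o (proj₁ y)
  ; R-resp = λ _ → ≲-resp
  ; C = λ k x → proj₁ x ≲ con k
  ; C-resp = λ _ → ≲-resp
  }
  where
  open Algebra A
  module ≈ = IsEquivalence isEquivalence
  ≲-resp : ∀ {x x′ y} → x ≈ x′ → x ≲ y → x′ ≲ y
  ≲-resp e p = ≈.trans (·-cong (≈.sym e) ≈.refl) (≈.trans p e)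

Cm : ∀ {σ α w r} → AtomStructure σ α w r → Algebra σ α (suc (w ⊔ r)) (w ⊔ r)
Cm {w = w} S = ℘-algebra points
  (λ o (X , _) → (λ x → ∃[ y ] y ∈ X × R o x y) ,
                 λ e (y , y∈X , Rxy) → y , y∈X , R-resp o e Rxy)
  (λ o (f , g) → (λ (y , y∈X , Rxy) → y , f y∈X , Rxy) ,
                 (λ (y , y∈Y , Rxy) → y , g y∈Y , Rxy))
  (λ k → (λ x → Lift w (C k x)) , λ e (lift Cx) → lift (C-resp k e Cx))
  where open AtomStructure S

module _ {σ α a ℓ} (A : Algebra σ α a ℓ) where
  open Algebra A

  data Generated {g} (G : Pred Carrier g) : Pred Carrier (a ⊔ ℓ ⊔ g) where
    gen   : ∀ {x} → x ∈ G → Generated G x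
    plus  : ∀ {x y} → Generated G x → Generated G y → Generated G (x + y)
    times : ∀ {x y} → Generated G x → Generated G y → Generated G (x · y)
    neg   : ∀ {x} → Generated G x → Generated G (- x)
    zero  : Generated G 𝟘
    one   : Generated G 𝟙
    apply : ∀ o {x} → Generated G x → Generated G (op o x)
    fixed : ∀ k → Generated G (con k)

  Sg : ∀ {g} → Pred Carrier g → Algebra σ α (a ⊔ ℓ ⊔ g) ℓ
  Sg G = record
    { Carrier = Σ Carrier (Generated G)
    ; _≈_ = λ x y → proj₁ x ≈ proj₁ y
    ; isEquivalence = record { refl = ≈.refl ; sym = ≈.sym ; trans = ≈.trans }
    ; _+_ = λ (x , p) (y , q) → x + y , plus p q
    ; _·_ = λ (x , p) (y , q) → x · y , times p q
    ; -_ = λ (x , p) → - x , neg p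
    ; 𝟘 = 𝟘 , zero
    ; 𝟙 = 𝟙 , one
    ; op = λ o (x , p) → op o x , apply o p
    ; con = λ k → con k , fixed k
    ; +-cong = +-cong ; ·-cong = ·-cong ; -‿cong = -‿cong
    ; op-cong = λ o → op-cong o
    }
    where module ≈ = IsEquivalence isEquivalence

Tm : ∀ {σ α w r} → AtomStructure σ α w r → Algebra σ α (suc (w ⊔ r)) (w ⊔ r)
Tm S = Sg (Cm S) (Algebra.IsAtom (Cm S))

AtomCanonical : ∀ {σ α} → Class σ α → (a ℓ : Level) → Set (suc (suc (a ⊔ ℓ)))
AtomCanonical {σ} {α} V a ℓ =
  (A : Algebra σ α a ℓ) → V A → Algebra.Atomic A → V (Cm (At A))

module _ {n : ℕ} {u : Level} where

  Tuples : (Fin n → Set u) → Setoid u u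
  Tuples U = record
    { Carrier = ∀ i → U i
    ; _≈_ = λ f g → ∀ i → f i ≡ g i
    ; isEquivalence = record
        { refl = λ _ → refl
        ; sym = λ e i → sym (e i)
        ; trans = λ e e′ i → trans (e i) (e′ i) }
    }

  _≡[_]_ : {U : Fin n → Set u} → (∀ i → U i) → Fin n → (∀ i → U i) → Set u
  t ≡[ i ] s = ∀ j → j ≢ i → t j ≡ s j

  module _ (U : Fin n → Set u) where

    cylindrify : Fin n → ℘ (Tuples U) → ℘ (Tuples U)
    cylindrify i (X , _) =
      (λ s → ∃[ t ] t ∈ X × t ≡[ i ] s) ,
      λ e (t , t∈X , t≡s) → t , t∈X , λ j j≢i → trans (t≡s j j≢i) (e j)

    cylindrify-cong : ∀ i {X Y} → _≃_ (Tuples U) X Y →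
                      _≃_ (Tuples U) (cylindrify i X) (cylindrify i Y)
    cylindrify-cong i (f , g) =
      (λ (t , t∈X , e) → t , f t∈X , e) , (λ (t , t∈Y , e) → t , g t∈Y , e)

-- i goes to j, everything else is fixed.

[_∣_] : ∀ {n} → Fin n → Fin n → Fin n → Fin n
[ i ∣ j ] = updateAt id i (const j)

SetAlgebra : ∀ (σ : SimType) (n : ℕ) {u} → Set u → Algebra σ n (suc u) u
SetAlgebra σ n {u} U = ℘-algebra (Tuples Uⁿ) ops ops-cong cons
  where
  Uⁿ : Fin n → Set u
  Uⁿ _ = U
  infixl 9 _∘*_
  _∘*_ : ℘ (Tuples Uⁿ) → (Fin n → Fin n) → ℘ (Tuples Uⁿ)
  (X , p) ∘* f = (λ s → s ∘ f ∈ X) , λ e → p (e ∘ f)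
  ops : Op σ n → ℘ (Tuples Uⁿ) → ℘ (Tuples Uⁿ)
  ops (cyl i)   X = cylindrify Uⁿ i X
  ops (sub i j) X = X ∘* [ i ∣ j ]
  ops (tra i j) X = X ∘* transpose i j
  ops-cong : ∀ o {X Y} → _≃_ (Tuples Uⁿ) X Y → _≃_ (Tuples Uⁿ) (ops o X) (ops o Y)
  ops-cong (cyl i)   {X} {Y} = cylindrify-cong Uⁿ i {X} {Y}
  ops-cong (sub i j) (f , g) = f , g
  ops-cong (tra i j) (f , g) = f , g
  cons : Con σ n → ℘ (Tuples Uⁿ)
  cons (dia i j) = (λ s → s i ≡ s j) , λ e p → trans (sym (e i)) (trans p (e j))

-- Here the unit is U₀ × … × Uₙ₋₁, with possibly distinct factors.

DfSetAlgebra : ∀ {n u} → (Fin n → Set u) → Algebra dfType n (suc u) u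
DfSetAlgebra {n} U = ℘-algebra (Tuples U) ops ops-cong λ { (dia {()} _ _) }
  where
  ops : Op dfType n → ℘ (Tuples U) → ℘ (Tuples U)
  ops (cyl i) = cylindrify U i
  ops-cong : ∀ o {X Y} → _≃_ (Tuples U) X Y → _≃_ (Tuples U) (ops o X) (ops o Y)
  ops-cong (cyl i) {X} {Y} = cylindrify-cong U i {X} {Y}

Product : ∀ {σ α i a ℓ} (I : Set i) → (I → Algebra σ α a ℓ) →
          Algebra σ α (i ⊔ a) (i ⊔ ℓ)
Product I A = record
  { Carrier = ∀ i → Carrier (A i)
  ; _≈_ = λ x y → ∀ i → _≈_ (A i) (x i) (y i)
  ; isEquivalence = record
      { refl = λ i → IsEquivalence.refl (isEquivalence (A i))
      ; sym = λ e i → IsEquivalence.sym (isEquivalence (A i)) (e i)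
      ; trans = λ e e′ i → IsEquivalence.trans (isEquivalence (A i)) (e i) (e′ i) }
  ; _+_ = λ x y i → _+_ (A i) (x i) (y i)
  ; _·_ = λ x y i → _·_ (A i) (x i) (y i)
  ; -_ = λ x i → -_ (A i) (x i)
  ; 𝟘 = λ i → 𝟘 (A i)
  ; 𝟙 = λ i → 𝟙 (A i)
  ; op = λ o x i → op (A i) o (x i)
  ; con = λ k i → con (A i) k
  ; +-cong = λ e e′ i → +-cong (A i) (e i) (e′ i)
  ; ·-cong = λ e e′ i → ·-cong (A i) (e i) (e′ i)
  ; -‿cong = λ e i → -‿cong (A i) (e i)
  ; op-cong = λ o e i → op-cong (A i) o (e i)
  }
  where open Algebra

RPEA : ∀ n → Class peaType n
RPEA n {a} {ℓ} A =
  Σ[ I ∈ Set (a ⊔ ℓ) ] Σ[ U ∈ (I → Set (a ⊔ ℓ)) ]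
  A ↪ Product I (λ i → SetAlgebra peaType n (U i))

RDf : ∀ n → Class dfType n
RDf n {a} {ℓ} A =
  Σ[ I ∈ Set (a ⊔ ℓ) ] Σ[ U ∈ (I → Fin n → Set (a ⊔ ℓ)) ]
  A ↪ Product I (λ i → DfSetAlgebra (U i))

module _ {σ n m a ℓ} (n≤m : n ≤ m) (B : Algebra σ m a ℓ) where
  open Algebra B

  Rdₙ : Algebra σ n a ℓ
  Rdₙ = Reduct ⊑-refl (λ i → inject≤ i n≤m) B

  -- The universe of 𝔑𝔯ₙB; its operations are those of Rdₙ.
  Nr : Pred Carrier ℓ
  Nr b = ∀ i → n ≤ toℕ i → c i b ≈ b

-- S𝔑𝔯ₙKₘ.  A subalgebra of 𝔑𝔯ₙB is the same thing as a subalgebra of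
-- Rdₙ B all of whose elements lie in Nr.

SNr : ∀ K {n m} → n ≤ m → Class (type K) n
SNr K {n} {m} n≤m {a} {ℓ} A =
  Σ[ B ∈ Algebra (type K) m a ℓ ] Is K B ×
  Σ[ h ∈ A ↪ Rdₙ n≤m B ] (∀ x → _↪_.⟦_⟧ h x ∈ Nr n≤m B)

infixl 10 _[_↦_]

_[_↦_] : ∀ {n m} → (Fin n → Fin m) → Fin n → Fin m → Fin n → Fin m
δ [ i ↦ z ] = updateAt δ i (const z)

module _ {σ n a ℓ} (B : Algebra σ n a ℓ) where
  open Algebra B

  record Network (m : ℕ) : Set (a ⊔ ℓ) where
    field
      label : (Fin n → Fin m) → Atom

    N : (Fin n → Fin m) → Carrier
    N δ = proj₁ (label δ)

    field
      N-cong : ∀ {δ ε} → δ ≗ ε → N δ ≈ N ε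
      N-cyl  : ∀ δ i z → N (δ [ i ↦ z ]) ≲ c i (N δ)
      N-diag : {p : T (hasDiag σ)} → ∀ δ i j → N (δ [ i ↦ δ j ]) ≲ d {p} i j
      N-sub  : ¬ T (hasDiag σ) → {p : T (hasSub σ)} →
               ∀ δ i j → N δ ≲ s {p} i j (N (δ ∘ [ i ∣ j ]))
      N-tra  : {p : T (hasTra σ)} → ∀ δ i j → N (δ ∘ transpose i j) ≈ t {p} i j (N δ)

  open Network using (N)

  _∌_ : ∀ {m} → (Fin n → Fin m) → Fin m → Set
  δ ∌ z = ∀ j → δ j ≢ z

  record IsBasis {m h} (n<m : n < m) (H : Pred (Network m) h) : Set (a ⊔ ℓ ⊔ h) where
    field
      atoms  : ∀ x → IsAtom x →
               ∃[ M ] M ∈ H × N M (λ i → inject≤ i (<⇒≤ n<m)) ≈ x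
      extend : ∀ M → M ∈ H → ∀ δ i x → IsAtom x → N M δ ≲ c i x →
               ∀ z → (∀ j → j ≢ i → δ j ≢ z) →
               ∃[ M′ ] M′ ∈ H × (∀ ε → ε ∌ z → N M′ ε ≈ N M ε) ×
                       N M′ (δ [ i ↦ z ]) ≈ x

CB : ∀ K {n m} → n < m → Class (type K) n
CB K {n} {m} n<m {a} {ℓ} A =
  Σ[ B ∈ Algebra (type K) n a ℓ ] Is K B × Algebra.Complete B × Algebra.Atomic B ×
  (Σ[ H ∈ Pred (Network B m) (a ⊔ ℓ) ] IsBasis B n<m H) × A ↪ B

{-# OPTIONS --safe #-}
module Submission where

-- Write n = 3 + k.  Nodes are coloured with the n + 3 parts P r (r < k), V β and
-- X s (s < 4, the tint), and every choice of one node from each P r carries an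
-- edge-coloured graph on the other nodes.  An X-node joined to both nodes of a
-- base (a pair in V false × V true) is an apex over it.  Apexes of different
-- tints over one base are joined by a red edge, which has a parity and a level
-- in ℕ ∪ {∞}.  In a red triangle the levels agree, and if they are finite then
-- the sum of the parities is prescribed by the tints.  The prescribed sums over
-- the four triples of tints have odd total, whereas each edge of a tetrahedron
-- lies in two triangles: four apexes over one base need level ∞.
--
-- In a homogeneous countable model ∞ cannot be told from large finite levels, so
-- every element generated by the types of finite level is unaffected by trading
-- one for the other; since every n-tuple can be approximated by one with finite
-- levels only, those types are the atoms.  The generated set algebra is therefore
-- atomic and representable although the model has level ∞.  Its completion has
-- only the finite levels, and there a base that admits all tints leads to four
-- apexes as soon as n + 3 coordinates are available: in a dilation, in a basis,
-- or in a diagonal-free representation, where the diagonal elements serve as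
-- relations between coordinates.

open import Defs
open import Level using (Level; 0ℓ; Lift; lift; lower) renaming (_⊔_ to _⊔ˡ_; suc to lsuc)
open import Axiom.ExcludedMiddle using (ExcludedMiddle)
open import Algebra.Lattice.Bundles using (BooleanAlgebra)
open import Algebra.Lattice.Structures using (IsBooleanAlgebra)
open import Data.Bool using (Bool; true; false; T; not; _∨_; _xor_; if_then_else_)
open import Data.Bool.Properties using (∨-comm; ∨-assoc; not-involutive; xor-comm) renaming (_≟_ to _≟ᵇ_)
open import Data.Empty using (⊥; ⊥-elim)
open import Data.Fin using (Fin; zero; suc; toℕ; fromℕ<; inject≤)
open import Data.Fin.Permutation.Components using (transpose)
open import Data.Fin.Properties using (toℕ-injective; toℕ<n; toℕ-fromℕ<; toℕ-inject≤; pigeonhole; suc-injective; inject≤-injective) renaming (_≟_ to _≟ᶠ_)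
open import Data.Nat using (ℕ; zero; suc; _≤_; _<_; z≤n; s≤s; z<s; s<s; _⊔_)
open import Data.Nat.Properties using (≤-refl; ≤-trans; ≤-reflexive; ≤-antisym; <-trans; <-≤-trans; ≤-<-trans; <⇒≤; <⇒≢; <-irrefl; <-cmp; n<1+n; m≤n⇒m≤1+n; m≤n⇒m<n∨m≡n; m≤m⊔n; m≤n⊔m; ⊔-lub; m≤m+n; m≤n+m; m<m+n; +-suc; +-identityʳ; +-monoʳ-≤; _<?_) renaming (_≟_ to _≟ⁿ_)
open import Data.Nat.Induction using (<-rec)
open import Data.Maybe using (Maybe; just; nothing)
open import Data.Maybe.Properties using (just-injective)
open import Data.Product using (Σ; Σ-syntax; _×_; _,_; proj₁; proj₂)
open import Data.Sum using (_⊎_; inj₁; inj₂) renaming (map to ⊎-map)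
open import Data.Unit using (⊤; tt)
open import Data.Vec using (Vec; []; _∷_; lookup; map; tabulate)
open import Data.Vec.Functional using (updateAt)
open import Data.Vec.Functional.Properties using (updateAt-updates; updateAt-minimal)
open import Data.Vec.Properties using (lookup-map; lookup∘tabulate; map-cong; map-∘; tabulate∘lookup; tabulate-cong; tabulate-∘)
open import Function using (_∘_; const; id; case_of_)
open import Relation.Binary.Definitions using (tri<; tri≈; tri>)
open import Relation.Binary.PropositionalEquality using (_≡_; _≢_; _≗_; refl; sym; trans; cong; cong₂; subst; subst₂)
open import Relation.Binary.Structures using (IsEquivalence)
open import Relation.Nullary using (¬_; Dec; yes; no; does)
open import Relation.Unary using (Pred; _∈_)
import Data.Nat as ℕ
import Data.Sum
import Data.Product
import Data.Nat.Properties as ℕₚ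
import Algebra.Lattice.Properties.BooleanAlgebra as BAP
import Relation.Binary.Reasoning.Setoid as SetoidReasoning

unpair : ℕ → ℕ × ℕ
unpair zero    = 0 , 0
unpair (suc c) with unpair c
... | zero  , b = suc b , 0
... | suc a , b = a , suc b

unpair-sum≤ : ∀ c → proj₁ (unpair c) ℕ.+ proj₂ (unpair c) ≤ c
unpair-sum≤ zero    = z≤n
unpair-sum≤ (suc c) with unpair c | unpair-sum≤ c
... | zero  , b | le rewrite +-identityʳ b = s≤s le
... | suc a , b | le rewrite +-suc a b = m≤n⇒m≤1+n le

unpair-surjective : ∀ a b → Σ[ c ∈ ℕ ] unpair c ≡ (a , b)
unpair-surjective a b = go (a ℕ.+ b) a b refl
  where
  go : ∀ s a b → a ℕ.+ b ≡ s → Σ[ c ∈ ℕ ] unpair c ≡ (a , b)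
  go s a (suc b) e with go s (suc a) b (trans (sym (+-suc a b)) e)
  ... | c , eq = suc c , step c eq
    where
    step : ∀ c → unpair c ≡ (suc a , b) → unpair (suc c) ≡ (a , suc b)
    step c p with unpair c
    step c refl | _ = refl
  go s zero zero e = 0 , refl
  go (suc s) (suc a) zero e with go s zero a (trans (sym (+-identityʳ a)) (ℕₚ.suc-injective e))
  ... | c , eq = suc c , step c eq
    where
    step : ∀ c → unpair c ≡ (zero , a) → unpair (suc c) ≡ (suc a , zero)
    step c p with unpair c
    step c refl | _ = refl

opaque
  nth : ℕ → ℕ → ℕ
  nth c zero    = proj₁ (unpair c)
  nth c (suc i) = nth (proj₂ (unpair c)) i

  nth-surjective : ∀ {N} (f : Fin N → ℕ) → Σ[ c ∈ ℕ ] (∀ i → nth c (toℕ i) ≡ f i)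
  nth-surjective {zero}  f = 0 , λ ()
  nth-surjective {suc N} f with nth-surjective (f ∘ suc)
  ... | d , p with unpair-surjective (f zero) d
  ... | c , q = c , λ { zero → cong proj₁ q ; (suc i) → trans (cong (λ x → nth (proj₂ x) (toℕ i)) q) (p i) }

  table : ∀ {N j} → ℕ → Vec (Fin N) j → ℕ
  table c []       = c
  table c (x ∷ xs) = table (nth c (toℕ x)) xs

  table-surjective : ∀ {N} j (f : Vec (Fin N) j → ℕ) → Σ[ c ∈ ℕ ] (∀ v → table c v ≡ f v)
  table-surjective zero    f = f [] , λ { [] → refl }
  table-surjective (suc j) f with nth-surjective (λ x → proj₁ (table-surjective j (λ v → f (x ∷ v))))
  ... | c , p = c , λ { (x ∷ v) → trans (cong (λ d → table d v) (p x)) (proj₂ (table-surjective j (λ v → f (x ∷ v))) v) }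

Enumerable : ∀ {a} → Set a → Set a
Enumerable A = Σ[ f ∈ (ℕ → A) ] (∀ a → Σ[ c ∈ ℕ ] f c ≡ a)

opaque
  enum-image : ∀ {a b} {A : Set a} {B : Set b} (g : A → B) → (∀ b → Σ[ a ∈ A ] g a ≡ b) → Enumerable A → Enumerable B
  enum-image g s (f , p) = g ∘ f , λ b → let (a , q) = s b ; (c , r) = p a in c , trans (cong g r) q

  enum-ℕ : Enumerable ℕ
  enum-ℕ = id , λ c → c , refl

  enum-× : ∀ {a b} {A : Set a} {B : Set b} → Enumerable A → Enumerable B → Enumerable (A × B)
  enum-× (f , p) (g , q) = (λ c → f (proj₁ (unpair c)) , g (proj₂ (unpair c))) , λ (a , b) →
    let (i , r) = p a ; (j , s) = q b ; (c , t) = unpair-surjective i j in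
    c , cong₂ _,_ (trans (cong (f ∘ proj₁) t) r) (trans (cong (g ∘ proj₂) t) s)

  enum-Fin : ∀ {m} → Enumerable (Fin (suc m))
  enum-Fin {m} = f , λ i → toℕ i , f-toℕ i
    where
    f : ∀ {m} → ℕ → Fin (suc m)
    f {m}     zero    = zero
    f {zero}  (suc c) = zero
    f {suc m} (suc c) = suc (f c)
    f-toℕ : ∀ {m} (i : Fin (suc m)) → f (toℕ i) ≡ i
    f-toℕ zero            = refl
    f-toℕ {suc m} (suc i) = cong suc (f-toℕ i)

  enum-Bool : Enumerable Bool
  enum-Bool = enum-image (λ { zero → false ; (suc _) → true }) (λ { false → 0 , refl ; true → 1 , refl }) enum-ℕ

  enum-Vec : ∀ {a} {A : Set a} → Enumerable A → ∀ m → Enumerable (Vec A m)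
  enum-Vec e zero    = (λ _ → []) , λ { [] → 0 , refl }
  enum-Vec e (suc m) = enum-image (λ (x , v) → x ∷ v) (λ { (x ∷ v) → (x , v) , refl }) (enum-× e (enum-Vec e m))

  enum-⊎ : ∀ {a b} {A : Set a} {B : Set b} → Enumerable A → Enumerable B → Enumerable (A ⊎ B)
  enum-⊎ {A = A} {B} e f = enum-image g (λ { (inj₁ x) → (false , x , proj₁ f 0) , refl ; (inj₂ y) → (true , proj₁ e 0 , y) , refl }) (enum-× enum-Bool (enum-× e f))
    where
    g : Bool × A × B → A ⊎ B
    g (false , x , _) = inj₁ x
    g (true  , _ , y) = inj₂ y

opaque
  bounded : ∀ {N} (f : Fin N → ℕ) → Σ[ L ∈ ℕ ] (∀ i → f i ≤ L)
  bounded {zero}  f = 0 , λ ()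
  bounded {suc N} f with bounded (f ∘ suc)
  ... | L , p = f zero ⊔ L , λ { zero → m≤m⊔n _ _ ; (suc i) → ≤-trans (p i) (m≤n⊔m (f zero) L) }

  boundedᵛ : ∀ {N} j (f : Vec (Fin N) j → ℕ) → Σ[ L ∈ ℕ ] (∀ v → f v ≤ L)
  boundedᵛ zero    f = f [] , λ { [] → ≤-refl }
  boundedᵛ (suc j) f with bounded (λ x → proj₁ (boundedᵛ j (λ v → f (x ∷ v))))
  ... | L , p = L , λ { (x ∷ v) → ≤-trans (proj₂ (boundedᵛ j (λ v → f (x ∷ v))) v) (p x) }

lookup-ext : ∀ {a} {A : Set a} {m} (u v : Vec A m) → (∀ i → lookup u i ≡ lookup v i) → u ≡ v
lookup-ext u v e = trans (sym (tabulate∘lookup u)) (trans (tabulate-cong e) (tabulate∘lookup v))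

map-local : ∀ {a b} {A : Set a} {B : Set b} {m} (f g : A → B) (v : Vec A m) →
            (∀ r → f (lookup v r) ≡ g (lookup v r)) → map f v ≡ map g v
map-local f g v e = lookup-ext _ _ λ r → trans (lookup-map r f v) (trans (e r) (sym (lookup-map r g v)))

update-≡ : ∀ {a} {A : Set a} {n} (f : Fin n → A) i z → updateAt f i (const z) i ≡ z
update-≡ f i z = updateAt-updates i f

update-≢ : ∀ {a} {A : Set a} {n} (f : Fin n → A) {i j} z → j ≢ i → updateAt f i (const z) j ≡ f j
update-≢ f {i} {j} z j≢i = updateAt-minimal j i f j≢i

private
  place : ∀ {k} {A : Set} → Vec A k → A → A → A → A → Fin (4 ℕ.+ k) → A
  place π a b c d zero                      = a
  place π a b c d (suc zero)                = b
  place π a b c d (suc (suc zero))          = c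
  place π a b c d (suc (suc (suc zero)))    = d
  place π a b c d (suc (suc (suc (suc r)))) = lookup π r

no-four-more : ∀ {k} (π : Vec (Fin (3 ℕ.+ k)) k) → (∀ r s → lookup π r ≡ lookup π s → r ≡ s) →
               ∀ {a b c d} → a ≢ b → a ≢ c → a ≢ d → b ≢ c → b ≢ d → c ≢ d →
               (∀ r → a ≢ lookup π r) → (∀ r → b ≢ lookup π r) →
               (∀ r → c ≢ lookup π r) → (∀ r → d ≢ lookup π r) → ⊥
no-four-more {k} π inj {a} {b} {c} {d} ab ac ad bc bd cd a∉ b∉ c∉ d∉
  with pigeonhole (n<1+n (3 ℕ.+ k)) (place π a b c d)
... | i , j , i<j , e = clash i j i<j e
  where
  clash : ∀ i j → toℕ i < toℕ j → place π a b c d i ≡ place π a b c d j → ⊥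
  clash zero (suc zero) _ = ab
  clash zero (suc (suc zero)) _ = ac
  clash zero (suc (suc (suc zero))) _ = ad
  clash zero (suc (suc (suc (suc r)))) _ = a∉ r
  clash (suc zero) (suc (suc zero)) _ = bc
  clash (suc zero) (suc (suc (suc zero))) _ = bd
  clash (suc zero) (suc (suc (suc (suc r)))) _ = b∉ r
  clash (suc (suc zero)) (suc (suc (suc zero))) _ = cd
  clash (suc (suc zero)) (suc (suc (suc (suc r)))) _ = c∉ r
  clash (suc (suc (suc zero))) (suc (suc (suc (suc r)))) _ = d∉ r
  clash (suc (suc (suc (suc r)))) (suc (suc (suc (suc s)))) lt e with inj r s e
  ... | refl = <-irrefl refl lt
  clash (suc zero) (suc zero) (s≤s ())
  clash (suc (suc zero)) (suc zero) (s≤s ())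
  clash (suc (suc zero)) (suc (suc zero)) (s≤s (s≤s ()))
  clash (suc (suc (suc zero))) (suc zero) (s≤s ())
  clash (suc (suc (suc zero))) (suc (suc zero)) (s≤s (s≤s ()))
  clash (suc (suc (suc zero))) (suc (suc (suc zero))) (s≤s (s≤s (s≤s ())))
  clash (suc (suc (suc (suc r)))) (suc zero) (s≤s ())
  clash (suc (suc (suc (suc r)))) (suc (suc zero)) (s≤s (s≤s ()))
  clash (suc (suc (suc (suc r)))) (suc (suc (suc zero))) (s≤s (s≤s (s≤s ())))

-- Coloured graphs

data Part (k : ℕ) : Set where
  P : Fin k → Part k
  V : Bool → Part k
  X : Fin 4 → Part k

P-inj : ∀ {k} {r s : Fin k} → P r ≡ P s → r ≡ s
P-inj refl = refl

V-inj : ∀ {k β γ} → V {k} β ≡ V γ → β ≡ γ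
V-inj refl = refl

X-inj : ∀ {k s t} → X {k} s ≡ X t → s ≡ t
X-inj refl = refl

not-≢ : ∀ β → not β ≢ β
not-≢ false ()
not-≢ true  ()

-- Between two X-nodes nil and w1 are the two whites, red i l is the red of
-- parity i on level l, and inf is the red of level ∞.  Between an X-node and a
-- V-node on means that the X-node is an apex over the V-node.  Between two
-- V-nodes lab S admits the apexes of tint in S.
data Col : Set where
  nil on w1 inf : Col
  lab : Vec Bool 4 → Col
  red : Bool → ℕ → Col

white : Bool → Col
white false = nil
white true  = w1

_∈ˡ_ : Fin 4 → Col → Set
s ∈ˡ lab S = T (lookup S s)
s ∈ˡ _     = ⊥

data IsRed : Col → Set where
  inf : IsRed inf
  red : ∀ {i l} → IsRed (red i l)

-- The parity required of three reds of one finite level.  The four triples of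
-- Fin 4 have odd total, so no assignment of parities to its six pairs works.
isThree : Fin 4 → Bool
isThree (suc (suc (suc zero))) = true
isThree _                      = false

ε : Fin 4 → Fin 4 → Fin 4 → Bool
ε s t u = not (isThree s ∨ (isThree t ∨ isThree u))

data Match (e : Bool) : Col → Col → Col → Set where
  inf : Match e inf inf inf
  red : ∀ {i j m l} → i xor (j xor m) ≡ e → Match e (red i l) (red j l) (red m l)

data Fit {k} : Part k → Part k → Col → Set where
  nil : ∀ {p q} → Fit p q nil
  onˡ : ∀ {s β} → Fit (X s) (V β) on
  onʳ : ∀ {s β} → Fit (V β) (X s) on
  lab : ∀ {β S} → Fit (V β) (V (not β)) (lab S)
  w1  : ∀ {s t} → s ≢ t → Fit (X s) (X t) w1
  inf : ∀ {s t} → s ≢ t → Fit (X s) (X t) inf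
  red : ∀ {s t i l} → s ≢ t → Fit (X s) (X t) (red i l)

xor-swap : ∀ a b c → a xor (b xor c) ≡ b xor (a xor c)
xor-swap false b c = refl
xor-swap true false c = refl
xor-swap true true c = refl

ε-swapˡ : ∀ s t u → ε s t u ≡ ε t s u
ε-swapˡ s t u = cong not (trans (sym (∨-assoc a b c)) (trans (cong (_∨ c) (∨-comm a b)) (∨-assoc b a c)))
  where a = isThree s ; b = isThree t ; c = isThree u

ε-swapʳ : ∀ s t u → ε s t u ≡ ε s u t
ε-swapʳ s t u = cong (λ x → not (isThree s ∨ x)) (∨-comm (isThree t) (isThree u))

Match-swapˡ : ∀ s t u {a b c} → Match (ε s t u) a b c → Match (ε t s u) a c b
Match-swapˡ s t u inf = inf
Match-swapˡ s t u (red {i} {j} {m} e) = red (trans (cong (i xor_) (xor-comm m j)) (trans e (ε-swapˡ s t u)))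

Match-swapʳ : ∀ s t u {a b c} → Match (ε s t u) a b c → Match (ε s u t) b a c
Match-swapʳ s t u inf = inf
Match-swapʳ s t u (red {i} {j} {m} e) = red (trans (xor-swap j i m) (trans e (ε-swapʳ s t u)))

module _ {k : ℕ} where

  -- T1 makes an edge between two apexes over both nodes of a base red.  I4 keeps
  -- it on level ∞ unless the base admits no third tint.

  T1 : (p q r : Part k) (pq pr qr : Col) → Set
  T1 p q r pq pr qr = ∀ {s t β} → p ≡ X s → q ≡ X t → s ≢ t → r ≡ V β →
                      pr ≡ on → qr ≡ on → pq ≢ white β

  T3 : (p q r : Part k) (pq pr qr : Col) → Set
  T3 p q r pq pr qr = ∀ {s β} → p ≡ X s → q ≡ V β → r ≡ V (not β) →
                      pq ≡ on → pr ≡ on → s ∈ˡ qr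

  T4 : (p q r : Part k) (pq pr qr : Col) → Set
  T4 p q r pq pr qr = ∀ {s t u} → p ≡ X s → q ≡ X t → r ≡ X u →
                      IsRed pq → IsRed pr → IsRed qr → Match (ε s t u) pq pr qr

  I4 : (p p′ q q′ : Part k) (pp′ pq pq′ p′q p′q′ qq′ : Col) → Set
  I4 p p′ q q′ pp′ pq pq′ p′q p′q′ qq′ =
    ∀ {s t β i l} → p ≡ X s → p′ ≡ X t → q ≡ V β → q′ ≡ V (not β) →
    pq ≡ on → pq′ ≡ on → p′q ≡ on → p′q′ ≡ on → pp′ ≡ red i l →
    ∀ u → u ∈ˡ qq′ → u ≡ s ⊎ u ≡ t

  T1-swap : ∀ {p q r a b c} → T1 p q r a b c → T1 q p r a c b
  T1-swap h p q s≢t r b c = h q p (s≢t ∘ sym) r c b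

  T4-swapˡ : ∀ {p q r a b c} → T4 p q r a b c → T4 q p r a c b
  T4-swapˡ h {s} {t} {u} p q r a b c = Match-swapˡ t s u (h q p r a c b)

  T4-swapʳ : ∀ {p q r a b c} → T4 p q r a b c → T4 p r q b a c
  T4-swapʳ h {s} {t} {u} p q r a b c = Match-swapʳ s u t (h p r q b a c)

  Fit-sym : ∀ {p q : Part k} {c} → Fit p q c → Fit q p c
  Fit-sym nil = nil
  Fit-sym onˡ = onʳ
  Fit-sym onʳ = onˡ
  Fit-sym (lab {β} {S}) = subst (λ γ → Fit (V (not β)) (V γ) (lab S)) (not-involutive β) lab
  Fit-sym (w1 e) = w1 (e ∘ sym)
  Fit-sym (inf e) = inf (e ∘ sym)
  Fit-sym (red e) = red (e ∘ sym)

  record IsGraph (part : ℕ → Part k) (e : ℕ → ℕ → Col) (N : ℕ) : Set where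
    field
      symmetric : ∀ x y → e x y ≡ e y x
      irrefl    : ∀ x → e x x ≡ nil
      fit : ∀ x y → x < N → y < N → x ≢ y → Fit (part x) (part y) (e x y)
      t1  : ∀ x y v → x < N → y < N → v < N → T1 (part x) (part y) (part v) (e x y) (e x v) (e y v)
      t3  : ∀ x v w → x < N → v < N → w < N → T3 (part x) (part v) (part w) (e x v) (e x w) (e v w)
      t4  : ∀ x y z → x < N → y < N → z < N → T4 (part x) (part y) (part z) (e x y) (e x z) (e y z)
      i4  : ∀ x y v w → x < N → y < N → v < N → w < N →
            I4 (part x) (part y) (part v) (part w) (e x y) (e x v) (e x w) (e y v) (e y w) (e v w)

  open IsGraph

  module GraphStep (em : ∀ {ℓ} → ExcludedMiddle ℓ)
                   (part : ℕ → Part k) (e : ℕ → ℕ → Col) (z : ℕ) (wish : ℕ → Maybe Col)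
                   (G : IsGraph part e z) where

    Wished : ℕ → Col → Set
    Wished y c = y < z × wish y ≡ just c

    record Good : Set where
      field
        few  : ∀ {x y v a b c} → Wished x a → Wished y b → Wished v c → x ≢ y → x ≢ v → y ≢ v → ⊥
        fitᵍ : ∀ {y c} → Wished y c → Fit (part z) (part y) c
        tri  : ∀ {x y a b} → x ≢ y → Wished x a → Wished y b →
               T1 (part z) (part x) (part y) a b (e x y) × T1 (part x) (part y) (part z) (e x y) a b ×
               T3 (part z) (part x) (part y) a b (e x y) × T3 (part x) (part z) (part y) a (e x y) b ×
               T4 (part z) (part x) (part y) a b (e x y)

    -- Between X-nodes an edge not asked for is as light as T1 allows, hence on
    -- level ∞ when it has to be red; a label not asked for is as small as T3 allows.
    Joined : Bool → ℕ → Set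
    Joined β y = Σ[ v ∈ ℕ ] Wished v on × part v ≡ V β × e y v ≡ on

    Touches : ℕ → Fin 4 → Set
    Touches y s = Σ[ x ∈ ℕ ] Wished x on × part x ≡ X s × e x y ≡ on

    data Default (y : ℕ) : Col → Set where
      plain : (∀ {s t} → part z ≡ X s → part y ≡ X t → s ≢ t → ⊥) →
              (∀ {β} → part z ≡ V β → part y ≡ V (not β) → ⊥) → Default y nil
      apart : ∀ {s t} → part z ≡ X s → part y ≡ X t → s ≢ t → ¬ Joined false y → Default y nil
      w1    : ∀ {s t} → part z ≡ X s → part y ≡ X t → s ≢ t → Joined false y → ¬ Joined true y → Default y w1
      inf   : ∀ {s t} → part z ≡ X s → part y ≡ X t → s ≢ t → Joined false y → Joined true y → Default y inf
      lab   : ∀ {β} S → part z ≡ V β → part y ≡ V (not β) →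
              (∀ s → T (lookup S s) → Touches y s) → (∀ s → Touches y s → T (lookup S s)) → Default y (lab S)

    default : ∀ y → Σ Col (Default y)
    default y with part z in pz | part y in py
    ... | X s | X t with s ≟ᶠ t
    ...   | yes refl = nil , plain (λ p q s≢t → s≢t (X-inj (trans (sym p) (trans pz (trans (sym py) q))))) (λ p → case trans (sym pz) p of λ ())
    ...   | no s≢t with em {P = Joined false y} | em {P = Joined true y}
    ...     | no ¬a | _     = nil , apart pz py s≢t ¬a
    ...     | yes a | no ¬b = w1 , w1 pz py s≢t a ¬b
    ...     | yes a | yes b = inf , inf pz py s≢t a b
    default y | V β | V γ with γ ≟ᵇ not β
    ...   | yes refl = lab S , lab S pz py to from
      where
      S : Vec Bool 4
      S = tabulate λ s → does (em {P = Touches y s})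
      to : ∀ s → T (lookup S s) → Touches y s
      to s h rewrite lookup∘tabulate (λ s → does (em {P = Touches y s})) s with em {P = Touches y s}
      ... | yes b = b
      ... | no _  = ⊥-elim h
      from : ∀ s → Touches y s → T (lookup S s)
      from s h rewrite lookup∘tabulate (λ s → does (em {P = Touches y s})) s with em {P = Touches y s}
      ... | yes b = tt
      ... | no ¬b = ¬b h
    ...   | no γ≢ = nil , plain (λ p → case trans (sym pz) p of λ ())
                      (λ p q → γ≢ (trans (V-inj (trans (sym py) q)) (cong not (V-inj (trans (sym p) pz)))))
    default y | P _ | _   = nil , plain (λ p → case trans (sym pz) p of λ ()) (λ p → case trans (sym pz) p of λ ())
    default y | X _ | P _ = nil , plain (λ _ p → case trans (sym py) p of λ ()) (λ p → case trans (sym pz) p of λ ())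
    default y | X _ | V _ = nil , plain (λ _ p → case trans (sym py) p of λ ()) (λ p → case trans (sym pz) p of λ ())
    default y | V _ | P _ = nil , plain (λ p → case trans (sym pz) p of λ ()) (λ _ p → case trans (sym py) p of λ ())
    default y | V _ | X _ = nil , plain (λ p → case trans (sym pz) p of λ ()) (λ _ p → case trans (sym py) p of λ ())

    data Row (y : ℕ) : Col → Set where
      bad  : ¬ Good → Row y nil
      granted : ∀ {c} → Good → wish y ≡ just c → Row y c
      dflt : ∀ {c} → Good → wish y ≡ nothing → Default y c → Row y c

    row : ∀ y → Σ Col (Row y)
    row y with em {P = Good}
    ... | no ¬g = nil , bad ¬g
    ... | yes g with wish y in eq
    ...   | just c  = c , granted g eq
    ...   | nothing = proj₁ (default y) , dflt g eq (proj₂ (default y))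

    good-on : ∀ {y} → Row y on → Good × wish y ≡ just on
    good-on (granted g w) = g , w

    good-red : ∀ {y i l} → Row y (red i l) → Good × wish y ≡ just (red i l)
    good-red (granted g w) = g , w

    row-fit : ∀ {y c} → y < z → Row y c → Fit (part z) (part y) c
    row-fit lt (bad _)       = nil
    row-fit lt (granted g w) = Good.fitᵍ g (lt , w)
    row-fit lt (dflt _ _ (plain _ _))        = nil
    row-fit lt (dflt _ _ (apart _ _ _ _))    = nil
    row-fit lt (dflt _ _ (w1 p q s≢t _ _))   = subst₂ (λ a b → Fit a b w1) (sym p) (sym q) (w1 s≢t)
    row-fit lt (dflt _ _ (inf p q s≢t _ _))  = subst₂ (λ a b → Fit a b inf) (sym p) (sym q) (inf s≢t)
    row-fit lt (dflt _ _ (lab S p q _ _))    = subst₂ (λ a b → Fit a b (lab S)) (sym p) (sym q) lab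

    parts-≢ : ∀ {x y p q} → part x ≡ p → part y ≡ q → p ≢ q → x ≢ y
    parts-≢ px py p≢q refl = p≢q (trans (sym px) py)

    new-T1ᵛ : ∀ {x y a b} → x < z → y < z → Row x a → Row y b →
              T1 (part x) (part y) (part z) (e x y) a b
    new-T1ᵛ x< y< rx ry px py s≢t pz refl refl with good-on rx | good-on ry
    ... | g , wx | _ , wy = proj₁ (proj₂ (Good.tri g (parts-≢ px py (s≢t ∘ X-inj)) (x< , wx) (y< , wy))) px py s≢t pz refl refl

    new-T1ˣ : ∀ {y v a b} → y < z → v < z → Row y a → Row v b →
              T1 (part z) (part y) (part v) a b (e y v)
    new-T1ˣ y< v< ry rv pz py s≢t pv refl ev with good-on rv
    new-T1ˣ y< v< (bad ¬g) rv pz py s≢t pv refl ev | g , wv = ⊥-elim (¬g g)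
    new-T1ˣ y< v< (granted _ wy) rv pz py s≢t pv refl ev | g , wv =
      proj₁ (Good.tri g (parts-≢ py pv (λ ())) (y< , wy) (v< , wv)) pz py s≢t pv refl ev
    new-T1ˣ y< v< (dflt _ _ (plain ¬x _)) rv pz py s≢t pv refl ev | _ = λ _ → ¬x pz py s≢t
    new-T1ˣ {v = v} y< v< (dflt _ _ (apart _ _ _ ¬j)) rv {β = false} pz py s≢t pv refl ev | _ , wv = λ _ → ¬j (v , (v< , wv) , pv , ev)
    new-T1ˣ y< v< (dflt _ _ (apart _ _ _ ¬j)) rv {β = true} pz py s≢t pv refl ev | _ = λ ()
    new-T1ˣ y< v< (dflt _ _ (w1 _ _ _ _ ¬j)) rv {β = false} pz py s≢t pv refl ev | _ = λ ()
    new-T1ˣ {v = v} y< v< (dflt _ _ (w1 _ _ _ _ ¬j)) rv {β = true} pz py s≢t pv refl ev | _ , wv = λ _ → ¬j (v , (v< , wv) , pv , ev)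
    new-T1ˣ y< v< (dflt _ _ (inf _ _ _ _ _)) rv {β = false} pz py s≢t pv refl ev | _ = λ ()
    new-T1ˣ y< v< (dflt _ _ (inf _ _ _ _ _)) rv {β = true} pz py s≢t pv refl ev | _ = λ ()
    new-T1ˣ y< v< (dflt _ _ (lab _ pz′ _ _ _)) rv pz py s≢t pv refl ev | _ = case trans (sym pz) pz′ of λ ()

    new-T3ˣ : ∀ {v w a b} → v < z → w < z → Row v a → Row w b →
              T3 (part z) (part v) (part w) a b (e v w)
    new-T3ˣ v< w< rv rw pz pv pw refl refl with good-on rv | good-on rw
    ... | g , wv | _ , ww =
      proj₁ (proj₂ (proj₂ (Good.tri g (parts-≢ pv pw (λ q → not-≢ _ (sym (V-inj q)))) (v< , wv) (w< , ww)))) pz pv pw refl refl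

    new-T3ᵛ : ∀ {x w a b} → x < z → w < z → Row x a → Row w b →
              T3 (part x) (part z) (part w) a (e x w) b
    new-T3ᵛ x< w< rx rw px pz pw refl ew with good-on rx
    new-T3ᵛ x< w< rx (bad ¬g) px pz pw refl ew | g , wx = ⊥-elim (¬g g)
    new-T3ᵛ x< w< rx (granted _ ww) px pz pw refl ew | g , wx =
      proj₁ (proj₂ (proj₂ (proj₂ (Good.tri g (parts-≢ px pw (λ ())) (x< , wx) (w< , ww))))) px pz pw refl ew
    new-T3ᵛ x< w< rx (dflt _ _ (plain _ ¬v)) px pz pw refl ew | _ = ⊥-elim (¬v pz pw)
    new-T3ᵛ x< w< rx (dflt _ _ (apart pz′ _ _ _)) px pz pw refl ew | _ = case trans (sym pz) pz′ of λ ()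
    new-T3ᵛ x< w< rx (dflt _ _ (w1 pz′ _ _ _ _)) px pz pw refl ew | _ = case trans (sym pz) pz′ of λ ()
    new-T3ᵛ x< w< rx (dflt _ _ (inf pz′ _ _ _ _)) px pz pw refl ew | _ = case trans (sym pz) pz′ of λ ()
    new-T3ᵛ {x} x< w< rx (dflt _ _ (lab S _ _ _ from)) px pz pw refl ew | _ , wx = from _ (x , (x< , wx) , px , ew)


    red-≢ : ∀ {x y} → IsRed (e x y) → x ≢ y
    red-≢ {x} r refl rewrite irrefl G x = case r of λ ()

    new-T4 : ∀ {x y a b} → x < z → y < z → Row x a → Row y b →
             T4 (part z) (part x) (part y) a b (e x y)
    new-T4 x< y< (granted g wx) (granted _ wy) pz px py ra rb rc =
      proj₂ (proj₂ (proj₂ (proj₂ (Good.tri g (red-≢ rc) (x< , wx) (y< , wy))))) pz px py ra rb rc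
    new-T4 x< y< (granted _ wx) (dflt g _ (inf _ _ _ (v , wv , pv , _) (w , ww , pw , _))) pz px py ra rb rc =
      ⊥-elim (Good.few g (x< , wx) wv ww (parts-≢ px pv (λ ())) (parts-≢ px pw (λ ())) (parts-≢ pv pw (λ ())))
    new-T4 x< y< (dflt g _ (inf _ _ _ (v , wv , pv , _) (w , ww , pw , _))) (granted _ wy) pz px py ra rb rc =
      ⊥-elim (Good.few g (y< , wy) wv ww (parts-≢ py pv (λ ())) (parts-≢ py pw (λ ())) (parts-≢ pv pw (λ ())))
    new-T4 {x} {y} x< y< (dflt g _ (inf pz₁ px₁ s≢t (v , wv , pv , ev) (w , ww , pw , ew)))
                         (dflt _ _ (inf pz₂ py₂ s≢u (v′ , wv′ , pv′ , ev′) (w′ , ww′ , pw′ , ew′))) pz px py ra rb rc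
      with v ≟ⁿ v′ | w ≟ⁿ w′
    ... | no v≢ | _ = ⊥-elim (Good.few g wv wv′ ww v≢ (parts-≢ pv pw (λ ())) (parts-≢ pv′ pw (λ ())))
    ... | yes _ | no w≢ = ⊥-elim (Good.few g ww ww′ wv w≢ (parts-≢ pw pv (λ ())) (parts-≢ pw′ pv (λ ())))
    ... | yes refl | yes refl with e x y in exy
    ...   | inf = inf
    ...   | red i l with i4 G x y v w x< y< (proj₁ wv) (proj₁ ww) px py pv pw ev ew ev′ ew′ exy _
                         (proj₁ (proj₂ (proj₂ (Good.tri g (parts-≢ pv pw (λ ())) wv ww))) pz pv pw refl refl)
    ...     | inj₁ s≡t = ⊥-elim (s≢t (trans (X-inj (trans (sym pz₁) pz)) (trans s≡t (X-inj (trans (sym px) px₁)))))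
    ...     | inj₂ s≡u = ⊥-elim (s≢u (trans (X-inj (trans (sym pz₂) pz)) (trans s≡u (X-inj (trans (sym py) py₂)))))
    new-T4 x< y< (bad _) rb pz px py () _ _
    new-T4 x< y< (dflt _ _ (plain _ _)) rb pz px py () _ _
    new-T4 x< y< (dflt _ _ (apart _ _ _ _)) rb pz px py () _ _
    new-T4 x< y< (dflt _ _ (w1 _ _ _ _ _)) rb pz px py () _ _
    new-T4 x< y< (dflt _ _ (lab _ _ _ _ _)) rb pz px py () _ _
    new-T4 x< y< (granted _ _) (bad _) pz px py _ () _
    new-T4 x< y< (granted _ _) (dflt _ _ (plain _ _)) pz px py _ () _
    new-T4 x< y< (granted _ _) (dflt _ _ (apart _ _ _ _)) pz px py _ () _
    new-T4 x< y< (granted _ _) (dflt _ _ (w1 _ _ _ _ _)) pz px py _ () _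
    new-T4 x< y< (granted _ _) (dflt _ _ (lab _ _ _ _ _)) pz px py _ () _
    new-T4 x< y< (dflt _ _ (inf _ _ _ _ _)) (bad _) pz px py _ () _
    new-T4 x< y< (dflt _ _ (inf _ _ _ _ _)) (dflt _ _ (plain _ _)) pz px py _ () _
    new-T4 x< y< (dflt _ _ (inf _ _ _ _ _)) (dflt _ _ (apart _ _ _ _)) pz px py _ () _
    new-T4 x< y< (dflt _ _ (inf _ _ _ _ _)) (dflt _ _ (w1 _ _ _ _ _)) pz px py _ () _
    new-T4 x< y< (dflt _ _ (inf _ _ _ _ _)) (dflt _ _ (lab _ _ _ _ _)) pz px py _ () _

    new-I4ˣ : ∀ {y v w a b c d} → y < z → v < z → w < z → Row y a → Row v b → Row w c →
              ∀ {a′ b′} → I4 (part z) (part y) (part v) (part w) a b c a′ b′ d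
    new-I4ˣ y< v< w< ry rv rw pz py pv pw refl refl _ _ refl with good-red ry | good-on rv | good-on rw
    ... | g , wy | _ , wv | _ , ww = λ _ _ →
      ⊥-elim (Good.few g (y< , wy) (v< , wv) (w< , ww) (parts-≢ py pv (λ ())) (parts-≢ py pw (λ ()))
                       (parts-≢ pv pw (λ q → not-≢ _ (sym (V-inj q)))))

    new-I4ᵛ : ∀ {x y w a b c} → x < z → y < z → w < z → Row x a → Row y b → Row w c →
              I4 (part x) (part y) (part z) (part w) (e x y) a (e x w) b (e y w) c
    new-I4ᵛ {x} {y} {w} x< y< w< rx ry rw px py pz pw refl ex refl ey exy u u∈ with good-on rx | good-on ry
    ... | g , wx | _ , wy = go rw u∈
      where
      x≢y : x ≢ y
      x≢y = red-≢ (subst IsRed (sym exy) red)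
      go : ∀ {c} → Row w c → u ∈ˡ c → _
      go (bad ¬g) _ = ⊥-elim (¬g g)
      go (granted _ ww) _ = ⊥-elim (Good.few g (x< , wx) (y< , wy) (w< , ww) x≢y (parts-≢ px pw (λ ())) (parts-≢ py pw (λ ())))
      go (dflt _ _ (lab S _ _ to _)) u∈S with to u u∈S
      ... | x″ , w″ , p″ , _ with x″ ≟ⁿ x | x″ ≟ⁿ y
      ...   | yes refl | _ = inj₁ (X-inj (trans (sym p″) px))
      ...   | no _ | yes refl = inj₂ (X-inj (trans (sym p″) py))
      ...   | no ≢x | no ≢y = ⊥-elim (Good.few g w″ (x< , wx) (y< , wy) ≢x ≢y x≢y)

    private
      flip-V : ∀ {p : Part k} β → p ≡ V β → p ≡ V (not (not β))
      flip-V β e = trans e (cong V (sym (not-involutive β)))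

    new-T3ʷ : ∀ {x v a b} → x < z → v < z → Row x a → Row v b →
              T3 (part x) (part v) (part z) (e x v) a b
    new-T3ʷ x< v< rx rv {β = β} px pv pz ev onx = new-T3ᵛ x< v< rx rv px pz (flip-V β pv) onx ev

    new-I4ʸ : ∀ {x v w a b c d} → x < z → v < z → w < z → Row x a → Row v b → Row w c →
              ∀ {a′ b′} → I4 (part x) (part z) (part v) (part w) a a′ b′ b c d
    new-I4ʸ {d = d} x< v< w< rx rv rw px pz pv pw ev ew onv onw isred = λ u u∈ →
      Data.Sum.swap (new-I4ˣ {d = d} x< v< w< rx rv rw pz px pv pw onv onw ev ew isred u u∈)

    new-I4ʷ : ∀ {x y v a b c} → x < z → y < z → v < z → Row x a → Row y b → Row v c →
              I4 (part x) (part y) (part v) (part z) (e x y) (e x v) a (e y v) b c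
    new-I4ʷ x< y< v< rx ry rv {β = β} px py pv pz ev onx ev′ ony isred =
      new-I4ᵛ x< y< v< rx ry rv px py pz (flip-V β pv) onx ev ony ev′ isred

    opaque
      extend : ℕ → ℕ → Col
      extend x y with x ≟ⁿ z | y ≟ⁿ z
      ... | yes _ | yes _ = nil
      ... | yes _ | no _  = proj₁ (row y)
      ... | no _  | yes _ = proj₁ (row x)
      ... | no _  | no _  = e x y

      extend-sym : ∀ x y → extend x y ≡ extend y x
      extend-sym x y with x ≟ⁿ z | y ≟ⁿ z
      ... | yes _ | yes _ = refl
      ... | yes _ | no _  = refl
      ... | no _  | yes _ = refl
      ... | no _  | no _  = symmetric G x y

      extend-irr : ∀ x → extend x x ≡ nil
      extend-irr x with x ≟ⁿ z
      ... | yes _ = refl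
      ... | no _  = irrefl G x

      extend-old : ∀ {x y} → x < z → y < z → extend x y ≡ e x y
      extend-old {x} {y} x< y< with x ≟ⁿ z | y ≟ⁿ z
      ... | yes x≡z | _ = ⊥-elim (<⇒≢ x< x≡z)
      ... | no _ | yes y≡z = ⊥-elim (<⇒≢ y< y≡z)
      ... | no _ | no _ = refl

      extend-row : ∀ {y} → y < z → extend z y ≡ proj₁ (row y)
      extend-row {y} y< with z ≟ⁿ z | y ≟ⁿ z
      ... | no z≢z | _ = ⊥-elim (z≢z refl)
      ... | yes _ | yes y≡z = ⊥-elim (<⇒≢ y< y≡z)
      ... | yes _ | no _ = refl

    private
      r : ∀ {y} → y < z → Row y (extend z y)
      r {y} y< = subst (Row y) (sym (extend-row y<)) (proj₂ (row y))

      r′ : ∀ {y} → y < z → Row y (extend y z)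
      r′ {y} y< = subst (Row y) (extend-sym z y) (r y<)

      old : ∀ {x y} → x < z → y < z → e x y ≡ extend x y
      old x< y< = sym (extend-old x< y<)

      old-or-new : ∀ {x} → x < suc z → x < z ⊎ x ≡ z
      old-or-new (s≤s x≤z) = m≤n⇒m<n∨m≡n x≤z

      V≢V : ∀ {p q : Part k} {β} → p ≡ V β → q ≡ V (not β) → p ≢ q
      V≢V pv pw refl = not-≢ _ (sym (V-inj (trans (sym pv) pw)))


    extend-graph : IsGraph part extend (suc z)
    symmetric extend-graph = extend-sym
    irrefl    extend-graph = extend-irr
    fit extend-graph x y x< y< x≢y with old-or-new x< | old-or-new y<
    ... | inj₁ x< | inj₁ y< = subst (Fit _ _) (old x< y<) (fit G x y x< y< x≢y)
    ... | inj₁ x< | inj₂ refl = Fit-sym (row-fit x< (r′ x<))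
    ... | inj₂ refl | inj₁ y< = row-fit y< (r y<)
    ... | inj₂ refl | inj₂ refl = ⊥-elim (x≢y refl)
    t1 extend-graph x y v x< y< v< with old-or-new x< | old-or-new y< | old-or-new v<
    ... | inj₁ x< | inj₁ y< | inj₁ v< rewrite extend-old x< y< | extend-old x< v< | extend-old y< v< = t1 G x y v x< y< v<
    ... | inj₁ x< | inj₁ y< | inj₂ refl rewrite extend-old x< y< = new-T1ᵛ x< y< (r′ x<) (r′ y<)
    ... | inj₂ refl | inj₁ y< | inj₁ v< rewrite extend-old y< v< = new-T1ˣ y< v< (r y<) (r v<)
    ... | inj₁ x< | inj₂ refl | inj₁ v< rewrite extend-old x< v< = T1-swap {part z} {part x} {part v} (new-T1ˣ x< v< (r′ x<) (r v<))
    ... | inj₂ refl | inj₂ refl | _ = λ p q s≢t → ⊥-elim (s≢t (X-inj (trans (sym p) q)))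
    ... | inj₂ refl | inj₁ _ | inj₂ refl = λ p _ _ q → case trans (sym p) q of λ ()
    ... | inj₁ _ | inj₂ refl | inj₂ refl = λ _ p _ q → case trans (sym p) q of λ ()
    t3 extend-graph x v w x< v< w< with old-or-new x< | old-or-new v< | old-or-new w<
    ... | inj₁ x< | inj₁ v< | inj₁ w< rewrite extend-old x< v< | extend-old x< w< | extend-old v< w< = t3 G x v w x< v< w<
    ... | inj₂ refl | inj₁ v< | inj₁ w< rewrite extend-old v< w< = new-T3ˣ v< w< (r v<) (r w<)
    ... | inj₁ x< | inj₂ refl | inj₁ w< rewrite extend-old x< w< = new-T3ᵛ x< w< (r′ x<) (r w<)
    ... | inj₁ x< | inj₁ v< | inj₂ refl rewrite extend-old x< v< = new-T3ʷ x< v< (r′ x<) (r′ v<)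
    ... | inj₂ refl | inj₂ refl | _ = λ p q → case trans (sym p) q of λ ()
    ... | inj₂ refl | inj₁ _ | inj₂ refl = λ p _ q → case trans (sym p) q of λ ()
    ... | inj₁ _ | inj₂ refl | inj₂ refl = λ _ p q → ⊥-elim (V≢V p q refl)
    t4 extend-graph x y w x< y< w< with old-or-new x< | old-or-new y< | old-or-new w<
    ... | inj₁ x< | inj₁ y< | inj₁ w< rewrite extend-old x< y< | extend-old x< w< | extend-old y< w< = t4 G x y w x< y< w<
    ... | inj₂ refl | inj₁ y< | inj₁ w< rewrite extend-old y< w< = new-T4 y< w< (r y<) (r w<)
    ... | inj₁ x< | inj₂ refl | inj₁ w< rewrite extend-old x< w< = T4-swapˡ {part z} {part x} {part w} (new-T4 x< w< (r′ x<) (r w<))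
    ... | inj₁ x< | inj₁ y< | inj₂ refl rewrite extend-old x< y< =
            T4-swapʳ {part x} {part z} {part y} (T4-swapˡ {part z} {part x} {part y} (new-T4 x< y< (r′ x<) (r′ y<)))
    ... | inj₂ refl | inj₂ refl | _ rewrite extend-irr z = λ _ _ _ ()
    ... | inj₂ refl | inj₁ _ | inj₂ refl rewrite extend-irr z = λ _ _ _ _ ()
    ... | inj₁ _ | inj₂ refl | inj₂ refl rewrite extend-irr z = λ _ _ _ _ _ ()
    i4 extend-graph x y v w x< y< v< w< with old-or-new x< | old-or-new y< | old-or-new v< | old-or-new w<
    ... | inj₁ x< | inj₁ y< | inj₁ v< | inj₁ w<
            rewrite extend-old x< y< | extend-old x< v< | extend-old x< w< | extend-old y< v< | extend-old y< w< | extend-old v< w< =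
            i4 G x y v w x< y< v< w<
    ... | inj₂ refl | inj₁ y< | inj₁ v< | inj₁ w< rewrite extend-old v< w< = new-I4ˣ {d = e v w} y< v< w< (r y<) (r v<) (r w<)
    ... | inj₁ x< | inj₂ refl | inj₁ v< | inj₁ w< rewrite extend-old v< w< = 
            new-I4ʸ {d = e v w} x< v< w< (r′ x<) (r v<) (r w<)
    ... | inj₁ x< | inj₁ y< | inj₂ refl | inj₁ w< rewrite extend-old x< y< | extend-old x< w< | extend-old y< w< =
            new-I4ᵛ x< y< w< (r′ x<) (r′ y<) (r w<)
    ... | inj₁ x< | inj₁ y< | inj₁ v< | inj₂ refl rewrite extend-old x< y< | extend-old x< v< | extend-old y< v< =
            new-I4ʷ x< y< v< (r′ x<) (r′ y<) (r′ v<)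
    ... | inj₂ refl | inj₂ refl | _ | _ rewrite extend-irr z = λ _ _ _ _ _ _ _ _ ()
    ... | inj₂ refl | inj₁ _ | inj₂ refl | _ = λ p _ q → case trans (sym p) q of λ ()
    ... | inj₂ refl | inj₁ _ | inj₁ _ | inj₂ refl = λ p _ _ q → case trans (sym p) q of λ ()
    ... | inj₁ _ | inj₂ refl | inj₂ refl | _ = λ _ p q → case trans (sym p) q of λ ()
    ... | inj₁ _ | inj₂ refl | inj₁ _ | inj₂ refl = λ _ p _ q → case trans (sym p) q of λ ()
    ... | inj₁ _ | inj₁ _ | inj₂ refl | inj₂ refl = λ _ _ p q → ⊥-elim (V≢V p q refl)

  module Build (em : ∀ {ℓ} → ExcludedMiddle ℓ)
               (part : ℕ → Part k) (wish : ℕ → ℕ → Maybe Col) where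

    stage : ∀ N → Σ[ e ∈ (ℕ → ℕ → Col) ] IsGraph part e N
    stage zero = (λ _ _ → nil) , record
      { symmetric = λ _ _ → refl ; irrefl = λ _ → refl
      ; fit = λ _ _ () ; t1 = λ _ _ _ () ; t3 = λ _ _ _ () ; t4 = λ _ _ _ () ; i4 = λ _ _ _ _ () }
    stage (suc z) = GraphStep.extend em part _ z (wish z) (proj₂ (stage z)) ,
                    GraphStep.extend-graph em part _ z (wish z) (proj₂ (stage z))

    edge : ℕ → ℕ → Col
    edge x y = proj₁ (stage (suc (x ⊔ y))) x y

    private
      later : ∀ {x y} N d → x < N → y < N → proj₁ (stage (d ℕ.+ N)) x y ≡ proj₁ (stage N) x y
      later N zero    x< y< = refl
      later N (suc d) x< y< = trans
        (GraphStep.extend-old em part _ _ (wish _) (proj₂ (stage (d ℕ.+ N))) (<-≤-trans x< (m≤n+m N d)) (<-≤-trans y< (m≤n+m N d)))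
        (later N d x< y<)

    edge-stage : ∀ {x y N} → x < N → y < N → edge x y ≡ proj₁ (stage N) x y
    edge-stage {x} {y} {N} x< y< = sym (trans
      (cong (λ M → proj₁ (stage M) x y) (sym (ℕₚ.m∸n+n≡m {N} {suc (x ⊔ y)} (⊔-lub x< y<))))
      (later (suc (x ⊔ y)) (N ℕ.∸ suc (x ⊔ y)) (s≤s (m≤m⊔n x y)) (s≤s (m≤n⊔m x y))))

    edge-graph : ∀ N → IsGraph part edge N
    symmetric (edge-graph N) x y = trans
      (symmetric (proj₂ (stage (suc (x ⊔ y)))) x y)
      (sym (edge-stage (s≤s (m≤n⊔m x y)) (s≤s (m≤m⊔n x y))))
    irrefl (edge-graph N) x = irrefl (proj₂ (stage (suc (x ⊔ x)))) x
    fit (edge-graph N) x y x< y< rewrite edge-stage x< y< = fit (proj₂ (stage N)) x y x< y<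
    t1 (edge-graph N) x y v x< y< v< rewrite edge-stage x< y< | edge-stage x< v< | edge-stage y< v< = t1 (proj₂ (stage N)) x y v x< y< v<
    t3 (edge-graph N) x y v x< y< v< rewrite edge-stage x< y< | edge-stage x< v< | edge-stage y< v< = t3 (proj₂ (stage N)) x y v x< y< v<
    t4 (edge-graph N) x y v x< y< v< rewrite edge-stage x< y< | edge-stage x< v< | edge-stage y< v< = t4 (proj₂ (stage N)) x y v x< y< v<
    i4 (edge-graph N) x y v w x< y< v< w<
      rewrite edge-stage x< y< | edge-stage x< v< | edge-stage x< w< | edge-stage y< v< | edge-stage y< w< | edge-stage v< w< =
      i4 (proj₂ (stage N)) x y v w x< y< v< w<

    Acceptable : ℕ → Set
    Acceptable z = GraphStep.Good em part edge z (wish z) (edge-graph z)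

    granted : ∀ {z y c} → Acceptable z → y < z → wish z y ≡ just c → edge z y ≡ c
    granted {z} {y} {c} g y< w = trans (trans (edge-stage (n<1+n z) (<-trans y< (n<1+n z))) (S.extend-row y<)) (get (proj₂ (S.row y)))
      where
      module S = GraphStep em part (proj₁ (stage z)) z (wish z) (proj₂ (stage z))
      module E = GraphStep em part edge z (wish z) (edge-graph z)
      g′ : S.Good
      S.Good.few  g′ = E.Good.few g
      S.Good.fitᵍ g′ = E.Good.fitᵍ g
      S.Good.tri  g′ {x} {y} x≢y wx wy with edge x y | edge-stage (proj₁ wx) (proj₁ wy) | E.Good.tri g x≢y wx wy
      ... | _ | refl | h = h
      get : ∀ {d} → S.Row y d → d ≡ c
      get (S.bad ¬g)      = ⊥-elim (¬g g′)
      get (S.granted _ v) = just-injective (trans (sym v) w)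
      get (S.dflt _ v _)  = case trans (sym v) w of λ ()

-- The homogeneous model

opaque
  enum-Part : ∀ k → Enumerable (Part k)
  enum-Part k = enum-image f onto (enum-⊎ enum-ℕ (enum-⊎ enum-Bool enum-Fin))
    where
    f : ℕ ⊎ Bool ⊎ Fin 4 → Part k
    f (inj₁ r) with r <? k
    ... | yes r<k = P (fromℕ< r<k)
    ... | no _    = V false
    f (inj₂ (inj₁ β)) = V β
    f (inj₂ (inj₂ s)) = X s
    onto : ∀ p → Σ[ a ∈ _ ] f a ≡ p
    onto (V β) = inj₂ (inj₁ β) , refl
    onto (X s) = inj₂ (inj₂ s) , refl
    onto (P r) = inj₁ (toℕ r) , eq
      where
      eq : f (inj₁ (toℕ r)) ≡ P r
      eq with toℕ r <? k
      ... | yes lt = cong P (toℕ-injective (toℕ-fromℕ< lt))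
      ... | no ¬lt = ⊥-elim (¬lt (toℕ<n r))

  enum-Col : Enumerable Col
  enum-Col = enum-image f onto (enum-⊎ enum-Fin (enum-⊎ (enum-Vec enum-Bool 4) (enum-× enum-Bool enum-ℕ)))
    where
    f : Fin 4 ⊎ Vec Bool 4 ⊎ (Bool × ℕ) → Col
    f (inj₁ zero)                   = nil
    f (inj₁ (suc zero))             = on
    f (inj₁ (suc (suc zero)))       = w1
    f (inj₁ (suc (suc (suc zero)))) = inf
    f (inj₂ (inj₁ S))               = lab S
    f (inj₂ (inj₂ (i , l)))         = red i l
    onto : ∀ c → Σ[ a ∈ _ ] f a ≡ c
    onto nil       = inj₁ zero , refl
    onto on        = inj₁ (suc zero) , refl
    onto w1        = inj₁ (suc (suc zero)) , refl
    onto inf       = inj₁ (suc (suc (suc zero))) , refl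
    onto (lab S)   = inj₂ (inj₁ S) , refl
    onto (red i l) = inj₂ (inj₂ (i , l)) , refl

maxv : ∀ {j} → Vec ℕ j → ℕ
maxv []       = 0
maxv (x ∷ xs) = x ⊔ maxv xs

maxv-≤ : ∀ {j} (v : Vec ℕ j) {z} → (∀ r → lookup v r ≤ z) → maxv v ≤ z
maxv-≤ []       h = z≤n
maxv-≤ (x ∷ xs) h = ⊔-lub (h zero) (maxv-≤ xs (h ∘ suc))

≤-maxv : ∀ {j} (v : Vec ℕ j) r → lookup v r ≤ maxv v
≤-maxv (x ∷ xs) zero    = m≤m⊔n x _
≤-maxv (x ∷ xs) (suc r) = ≤-trans (≤-maxv xs r) (m≤n⊔m x _)

Fit-Pˡ : ∀ {k} {p q : Part k} {r c} → p ≡ P r → Fit p q c → c ≡ nil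
Fit-Pˡ refl nil = refl

Fit-Pʳ : ∀ {k} {p q : Part k} {r c} → q ≡ P r → Fit p q c → c ≡ nil
Fit-Pʳ refl nil = refl

module Model (em : ∀ {ℓ} → ExcludedMiddle ℓ) (k : ℕ) where

  n : ℕ
  n = 3 ℕ.+ k

  Pattern : Set
  Pattern = Fin n → Fin n → Vec (Fin n) k → Col

  -- A number codes the part of the node, the n − 1 nodes over which it is
  -- created (with an index at which it replaces the remaining entry), and the
  -- colours it asks for.
  opaque
    codes : Enumerable (ℕ × (Part k × Fin n) × (ℕ × ℕ))
    codes = enum-× enum-ℕ (enum-× (enum-× (enum-Part k) enum-Fin) (enum-× enum-ℕ enum-ℕ))

  opaque
    unfolding codes enum-× enum-ℕ
    codes-≤ : ∀ z → proj₁ (proj₁ codes z) ≤ z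
    codes-≤ z = ≤-trans (m≤m+n (proj₁ (unpair z)) _) (unpair-sum≤ z)

  opaque
    part : ℕ → Part k
    part z = proj₁ (proj₁ (proj₂ (proj₁ codes z)))

    over : ℕ → Fin n → ℕ
    over z = updateAt (λ j → nth (proj₁ (proj₂ (proj₂ (proj₁ codes z)))) (toℕ j))
                      (proj₂ (proj₁ (proj₂ (proj₁ codes z)))) (const z)

    asked : ℕ → Pattern
    asked z x y π = proj₁ enum-Col (table (proj₂ (proj₂ (proj₂ (proj₁ codes z)))) (x ∷ y ∷ π))

    node : ∀ (w : Fin n → ℕ) i t (D : Pattern) → Σ[ z ∈ ℕ ] (∀ j → w j < z) × part z ≡ t ×
           (∀ j → over z j ≡ updateAt w i (const z) j) × (∀ x y π → asked z x y π ≡ D x y π)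
    node w i t D
      with nth-surjective w | table-surjective (2 ℕ.+ k) (λ { (x ∷ y ∷ π) → proj₁ (proj₂ enum-Col (D x y π)) }) | bounded w
    ... | b , b-≡ | d , d-≡ | L , w≤L with proj₂ codes (suc L , (t , i) , (b , d))
    ... | z , eq = z , big , cong (proj₁ ∘ proj₁ ∘ proj₂) eq , over-≡ , asked-≡
      where
      big : ∀ j → w j < z
      big j = <-≤-trans (s≤s (w≤L j)) (subst (_≤ z) (cong proj₁ eq) (codes-≤ z))
      over-≡ : ∀ j → over z j ≡ updateAt w i (const z) j
      over-≡ j = trans (cong₂ (λ b i → updateAt (λ j → nth b (toℕ j)) i (const z) j)
                         (cong (proj₁ ∘ proj₂ ∘ proj₂) eq) (cong (proj₂ ∘ proj₁ ∘ proj₂) eq))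
                       (ov (j ≟ᶠ i))
        where
        ov : Dec (j ≡ i) → updateAt (λ j → nth b (toℕ j)) i (const z) j ≡ updateAt w i (const z) j
        ov (yes refl) = trans (update-≡ _ j z) (sym (update-≡ w j z))
        ov (no j≢i)   = trans (update-≢ _ z j≢i) (trans (b-≡ j) (sym (update-≢ w z j≢i)))
      asked-≡ : ∀ x y π → asked z x y π ≡ D x y π
      asked-≡ x y π = trans (cong (proj₁ enum-Col) (trans (cong (λ d → table d (x ∷ y ∷ π)) (cong (proj₂ ∘ proj₂ ∘ proj₂) eq)) (d-≡ (x ∷ y ∷ π))))
                            (proj₂ (proj₂ enum-Col (D x y π)))

  NonP : ℕ → Set
  NonP x = ∀ r → part x ≢ P r

  nonP? : ∀ x → NonP x ⊎ Σ[ r ∈ Fin k ] part x ≡ P r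
  nonP? x with part x
  ... | P r = inj₂ (r , refl)
  ... | V β = inj₁ λ r ()
  ... | X s = inj₁ λ r ()

  Asks : ℕ → ℕ → ℕ → Vec ℕ k → Set
  Asks z x y p = Σ[ x′ ∈ Fin n ] Σ[ y′ ∈ Fin n ] Σ[ π ∈ Vec (Fin n) k ]
                 over z x′ ≡ x × over z y′ ≡ y × map (over z) π ≡ p × NonP x × NonP y

  wishOf : ℕ → ℕ → ℕ → Vec ℕ k → Maybe Col
  wishOf z x y p with em {P = Asks z x y p}
  ... | yes (x′ , y′ , π , _) = just (asked z x′ y′ π)
  ... | no _ = nothing

  module G (p : Vec ℕ k) = Build em part (λ x y → wishOf (maxv p ⊔ x) x y p)

  Legal : Vec ℕ k → Set
  Legal p = ∀ r → part (lookup p r) ≡ P r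

  opaque
    C : ℕ → ℕ → Vec ℕ k → Col
    C x y p with em {P = Legal p}
    ... | yes _ = G.edge p x y
    ... | no _  = nil

    C-legal : ∀ {x y p} → Legal p → C x y p ≡ G.edge p x y
    C-legal {p = p} h with em {P = Legal p}
    ... | yes _ = refl
    ... | no ¬h = ⊥-elim (¬h h)

    C-illegal : ∀ {x y p} → ¬ Legal p → C x y p ≡ nil
    C-illegal {p = p} h with em {P = Legal p}
    ... | yes h′ = ⊥-elim (h h′)
    ... | no _ = refl

    C-sym : ∀ x y p → C x y p ≡ C y x p
    C-sym x y p with em {P = Legal p}
    ... | yes _ = IsGraph.symmetric (G.edge-graph p 0) x y
    ... | no _  = refl

    C-irr : ∀ x p → C x x p ≡ nil
    C-irr x p with em {P = Legal p}
    ... | yes _ = IsGraph.irrefl (G.edge-graph p 0) x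
    ... | no _  = refl

    C-fit : ∀ x y p → x ≢ y → Fit (part x) (part y) (C x y p)
    C-fit x y p x≢y with em {P = Legal p}
    ... | yes _ = IsGraph.fit (G.edge-graph p (suc (x ⊔ y))) x y (s≤s (m≤m⊔n x y)) (s≤s (m≤n⊔m x y)) x≢y
    ... | no _  = nil

    C-T1 : ∀ x y z p → T1 (part x) (part y) (part z) (C x y p) (C x z p) (C y z p)
    C-T1 x y z p with em {P = Legal p}
    ... | yes _ = IsGraph.t1 (G.edge-graph p (suc (x ⊔ (y ⊔ z)))) x y z (s≤s (m≤m⊔n x _))
                    (s≤s (≤-trans (m≤m⊔n y z) (m≤n⊔m x _))) (s≤s (≤-trans (m≤n⊔m y z) (m≤n⊔m x _)))
    ... | no _  = λ _ _ _ _ ()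

    C-T3 : ∀ x y z p → T3 (part x) (part y) (part z) (C x y p) (C x z p) (C y z p)
    C-T3 x y z p with em {P = Legal p}
    ... | yes _ = IsGraph.t3 (G.edge-graph p (suc (x ⊔ (y ⊔ z)))) x y z (s≤s (m≤m⊔n x _))
                    (s≤s (≤-trans (m≤m⊔n y z) (m≤n⊔m x _))) (s≤s (≤-trans (m≤n⊔m y z) (m≤n⊔m x _)))
    ... | no _  = λ _ _ _ ()

    C-T4 : ∀ x y z p → T4 (part x) (part y) (part z) (C x y p) (C x z p) (C y z p)
    C-T4 x y z p with em {P = Legal p}
    ... | yes _ = IsGraph.t4 (G.edge-graph p (suc (x ⊔ (y ⊔ z)))) x y z (s≤s (m≤m⊔n x _))
                    (s≤s (≤-trans (m≤m⊔n y z) (m≤n⊔m x _))) (s≤s (≤-trans (m≤n⊔m y z) (m≤n⊔m x _)))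
    ... | no _  = λ _ _ _ ()

  record Target (w : Fin n → ℕ) (i : Fin n) (D : Pattern) : Set where
    field
      d-sym : ∀ x y π → D x y π ≡ D y x π
      d-ext : ∀ {x y π x′ y′ π′} → w x ≡ w x′ → w y ≡ w y′ → map w π ≡ map w π′ → D x y π ≡ D x′ y′ π′
      d-old : ∀ {x y π} → Legal (map w π) → w x ≢ w y → x ≢ i → y ≢ i → (∀ r → lookup π r ≢ i) →
              C (w x) (w y) (map w π) ≡ D x y π
      d-fit : ∀ {x y π} → Legal (map w π) → w x ≢ w y → Fit (part (w x)) (part (w y)) (D x y π)
      d-tri : ∀ {x y v π} → Legal (map w π) → w x ≢ w y → w x ≢ w v → w y ≢ w v →
              T1 (part (w x)) (part (w y)) (part (w v)) (D x y π) (D x v π) (D y v π) ×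
              T3 (part (w x)) (part (w y)) (part (w v)) (D x y π) (D x v π) (D y v π) ×
              T4 (part (w x)) (part (w y)) (part (w v)) (D x y π) (D x v π) (D y v π)

  legal-inj : ∀ {w : Fin n → ℕ} π → Legal (map w π) → ∀ r s → lookup π r ≡ lookup π s → r ≡ s
  legal-inj {w} π lg r s e = P-inj (trans (sym (lg r)) (trans (cong part
    (trans (lookup-map r w π) (trans (cong w e) (sym (lookup-map s w π))))) (lg s)))

  legal-out : ∀ {w : Fin n → ℕ} π → Legal (map w π) → ∀ {x} → NonP (w x) → ∀ r → x ≢ lookup π r
  legal-out {w} π lg np r refl = np r (trans (cong part (sym (lookup-map r w π))) (lg r))

  create : ∀ (w : Fin n → ℕ) i t (D : Pattern) →
           (∀ z → (∀ j → w j < z) → part z ≡ t → Target (updateAt w i (const z)) i D) →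
           Σ[ z ∈ ℕ ] (∀ j → w j < z) × part z ≡ t ×
           (∀ x y π → let w′ = updateAt w i (const z) in Legal (map w′ π) → w′ x ≢ w′ y →
            C (w′ x) (w′ y) (map w′ π) ≡ D x y π)
  create w i t D tgt with node w i t D
  ... | z , big , pz , over≡ , asked≡ = z , big , pz , final
    where
    w′ : Fin n → ℕ
    w′ = updateAt w i (const z)
    open Target (tgt z big pz)

    w′i : w′ i ≡ z
    w′i = update-≡ w i z

    w′≤ : ∀ j → w′ j ≤ z
    w′≤ j with j ≟ᶠ i
    ... | yes refl = ≤-reflexive w′i
    ... | no j≢i = <⇒≤ (subst (_< z) (sym (update-≢ w z j≢i)) (big j))

    map-over : ∀ {j} (π : Vec (Fin n) j) → map (over z) π ≡ map w′ π
    map-over = map-cong over≡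

    module _ (π : Vec (Fin n) k) (lg : Legal (map w′ π)) where
      p : Vec ℕ k
      p = map w′ π

      private module B = G p

      latest : ∀ x → (x ≡ i ⊎ Σ[ r ∈ Fin k ] lookup π r ≡ i) → maxv p ⊔ w′ x ≡ z
      latest x c = ≤-antisym (⊔-lub (maxv-≤ p λ r → subst (_≤ z) (sym (lookup-map r w′ π)) (w′≤ _)) (w′≤ x)) (ge c)
        where
        ge : _ → z ≤ maxv p ⊔ w′ x
        ge (inj₁ refl) = ≤-trans (≤-reflexive (sym w′i)) (m≤n⊔m (maxv p) (w′ x))
        ge (inj₂ (r , e)) = ≤-trans (≤-reflexive (sym (trans (lookup-map r w′ π) (trans (cong w′ e) w′i))))
                              (≤-trans (≤-maxv p r) (m≤m⊔n _ (w′ x)))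

      module _ (x : Fin n) (now : maxv p ⊔ w′ x ≡ z) (npx : NonP (w′ x)) where

        wish-≡ : ∀ y → NonP (w′ y) → wishOf (maxv p ⊔ w′ x) (w′ x) (w′ y) p ≡ just (D x y π)
        wish-≡ y npy rewrite now with em {P = Asks z (w′ x) (w′ y) p}
        ... | yes (x′ , y′ , π′ , ex , ey , eπ , _) = cong just (trans (asked≡ x′ y′ π′)
                (d-ext (trans (sym (over≡ x′)) ex) (trans (sym (over≡ y′)) ey) (trans (sym (map-over π′)) eπ)))
        ... | no ¬a = ⊥-elim (¬a (x , y , π , over≡ x , over≡ y , map-over π , npx , npy))

        wish-inv : ∀ Y {c} → wishOf (maxv p ⊔ w′ x) (w′ x) Y p ≡ just c →
                   Σ[ y ∈ Fin n ] w′ y ≡ Y × NonP Y × D x y π ≡ c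
        wish-inv Y e rewrite now with em {P = Asks z (w′ x) Y p}
        wish-inv Y refl | yes (x′ , y′ , π′ , ex , ey , eπ , _ , npY) = y′ , trans (sym (over≡ y′)) ey , npY ,
          sym (trans (asked≡ x′ y′ π′) (d-ext (trans (sym (over≡ x′)) ex) refl (trans (sym (map-over π′)) eπ)))

        accept : (∀ y v → w′ y < w′ x → w′ v < w′ x → w′ y ≢ w′ v → C (w′ y) (w′ v) p ≡ D y v π) → B.Acceptable (w′ x)
        accept ih = record { few = few ; fitᵍ = fitᵍ ; tri = tri }
          where
          open GraphStep em part B.edge (w′ x) (λ y → wishOf (maxv p ⊔ w′ x) (w′ x) y p) (B.edge-graph (w′ x)) using (Wished)
          ne : ∀ {Y c} → Wished Y c → w′ x ≢ Y
          ne (lt , _) e = <⇒≢ lt (sym e)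
          few : ∀ {Y₁ Y₂ Y₃ a b c} → Wished Y₁ a → Wished Y₂ b → Wished Y₃ c → Y₁ ≢ Y₂ → Y₁ ≢ Y₃ → Y₂ ≢ Y₃ → ⊥
          few {Y₁} {Y₂} {Y₃} q₁ q₂ q₃ n₁₂ n₁₃ n₂₃
            with wish-inv Y₁ (proj₂ q₁) | wish-inv Y₂ (proj₂ q₂) | wish-inv Y₃ (proj₂ q₃)
          ... | y₁ , refl , np₁ , _ | y₂ , refl , np₂ , _ | y₃ , refl , np₃ , _ =
            no-four-more π (legal-inj π lg) {x} {y₁} {y₂} {y₃} (ne q₁ ∘ cong w′) (ne q₂ ∘ cong w′) (ne q₃ ∘ cong w′)
              (n₁₂ ∘ cong w′) (n₁₃ ∘ cong w′) (n₂₃ ∘ cong w′)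
              (legal-out π lg npx) (legal-out π lg np₁) (legal-out π lg np₂) (legal-out π lg np₃)
          fitᵍ : ∀ {Y c} → Wished Y c → Fit (part (w′ x)) (part Y) c
          fitᵍ {Y} q with wish-inv Y (proj₂ q)
          ... | y , refl , _ , refl = d-fit lg (ne q)
          Triangles : (Y₁ Y₂ : ℕ) (a b e : Col) → Set
          Triangles Y₁ Y₂ a b e =
            T1 (part (w′ x)) (part Y₁) (part Y₂) a b e × T1 (part Y₁) (part Y₂) (part (w′ x)) e a b ×
            T3 (part (w′ x)) (part Y₁) (part Y₂) a b e × T3 (part Y₁) (part (w′ x)) (part Y₂) a e b ×
            T4 (part (w′ x)) (part Y₁) (part Y₂) a b e
          tri : ∀ {Y₁ Y₂ a b} → Y₁ ≢ Y₂ → Wished Y₁ a → Wished Y₂ b → Triangles Y₁ Y₂ a b (B.edge Y₁ Y₂)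
          tri {Y₁} {Y₂} n₁₂ q₁ q₂ with wish-inv Y₁ (proj₂ q₁) | wish-inv Y₂ (proj₂ q₂)
          ... | y₁ , refl , _ , refl | y₂ , refl , _ , refl =
            subst (Triangles (w′ y₁) (w′ y₂) (D x y₁ π) (D x y₂ π)) (trans (sym (ih y₁ y₂ (proj₁ q₁) (proj₁ q₂) n₁₂)) (C-legal lg))
              ( proj₁ fwd
              , subst₂ (T1 (part (w′ y₁)) (part (w′ y₂)) (part (w′ x)) (D y₁ y₂ π)) (d-sym y₁ x π) (d-sym y₂ x π)
                  (proj₁ (d-tri lg n₁₂ (ne q₁ ∘ sym) (ne q₂ ∘ sym)))
              , proj₁ (proj₂ fwd)
              , subst (λ c → T3 (part (w′ y₁)) (part (w′ x)) (part (w′ y₂)) c (D y₁ y₂ π) (D x y₂ π)) (d-sym y₁ x π)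
                  (proj₁ (proj₂ (d-tri lg (ne q₁ ∘ sym) n₁₂ (ne q₂))))
              , proj₂ (proj₂ fwd))
            where
            fwd = d-tri lg (ne q₁) (ne q₂) n₁₂

      Claim : ℕ → Set
      Claim N = ∀ x y → w′ x ≡ N → w′ y < N → C (w′ x) (w′ y) p ≡ D x y π

      below : ∀ {N} → (∀ {M} → M < N → Claim M) → ∀ x y → w′ x < N → w′ y < N → w′ x ≢ w′ y → C (w′ x) (w′ y) p ≡ D x y π
      below ih x y x< y< x≢y with <-cmp (w′ x) (w′ y)
      ... | tri> _ _ y<x = ih x< x y refl y<x
      ... | tri≈ _ e _ = ⊥-elim (x≢y e)
      ... | tri< x<y _ _ = trans (C-sym _ _ p) (trans (ih y< y x refl x<y) (d-sym y x π))

      claim : ∀ N → Claim N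
      claim = <-rec Claim λ N ih x y e y< → step ih x y e y<
        where
        step : ∀ {N} → (∀ {M} → M < N → Claim M) → ∀ x y → w′ x ≡ N → w′ y < N → C (w′ x) (w′ y) p ≡ D x y π
        step ih x y refl y< with em {P = x ≡ i ⊎ Σ[ r ∈ Fin k ] lookup π r ≡ i}
        ... | no ¬c = d-old lg (λ e → <⇒≢ y< (sym e)) (¬c ∘ inj₁)
                (λ { refl → <⇒≢ (<-≤-trans y< (≤-trans (w′≤ x) (≤-reflexive (sym w′i)))) refl }) (λ r e → ¬c (inj₂ (r , e)))
        ... | yes c with nonP? (w′ x) | nonP? (w′ y)
        ...   | inj₂ (r , e) | _ = trans (Fit-Pˡ e (C-fit _ _ p ne)) (sym (Fit-Pˡ e (d-fit lg ne)))
          where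
          ne : w′ x ≢ w′ y
          ne e = <⇒≢ y< (sym e)
        ...   | inj₁ _ | inj₂ (r , e) = trans (Fit-Pʳ e (C-fit _ _ p ne)) (sym (Fit-Pʳ e (d-fit lg ne)))
          where
          ne : w′ x ≢ w′ y
          ne e = <⇒≢ y< (sym e)
        ...   | inj₁ npx | inj₁ npy = trans (C-legal lg)
                (B.granted (accept x (latest x c) npx (λ a b → below ih a b)) y< (wish-≡ x (latest x c) npx y npy))

    final : ∀ x y π → Legal (map w′ π) → w′ x ≢ w′ y → C (w′ x) (w′ y) (map w′ π) ≡ D x y π
    final x y π lg ne = below π lg {suc z} (λ {M} _ → claim π lg M) x y (s≤s (w′≤ x)) (s≤s (w′≤ y)) ne

-- Tuples indistinguishable up to high levels

data Out (L : ℕ) : Col → Set where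
  inf : Out L inf
  red : ∀ {i l} → L ≤ l → Out L (red i l)

out? : ∀ L c → Dec (Out L c)
out? L nil     = no λ ()
out? L on      = no λ ()
out? L w1      = no λ ()
out? L (lab _) = no λ ()
out? L inf     = yes inf
out? L (red i l) with L ℕ.≤? l
... | yes le = yes (red le)
... | no ¬le = no λ { (red le) → ¬le le }

data _≈[_]_ : Col → ℕ → Col → Set where
  same : ∀ {L c} → c ≈[ L ] c
  out  : ∀ {L c d} → Out L c → Out L d → c ≈[ L ] d

≈-reflexive : ∀ {L c d} → c ≡ d → c ≈[ L ] d
≈-reflexive refl = same

≈-sym : ∀ {L c d} → c ≈[ L ] d → d ≈[ L ] c
≈-sym same      = same
≈-sym (out p q) = out q p

≈-trans : ∀ {L c d e} → c ≈[ L ] d → d ≈[ L ] e → c ≈[ L ] e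
≈-trans same q = q
≈-trans (out p q) same = out p q
≈-trans (out p _) (out _ q) = out p q

Out-≤ : ∀ {L M c} → L ≤ M → Out M c → Out L c
Out-≤ le inf     = inf
Out-≤ le (red p) = red (≤-trans le p)

≈-≤ : ∀ {L M c d} → L ≤ M → c ≈[ M ] d → c ≈[ L ] d
≈-≤ le same      = same
≈-≤ le (out p q) = out (Out-≤ le p) (Out-≤ le q)

≈-in : ∀ {L c d} → c ≈[ L ] d → ¬ Out L d → c ≡ d
≈-in same      _  = refl
≈-in (out _ q) ¬q = ⊥-elim (¬q q)

≈-Out : ∀ {L c d} → c ≈[ L ] d → Out L d → Out L c
≈-Out same q = q
≈-Out (out p _) q = p

≈-on : ∀ {L c d} → c ≈[ L ] d → d ≡ on → c ≡ on
≈-on same e = e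
≈-on (out _ ()) refl

≈-white : ∀ {L c d} β → c ≈[ L ] d → d ≡ white β → c ≡ white β
≈-white β same e = e
≈-white false (out _ ()) refl
≈-white true  (out _ ()) refl

Out-red : ∀ {L c} → Out L c → IsRed c
Out-red inf     = inf
Out-red (red _) = red

≈-red : ∀ {L c d} → c ≈[ L ] d → IsRed d → IsRed c
≈-red same r = r
≈-red (out p _) _ = Out-red p

∈ˡ-≈ : ∀ {L c d s} → c ≈[ L ] d → s ∈ˡ c → s ∈ˡ d
∈ˡ-≈ same h = h
∈ˡ-≈ (out inf _) ()
∈ˡ-≈ (out (red _) _) ()

T1-≈ : ∀ {k L} {p q r : Part k} {a b c a′ b′ c′} → a ≈[ L ] a′ → b ≈[ L ] b′ → c ≈[ L ] c′ →
       T1 p q r a b c → T1 p q r a′ b′ c′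
T1-≈ ea eb ec h {β = β} p q s≢t r b c a = h p q s≢t r (≈-on eb b) (≈-on ec c) (≈-white β ea a)

T3-≈ : ∀ {k L} {p q r : Part k} {a b c a′ b′ c′} → a ≈[ L ] a′ → b ≈[ L ] b′ → c ≈[ L ] c′ →
       T3 p q r a b c → T3 p q r a′ b′ c′
T3-≈ ea eb ec h p q r a b = ∈ˡ-≈ ec (h p q r (≈-on ea a) (≈-on eb b))

Fit-red : ∀ {k} {p q : Part k} {c d} → IsRed c → IsRed d → Fit p q c → Fit p q d
Fit-red r inf (inf e) = inf e
Fit-red r red (inf e) = red e
Fit-red r inf (red e) = inf e
Fit-red r red (red e) = red e

Fit-≈ : ∀ {k L} {p q : Part k} {c d} → c ≈[ L ] d → Fit p q c → Fit p q d
Fit-≈ same f = f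
Fit-≈ (out a b) f = Fit-red (Out-red a) (Out-red b) f

xor-solve : ∀ e j → false xor ((j xor e) xor j) ≡ e
xor-solve false false = refl
xor-solve false true  = refl
xor-solve true  false = refl
xor-solve true  true  = refl

module Similarity (em : ∀ {ℓ} → ExcludedMiddle ℓ) (k : ℕ) where
  open Model em k public

  edge : (Fin n → ℕ) → Pattern
  edge u x y π = C (u x) (u y) (map u π)

  All : Fin n → Set
  All _ = ⊤

  record Sim (L : ℕ) (Ok : Fin n → Set) (u w : Fin n → ℕ) : Set where
    field
      parts : ∀ j → Ok j → part (u j) ≡ part (w j)
      eqs   : ∀ i j → Ok i → Ok j → u i ≡ u j → w i ≡ w j
      eqs⁻  : ∀ i j → Ok i → Ok j → w i ≡ w j → u i ≡ u j
      cols  : ∀ x y π → Ok x → Ok y → (∀ r → Ok (lookup π r)) → edge u x y π ≈[ L ] edge w x y π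
  open Sim public

  Real : (Fin n → Set) → (Fin n → ℕ) → Set
  Real Ok w = ∀ x y π → Ok x → Ok y → (∀ r → Ok (lookup π r)) → edge w x y π ≢ inf

  edge-∘ : ∀ u (f : Fin n → Fin n) x y π → edge (u ∘ f) x y π ≡ edge u (f x) (f y) (map f π)
  edge-∘ u f x y π = cong (C _ _) (map-∘ u f π)

  edge-local : ∀ {u w : Fin n → ℕ} x y π → u x ≡ w x → u y ≡ w y → (∀ r → u (lookup π r) ≡ w (lookup π r)) →
               edge u x y π ≡ edge w x y π
  edge-local {u} {w} x y π ex ey eπ rewrite ex | ey = cong (C _ _) (map-local u w π eπ)

  Sim-refl : ∀ {L Ok u w} → (∀ j → Ok j → u j ≡ w j) → Sim L Ok u w
  Sim-refl e .parts j o = cong part (e j o)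
  Sim-refl e .eqs i j o o′ p = trans (sym (e i o)) (trans p (e j o′))
  Sim-refl e .eqs⁻ i j o o′ p = trans (e i o) (trans p (sym (e j o′)))
  Sim-refl e .cols x y π ox oy oπ = ≈-reflexive (edge-local x y π (e x ox) (e y oy) (λ r → e _ (oπ r)))

  Sim-sym : ∀ {L Ok u w} → Sim L Ok u w → Sim L Ok w u
  Sim-sym s .parts j o = sym (parts s j o)
  Sim-sym s .eqs  = eqs⁻ s
  Sim-sym s .eqs⁻ = eqs s
  Sim-sym s .cols x y π ox oy oπ = ≈-sym (cols s x y π ox oy oπ)

  Sim-trans : ∀ {L Ok u v w} → Sim L Ok u v → Sim L Ok v w → Sim L Ok u w
  Sim-trans s t .parts j o = trans (parts s j o) (parts t j o)
  Sim-trans s t .eqs i j o o′ e = eqs t i j o o′ (eqs s i j o o′ e)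
  Sim-trans s t .eqs⁻ i j o o′ e = eqs⁻ s i j o o′ (eqs⁻ t i j o o′ e)
  Sim-trans s t .cols x y π ox oy oπ = ≈-trans (cols s x y π ox oy oπ) (cols t x y π ox oy oπ)

  Sim-weaken : ∀ {L M Ok Ok′ u w} → L ≤ M → (∀ j → Ok′ j → Ok j) → Sim M Ok u w → Sim L Ok′ u w
  Sim-weaken le i s .parts j o = parts s j (i j o)
  Sim-weaken le i s .eqs a b o o′ = eqs s a b (i a o) (i b o′)
  Sim-weaken le i s .eqs⁻ a b o o′ = eqs⁻ s a b (i a o) (i b o′)
  Sim-weaken le i s .cols x y π ox oy oπ = ≈-≤ le (cols s x y π (i x ox) (i y oy) (λ r → i _ (oπ r)))

  Sim-∘ : ∀ {L Ok u w} (f : Fin n → Fin n) → (∀ j → Ok (f j)) → Sim L Ok u w → Sim L All (u ∘ f) (w ∘ f)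
  Sim-∘ f ok s .parts j _ = parts s (f j) (ok j)
  Sim-∘ f ok s .eqs i j _ _ = eqs s (f i) (f j) (ok i) (ok j)
  Sim-∘ f ok s .eqs⁻ i j _ _ = eqs⁻ s (f i) (f j) (ok i) (ok j)
  Sim-∘ {L} {Ok} {u} {w} f ok s .cols x y π _ _ _ rewrite edge-∘ u f x y π | edge-∘ w f x y π =
    cols s (f x) (f y) (map f π) (ok x) (ok y) (λ r → subst Ok (sym (lookup-map r f π)) (ok _))

  Real-∘ : ∀ {Ok w} (f : Fin n → Fin n) → (∀ j → Ok (f j)) → Real Ok w → Real All (w ∘ f)
  Real-∘ {Ok} {w} f ok re x y π _ _ _ rewrite edge-∘ w f x y π =
    re (f x) (f y) (map f π) (ok x) (ok y) (λ r → subst Ok (sym (lookup-map r f π)) (ok _))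

  Real-≗ : ∀ {u w} → u ≗ w → Real All u → Real All w
  Real-≗ e re x y π a b c q = re x y π a b c (trans (edge-local x y π (e x) (e y) (λ r → e _)) q)

  update-∘ : ∀ (w : Fin n → ℕ) i j → updateAt w i (const (w j)) ≗ w ∘ [ i ∣ j ]
  update-∘ w i j x with x ≟ᶠ i
  ... | yes refl = trans (update-≡ w x (w j)) (cong w (sym (update-≡ id x j)))
  ... | no x≢i   = trans (update-≢ w (w j) x≢i) (cong w (sym (update-≢ id j x≢i)))

  ∣-≢ : ∀ {i j : Fin n} → j ≢ i → ∀ x → [ i ∣ j ] x ≢ i
  ∣-≢ {i} {j} j≢i x with x ≟ᶠ i
  ... | yes refl = λ e → j≢i (trans (sym (update-≡ id x j)) e)
  ... | no x≢i   = λ e → x≢i (trans (sym (update-≢ id j x≢i)) e)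

  red-NonP : ∀ {x y p} → IsRed (C x y p) → x ≢ y × NonP x × NonP y
  red-NonP {x} {y} {p} r = x≢y , np (C-fit x y p x≢y) r , np (Fit-sym (C-fit x y p x≢y)) r
    where
    x≢y : x ≢ y
    x≢y refl rewrite C-irr x p = case r of λ ()
    np : ∀ {q q′ : Part k} {c} → Fit q q′ c → IsRed c → ∀ s → q ≢ P s
    np f inf s refl = case f of λ ()
    np f red s refl = case f of λ ()

  red-legal : ∀ {x y p} → IsRed (C x y p) → Legal p
  red-legal {x} {y} {p} r with em {P = Legal p}
  ... | yes lg = lg
  ... | no ¬lg = case subst IsRed (C-illegal {x} {y} {p} ¬lg) r of λ ()

  module Zigzag {L : ℕ} {i : Fin n} {u w : Fin n → ℕ} (s : Sim L (_≢ i) u w) where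

    Through : Vec (Fin n) k → Set
    Through π = Σ[ r ∈ Fin k ] lookup π r ≡ i

    away : ∀ π → ¬ Through π → ∀ r → lookup π r ≢ i
    away π ¬t r e = ¬t (r , e)

    module New (fresh : ∀ j → j ≢ i → u j ≢ u i) where

      -- The long red edge among the two old X-nodes of the graph of p, if there is one.
      Pair : Vec ℕ k → Set
      Pair p = Σ[ y ∈ Fin n ] Σ[ v ∈ Fin n ] y ≢ i × v ≢ i × Out L (C (w y) (w v) p)

      follow : Fin n → Fin n → Col → ℕ → Col
      follow y v (red j l) Y with Y ≟ⁿ w y
      ... | yes _ = red false l
      ... | no _  = red (j xor e (part (u i)) (part (u y)) (part (u v))) l
        where
        e : Part k → Part k → Part k → Bool
        e (X a) (X b) (X c) = ε a b c
        e _     _     _     = false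
      follow y v _ Y = inf

      pick : Vec ℕ k → ℕ → Col
      pick p Y with em {P = Pair p}
      ... | yes (y , v , _) = follow y v (C (w y) (w v) p) Y
      ... | no _            = red false L

      pick-out : ∀ p Y → Out L (pick p Y)
      pick-out p Y with em {P = Pair p}
      ... | no _ = red ≤-refl
      ... | yes (y , v , _ , _ , o) with C (w y) (w v) p
      ...   | inf = inf
      ...   | red j l with o | Y ≟ⁿ w y
      ...     | red le | yes _ = red le
      ...     | red le | no _  = red le

      lift-out : Col → Vec ℕ k → ℕ → Col
      lift-out c p Y with out? L c
      ... | yes _ = pick p Y
      ... | no _  = c

      lift-≈ : ∀ c p Y → c ≈[ L ] lift-out c p Y
      lift-≈ c p Y with out? L c
      ... | yes o = out o (pick-out p Y)
      ... | no _  = same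

      spoke : Fin n → Vec (Fin n) k → Col
      spoke y π = lift-out (edge u i y π) (map w π) (w y)

      spoke-≈ : ∀ y π → edge u i y π ≈[ L ] spoke y π
      spoke-≈ y π = lift-≈ _ _ _

      D : Pattern
      D x y π with em {P = Through π} | x ≟ᶠ i | y ≟ᶠ i
      ... | yes _ | _     | _     = edge u x y π
      ... | no _  | yes _ | yes _ = nil
      ... | no _  | yes _ | no _  = spoke y π
      ... | no _  | no _  | yes _ = spoke x π
      ... | no _  | no _  | no _  = edge w x y π

      D-≈ : ∀ x y π → edge u x y π ≈[ L ] D x y π
      D-≈ x y π with em {P = Through π} | x ≟ᶠ i | y ≟ᶠ i
      ... | yes _ | _        | _        = same
      ... | no _  | yes refl | yes refl = ≈-reflexive (C-irr _ _)
      ... | no _  | yes refl | no _     = spoke-≈ y π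
      ... | no _  | no _     | yes refl = ≈-trans (≈-reflexive (C-sym _ _ _)) (spoke-≈ x π)
      ... | no ¬t | no x≢    | no y≢    = cols s x y π x≢ y≢ (away π ¬t)

      D-sym : ∀ x y π → D x y π ≡ D y x π
      D-sym x y π with em {P = Through π} | x ≟ᶠ i | y ≟ᶠ i
      ... | yes _ | _     | _     = C-sym _ _ _
      ... | no _  | yes _ | yes _ = refl
      ... | no _  | yes _ | no _  = refl
      ... | no _  | no _  | yes _ = refl
      ... | no _  | no _  | no _  = C-sym _ _ _

      D-old : ∀ {x y π} → ¬ Through π → x ≢ i → y ≢ i → D x y π ≡ edge w x y π
      D-old {x} {y} {π} ¬t x≢ y≢ with em {P = Through π} | x ≟ᶠ i | y ≟ᶠ i
      ... | yes t | _ | _ = ⊥-elim (¬t t)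
      ... | no _ | yes e | _ = ⊥-elim (x≢ e)
      ... | no _ | no _ | yes e = ⊥-elim (y≢ e)
      ... | no _ | no _ | no _ = refl

      module _ (z : ℕ) (big : ∀ j → w j < z) (pz : part z ≡ part (u i)) where
        w′ : Fin n → ℕ
        w′ = updateAt w i (const z)

        w′-eq : ∀ {x y} → w′ x ≡ w′ y → x ≡ y ⊎ (x ≢ i × y ≢ i × w x ≡ w y)
        w′-eq {x} {y} e with x ≟ᶠ i | y ≟ᶠ i
        ... | yes refl | yes refl = inj₁ refl
        ... | yes refl | no y≢ = ⊥-elim (<⇒≢ (big y) (trans (sym (update-≢ w z y≢)) (trans (sym e) (update-≡ w x z))))
        ... | no x≢ | yes refl = ⊥-elim (<⇒≢ (big x) (trans (sym (update-≢ w z x≢)) (trans e (update-≡ w y z))))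
        ... | no x≢ | no y≢ = inj₂ (x≢ , y≢ , trans (sym (update-≢ w z x≢)) (trans e (update-≢ w z y≢)))

        u-eq : ∀ {x y} → w′ x ≡ w′ y → u x ≡ u y
        u-eq e with w′-eq e
        ... | inj₁ refl = refl
        ... | inj₂ (x≢ , y≢ , e′) = eqs⁻ s _ _ x≢ y≢ e′

        eq-u : ∀ {x y} → u x ≡ u y → w′ x ≡ w′ y
        eq-u {x} {y} e with x ≟ᶠ i | y ≟ᶠ i
        ... | yes refl | yes refl = refl
        ... | yes refl | no y≢ = ⊥-elim (fresh y y≢ (sym e))
        ... | no x≢ | yes refl = ⊥-elim (fresh x x≢ e)
        ... | no x≢ | no y≢ = trans (update-≢ w z x≢) (trans (eqs s x y x≢ y≢ e) (sym (update-≢ w z y≢)))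

        w′-part : ∀ x → part (u x) ≡ part (w′ x)
        w′-part x with x ≟ᶠ i
        ... | yes refl = trans (sym pz) (cong part (sym (update-≡ w x z)))
        ... | no x≢ = trans (parts s x x≢) (cong part (sym (update-≢ w z x≢)))

        i-eq : ∀ {x y} → w′ x ≡ w′ y → x ≡ i → y ≡ i
        i-eq e refl with w′-eq e
        ... | inj₁ refl = refl
        ... | inj₂ (x≢ , _) = ⊥-elim (x≢ refl)

        at : ∀ {π π′ : Vec (Fin n) k} → map w′ π ≡ map w′ π′ → ∀ r → w′ (lookup π r) ≡ w′ (lookup π′ r)
        at {π} {π′} e r = trans (sym (lookup-map r w′ π)) (trans (cong (λ v → lookup v r) e) (lookup-map r w′ π′))

        thru-eq : ∀ {π π′ : Vec (Fin n) k} → map w′ π ≡ map w′ π′ → Through π → Through π′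
        thru-eq e (r , q) = r , i-eq (at e r) q

        w′-old : ∀ {x} → x ≢ i → w′ x ≡ w x
        w′-old = update-≢ w z

        map-old : ∀ {π : Vec (Fin n) k} → ¬ Through π → map w′ π ≡ map w π
        map-old {π} ¬t = map-local w′ w π (λ r → w′-old (away π ¬t r))

        edge-u : ∀ {x y x′ y′} {π π′ : Vec (Fin n) k} → w′ x ≡ w′ x′ → w′ y ≡ w′ y′ → map w′ π ≡ map w′ π′ →
                 edge u x y π ≡ edge u x′ y′ π′
        edge-u {π = π} {π′} ex ey eπ rewrite u-eq ex | u-eq ey = cong (C _ _)
          (lookup-ext _ _ λ r → trans (lookup-map r u π) (trans (u-eq (at eπ r)) (sym (lookup-map r u π′))))

        spoke-ext : ∀ {y y′ π π′} → ¬ Through π → ¬ Through π′ → y ≢ i → y′ ≢ i →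
                    w′ y ≡ w′ y′ → map w′ π ≡ map w′ π′ → spoke y π ≡ spoke y′ π′
        spoke-ext {y} {y′} {π} {π′} ¬t ¬t′ y≢ y≢′ ey eπ
          rewrite edge-u {i} {y} {i} {y′} {π} {π′} refl ey eπ
                | trans (sym (map-old ¬t)) (trans eπ (map-old ¬t′))
                | trans (sym (w′-old y≢)) (trans ey (w′-old y≢′)) = refl

        D-ext : ∀ {x y π x′ y′ π′} → w′ x ≡ w′ x′ → w′ y ≡ w′ y′ → map w′ π ≡ map w′ π′ → D x y π ≡ D x′ y′ π′
        D-ext {x} {y} {π} {x′} {y′} {π′} ex ey eπ with em {P = Through π} | em {P = Through π′}
        ... | yes t | no ¬t′ = ⊥-elim (¬t′ (thru-eq eπ t))
        ... | no ¬t | yes t′ = ⊥-elim (¬t (thru-eq (sym eπ) t′))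
        ... | yes _ | yes _ = edge-u ex ey eπ
        ... | no ¬t | no ¬t′ with x ≟ᶠ i | x′ ≟ᶠ i | y ≟ᶠ i | y′ ≟ᶠ i
        ...   | yes e | no e′ | _ | _ = ⊥-elim (e′ (i-eq ex e))
        ...   | no e | yes e′ | _ | _ = ⊥-elim (e (i-eq (sym ex) e′))
        ...   | _ | _ | yes e | no e′ = ⊥-elim (e′ (i-eq ey e))
        ...   | _ | _ | no e | yes e′ = ⊥-elim (e (i-eq (sym ey) e′))
        ...   | yes _ | yes _ | yes _ | yes _ = refl
        ...   | yes _ | yes _ | no y≢ | no y≢′ = spoke-ext ¬t ¬t′ y≢ y≢′ ey eπ
        ...   | no x≢ | no x≢′ | yes _ | yes _ = spoke-ext ¬t ¬t′ x≢ x≢′ ex eπ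
        ...   | no x≢ | no x≢′ | no y≢ | no y≢′ =
                cong₂ (λ a f → f a) (trans (sym (w′-old x≢)) (trans ex (w′-old x≢′)))
                  (cong₂ (λ b p a → C a b p) (trans (sym (w′-old y≢)) (trans ey (w′-old y≢′)))
                                             (trans (sym (map-old ¬t)) (trans eπ (map-old ¬t′))))

        u-legal : ∀ {π : Vec (Fin n) k} → Legal (map w′ π) → Legal (map u π)
        u-legal {π} lg r = trans (cong part (lookup-map r u π)) (trans (w′-part _)
                             (trans (cong part (sym (lookup-map r w′ π))) (lg r)))

        u-legal⁻ : ∀ {π : Vec (Fin n) k} → Legal (map u π) → Legal (map w′ π)
        u-legal⁻ {π} lg r = trans (cong part (lookup-map r w′ π)) (trans (sym (w′-part _))
                             (trans (cong part (sym (lookup-map r u π))) (lg r)))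

        unique : ∀ {π} → Legal (map w′ π) → ¬ Through π → ∀ {y v x} → y ≢ i → v ≢ i → x ≢ i →
                 w y ≢ w v → NonP (w y) → NonP (w v) → NonP (w x) → w x ≢ w y → w x ≡ w v
        unique {π} lg ¬t {y} {v} {x} y≢ v≢ x≢ y≢v npy npv npx x≢y with w x ≟ⁿ w v
        ... | yes e = e
        ... | no x≢v = ⊥-elim (no-four-more π (legal-inj π lg) {i} {y} {v} {x} (y≢ ∘ sym) (v≢ ∘ sym) (x≢ ∘ sym)
                (y≢v ∘ cong w) (λ { refl → x≢y refl }) (λ { refl → x≢v refl })
                (λ r e → ¬t (r , sym e)) (legal-out {w} π lg′ npy) (legal-out {w} π lg′ npv) (legal-out {w} π lg′ npx))
          where
          lg′ : Legal (map w π)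
          lg′ = subst Legal (map-old {π} ¬t) lg

        follow-match : ∀ {y v a b c} → part (u i) ≡ X a → part (u y) ≡ X b → part (u v) ≡ X c →
                       ∀ d → Out L d → ∀ {Y Y′} → Y ≡ w y → Y′ ≢ w y →
                       Match (ε a b c) (follow y v d Y) (follow y v d Y′) d
        follow-match _ _ _ inf inf _ _ = inf
        follow-match {y} {v} {a} {b} {c} pi py pv (red j l) _ {Y} {Y′} e e′ with Y ≟ⁿ w y | Y′ ≟ⁿ w y
        ... | no ne | _ = ⊥-elim (ne e)
        ... | yes _ | yes e″ = ⊥-elim (e′ e″)
        ... | yes _ | no _ rewrite pi | py | pv = red (xor-solve (ε a b c) j)

        part-u : ∀ {x x′} → x ≢ i → x′ ≢ i → w x ≡ w x′ → part (u x) ≡ part (u x′)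
        part-u x≢ x′≢ e = cong part (eqs⁻ s _ _ x≢ x′≢ e)

        pick-match : ∀ {y v π a b c} → Legal (map w′ π) → ¬ Through π → y ≢ i → v ≢ i →
                     part (u i) ≡ X a → part (u y) ≡ X b → part (u v) ≡ X c →
                     Out L (edge w y v π) →
                     Match (ε a b c) (pick (map w π) (w y)) (pick (map w π) (w v)) (edge w y v π)
        pick-match {y} {v} {π} {a} {b} {c} lg ¬t y≢ v≢ pi py pv o with em {P = Pair (map w π)}
        ... | no ¬p = ⊥-elim (¬p (y , v , y≢ , v≢ , o))
        ... | yes (y₀ , v₀ , y₀≢ , v₀≢ , o₀) with red-NonP (Out-red o) | red-NonP (Out-red o₀)
        ...   | y≢v , npy , npv | y₀≢v₀ , npy₀ , npv₀ with w y ≟ⁿ w y₀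
        ...     | yes e = conclude e (unique {π} lg ¬t y₀≢ v₀≢ v≢ y₀≢v₀ npy₀ npv₀ npv (λ e′ → y≢v (trans e (sym e′))))
          where
          conclude : w y ≡ w y₀ → w v ≡ w v₀ →
                     Match (ε a b c) (follow y₀ v₀ (edge w y₀ v₀ π) (w y)) (follow y₀ v₀ (edge w y₀ v₀ π) (w v)) (edge w y v π)
          conclude e f = subst (Match (ε a b c) _ _) (cong₂ (λ p q → C p q (map w π)) (sym e) (sym f))
            (follow-match {y₀} {v₀} pi (trans (sym (part-u y≢ y₀≢ e)) py) (trans (sym (part-u v≢ v₀≢ f)) pv)
              (edge w y₀ v₀ π) o₀ e (λ e′ → y≢v (trans e (sym e′))))
        ...     | no ne = conclude (unique {π} lg ¬t y₀≢ v₀≢ y≢ y₀≢v₀ npy₀ npv₀ npy ne)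
          where
          conclude : w y ≡ w v₀ →
                     Match (ε a b c) (follow y₀ v₀ (edge w y₀ v₀ π) (w y)) (follow y₀ v₀ (edge w y₀ v₀ π) (w v)) (edge w y v π)
          conclude e with em {P = w v ≡ w y₀}
          ... | no ne′ = ⊥-elim (y≢v (trans e (sym (unique {π} lg ¬t y₀≢ v₀≢ v≢ y₀≢v₀ npy₀ npv₀ npv ne′))))
          ... | yes f = Match-swapʳ a c b (subst (Match (ε a c b) _ _) (trans (cong₂ (λ p q → C p q (map w π)) (sym f) (sym e)) (C-sym _ _ _))
                (follow-match {y₀} {v₀} pi (trans (sym (part-u v≢ y₀≢ f)) pv) (trans (sym (part-u y≢ v₀≢ e)) py)
                  (edge w y₀ v₀ π) o₀ f ne))

        match-out : ∀ {e a b c} → Match e a b c → Out L c → Out L a × Out L b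
        match-out inf inf = inf , inf
        match-out (red _) (red le) = red le , red le

        match-in : ∀ {e a b c} → Match e a b c → ¬ Out L c → ¬ Out L a × ¬ Out L b
        match-in inf ¬o = ⊥-elim (¬o inf)
        match-in (red _) ¬o = (λ { (red le) → ¬o (red le) }) , (λ { (red le) → ¬o (red le) })

        spoke-T4 : ∀ {y v π} → Legal (map w′ π) → ¬ Through π → y ≢ i → v ≢ i →
                   T4 (part (u i)) (part (u y)) (part (u v)) (spoke y π) (spoke v π) (edge w y v π)
        spoke-T4 {y} {v} {π} lg ¬t y≢ v≢ {a} {b} {c} pi py pv ra rb rc = go
          where
          sim : edge u y v π ≈[ L ] edge w y v π
          sim = cols s y v π y≢ v≢ (away π ¬t)
          m : Match (ε a b c) (edge u i y π) (edge u i v π) (edge u y v π)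
          m = C-T4 _ _ _ _ pi py pv (≈-red (spoke-≈ y π) ra) (≈-red (spoke-≈ v π) rb) (≈-red sim rc)
          go : Match (ε a b c) (spoke y π) (spoke v π) (edge w y v π)
          go with out? L (edge u y v π)
          go | yes o with match-out m o | out? L (edge u i y π) | out? L (edge u i v π)
          ... | _ | yes _ | yes _ = pick-match {π = π} lg ¬t y≢ v≢ pi py pv (≈-Out (≈-sym sim) o)
          ... | oa , _ | no ¬oa | _ = ⊥-elim (¬oa oa)
          ... | _ , ob | _ | no ¬ob = ⊥-elim (¬ob ob)
          go | no ¬o with match-in m ¬o | out? L (edge u i y π) | out? L (edge u i v π)
          ... | _ | no _ | no _ = subst (Match (ε a b c) _ _) (sym (≈-in (≈-sym sim) ¬o)) m
          ... | ¬oa , _ | yes oa | _ = ⊥-elim (¬oa oa)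
          ... | _ , ¬ob | _ | yes ob = ⊥-elim (¬ob ob)

        D-T4 : ∀ {x y v π} → Legal (map w′ π) → x ≢ y → x ≢ v → y ≢ v →
               T4 (part (u x)) (part (u y)) (part (u v)) (D x y π) (D x v π) (D y v π)
        D-T4 {x} {y} {v} {π} lg x≢y x≢v y≢v with em {P = Through π}
        ... | yes t = C-T4 _ _ _ _
        ... | no ¬t with x ≟ᶠ i | y ≟ᶠ i | v ≟ᶠ i
        ...   | yes refl | yes refl | _ = ⊥-elim (x≢y refl)
        ...   | yes refl | no _ | yes refl = ⊥-elim (x≢v refl)
        ...   | no _ | yes refl | yes refl = ⊥-elim (y≢v refl)
        ...   | yes refl | no y≢ | no v≢ = spoke-T4 {π = π} lg ¬t y≢ v≢
        ...   | no x≢ | yes refl | no v≢ = T4-swapˡ {p = part (u i)} {part (u x)} {part (u v)} (spoke-T4 {π = π} lg ¬t x≢ v≢)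
        ...   | no x≢ | no y≢ | yes refl = T4-swapʳ {p = part (u x)} {part (u i)} {part (u y)}
                (T4-swapˡ {p = part (u i)} {part (u x)} {part (u y)} (spoke-T4 {π = π} lg ¬t x≢ y≢))
        ...   | no x≢ | no y≢ | no v≢ = subst₂ (λ p q → T4 p q (part (u v)) _ _ _) (sym (parts s x x≢)) (sym (parts s y y≢))
                (subst (λ r → T4 (part (w x)) (part (w y)) r _ _ _) (sym (parts s v v≢)) (C-T4 _ _ _ _))

        target : Target w′ i D
        target = record
          { d-sym = D-sym
          ; d-ext = λ {x} {y} {π} {x′} {y′} {π′} → D-ext {x} {y} {π} {x′} {y′} {π′}
          ; d-old = λ {x} {y} {π} lg _ x≢ y≢ ¬t → trans
              (trans (cong₂ (λ a b → C a b (map w′ π)) (w′-old x≢) (w′-old y≢)) (cong (C (w x) (w y)) (map-old {π} (λ (r , e) → ¬t r e))))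
              (sym (D-old {x} {y} {π} (λ (r , e) → ¬t r e) x≢ y≢))
          ; d-fit = λ {x} {y} {π} lg ne → subst₂ (λ p q → Fit p q (D x y π)) (w′-part x) (w′-part y)
              (Fit-≈ (D-≈ x y π) (C-fit _ _ _ (λ e → ne (eq-u e))))
          ; d-tri = λ {x} {y} {v} {π} lg xy xv yv → transport x y v
              (D x y π) (D x v π) (D y v π)
              ( T1-≈ (D-≈ x y π) (D-≈ x v π) (D-≈ y v π) (C-T1 _ _ _ _)
              , T3-≈ (D-≈ x y π) (D-≈ x v π) (D-≈ y v π) (C-T3 _ _ _ _)
              , D-T4 {π = π} lg (xy ∘ cong w′) (xv ∘ cong w′) (yv ∘ cong w′))
          }
          where
          Tri : (p q r : Part k) (a b c : Col) → Set
          Tri p q r a b c = T1 p q r a b c × T3 p q r a b c × T4 p q r a b c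
          transport : ∀ x y v a b c → Tri (part (u x)) (part (u y)) (part (u v)) a b c → Tri (part (w′ x)) (part (w′ y)) (part (w′ v)) a b c
          transport x y v a b c h = subst (λ p → Tri p (part (w′ y)) (part (w′ v)) a b c) (w′-part x)
            (subst (λ q → Tri (part (u x)) q (part (w′ v)) a b c) (w′-part y)
              (subst (λ r → Tri (part (u x)) (part (u y)) r a b c) (w′-part v) h))

      follow-real : ∀ y v d Y → Out L d → d ≢ inf → follow y v d Y ≢ inf
      follow-real y v inf Y _ ne = ⊥-elim (ne refl)
      follow-real y v (red j l) Y _ _ with Y ≟ⁿ w y
      ... | yes _ = λ ()
      ... | no _  = λ ()

      pick-real : Real (_≢ i) w → ∀ {π} → ¬ Through π → ∀ Y → pick (map w π) Y ≢ inf
      pick-real re {π} ¬t Y with em {P = Pair (map w π)}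
      ... | no _ = λ ()
      ... | yes (y , v , y≢ , v≢ , o) = follow-real y v (edge w y v π) Y o (re y v π y≢ v≢ (away π ¬t))

      spoke-real : Real (_≢ i) w → ∀ {y π} → ¬ Through π → spoke y π ≢ inf
      spoke-real re {y} {π} ¬t with out? L (edge u i y π)
      ... | yes _ = pick-real re {π} ¬t (w y)
      ... | no ¬o = λ e → ¬o (subst (Out L) (sym e) inf)

      D-real : Real (_≢ i) w → ∀ {x y π} → ¬ Through π → D x y π ≢ inf
      D-real re {x} {y} {π} ¬t with em {P = Through π} | x ≟ᶠ i | y ≟ᶠ i
      ... | yes t | _ | _ = ⊥-elim (¬t t)
      ... | no _ | yes _ | yes _ = λ ()
      ... | no _ | yes _ | no _ = spoke-real re {y} {π} ¬t
      ... | no _ | no _ | yes _ = spoke-real re {x} {π} ¬t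
      ... | no _ | no x≢ | no y≢ = re x y π x≢ y≢ (away π ¬t)

      new : Σ[ z ∈ ℕ ] Sim L All u (updateAt w i (const z)) ×
                       (NonP (u i) → Real (_≢ i) w → Real All (updateAt w i (const z)))
      new with create w i (part (u i)) D target
      ... | z , big , pz , C≡D = z , sim , real
        where
        sim : Sim L All u (w′ z big pz)
        sim .parts j _ = w′-part z big pz j
        sim .eqs x y _ _ = eq-u z big pz
        sim .eqs⁻ x y _ _ = u-eq z big pz
        sim .cols x y π _ _ _ with em {P = u x ≡ u y} | em {P = Legal (map u π)}
        ... | yes e | _ = ≈-reflexive (trans (trans (cong (λ a → C (u x) a (map u π)) (sym e)) (C-irr _ _))
                (sym (trans (cong (λ a → C (w′ z big pz x) a _) (sym (eq-u z big pz e))) (C-irr _ _))))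
        ... | no _ | no ¬lg = ≈-reflexive (trans (C-illegal ¬lg) (sym (C-illegal (¬lg ∘ u-legal z big pz {π}))))
        ... | no ne | yes lg = ≈-trans (D-≈ x y π) (≈-reflexive (sym (C≡D x y π (u-legal⁻ z big pz {π} lg) (ne ∘ u-eq z big pz))))
        real : NonP (u i) → Real (_≢ i) w → Real All (w′ z big pz)
        real np re x y π _ _ _ e = D-real re {x} {y} {π} ¬t (trans (sym (C≡D x y π lg (proj₁ (red-NonP isred)))) e)
          where
          isred : IsRed (edge (w′ z big pz) x y π)
          isred = subst IsRed (sym e) inf
          lg : Legal (map (w′ z big pz) π)
          lg = red-legal isred
          ¬t : ¬ Through π
          ¬t (r , q) = np r (trans (cong part (cong u (sym q))) (trans (cong part (sym (lookup-map r u π))) (u-legal z big pz {π} lg r)))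

    opaque
      zigzag : Σ[ z ∈ ℕ ] Sim L All u (updateAt w i (const z)) ×
                          (NonP (u i) → Real (_≢ i) w → Real All (updateAt w i (const z)))
      zigzag with em {P = Σ[ j ∈ Fin n ] j ≢ i × u j ≡ u i}
      ... | no ¬e = New.new (λ j j≢ e → ¬e (j , j≢ , e))
      ... | yes (j , j≢ , e) = w j ,
        Sim-trans (Sim-refl (λ x _ → back x)) (Sim-trans (Sim-∘ [ i ∣ j ] (∣-≢ j≢) s) (Sim-refl (λ x _ → sym (update-∘ w i j x)))) ,
        λ _ re → Real-≗ (λ x → sym (update-∘ w i j x)) (Real-∘ [ i ∣ j ] (∣-≢ j≢) re)
        where
        back : ∀ x → u x ≡ u ([ i ∣ j ] x)
        back x with x ≟ᶠ i
        ... | yes refl = trans (sym e) (cong u (sym (update-≡ id x j)))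
        ... | no x≢ = cong u (sym (update-≢ id j x≢))

  open Zigzag public using (zigzag)

  module Density (L : ℕ) (u : Fin n → ℕ) where

    module Neutral (i : Fin n) where

      Thru : Fin n → Fin n → Vec (Fin n) k → Set
      Thru x y π = x ≡ i ⊎ y ≡ i ⊎ Σ[ r ∈ Fin k ] lookup π r ≡ i

      D : Pattern
      D x y π with em {P = Thru x y π}
      ... | yes _ = nil
      ... | no _  = edge u x y π

      D-yes : ∀ {x y π} → Thru x y π → D x y π ≡ nil
      D-yes {x} {y} {π} t with em {P = Thru x y π}
      ... | yes _ = refl
      ... | no ¬t = ⊥-elim (¬t t)

      D-no : ∀ {x y π} → ¬ Thru x y π → D x y π ≡ edge u x y π
      D-no {x} {y} {π} ¬t with em {P = Thru x y π}
      ... | yes t = ⊥-elim (¬t t)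
      ... | no _ = refl

      module _ (z : ℕ) (big : ∀ j → u j < z) (pz : part z ≡ part (u i)) where
        u′ : Fin n → ℕ
        u′ = updateAt u i (const z)

        u′-old : ∀ {x} → x ≢ i → u′ x ≡ u x
        u′-old = update-≢ u z

        i-eq : ∀ {x y} → u′ x ≡ u′ y → x ≡ i → y ≡ i
        i-eq {x} {y} e refl with y ≟ᶠ x
        ... | yes q = q
        ... | no y≢ = ⊥-elim (<⇒≢ (big y) (trans (sym (u′-old y≢)) (trans (sym e) (update-≡ u x z))))

        target : Target u′ i D
        target = record { d-sym = d-sym ; d-ext = λ {x} {y} {π} {x′} {y′} {π′} → d-ext {x} {y} {π} {x′} {y′} {π′}
                        ; d-old = d-old ; d-fit = d-fit ; d-tri = λ {x} {y} {v} {π} lg xy xv yv → d-tri x y v π xy xv yv }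
          where
          d-sym : ∀ x y π → D x y π ≡ D y x π
          d-sym x y π with em {P = Thru x y π}
          ... | yes t = sym (D-yes (flip t))
            where
            flip : Thru x y π → Thru y x π
            flip (inj₁ e) = inj₂ (inj₁ e)
            flip (inj₂ (inj₁ e)) = inj₁ e
            flip (inj₂ (inj₂ e)) = inj₂ (inj₂ e)
          ... | no ¬t = trans (C-sym _ _ _) (sym (D-no (¬t ∘ flip)))
            where
            flip : Thru y x π → Thru x y π
            flip (inj₁ e) = inj₂ (inj₁ e)
            flip (inj₂ (inj₁ e)) = inj₁ e
            flip (inj₂ (inj₂ e)) = inj₂ (inj₂ e)
          at : ∀ {π π′ : Vec (Fin n) k} → map u′ π ≡ map u′ π′ → ∀ r → u′ (lookup π r) ≡ u′ (lookup π′ r)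
          at {π} {π′} e r = trans (sym (lookup-map r u′ π)) (trans (cong (λ v → lookup v r) e) (lookup-map r u′ π′))
          thru : ∀ {x y π x′ y′ π′} → u′ x ≡ u′ x′ → u′ y ≡ u′ y′ → map u′ π ≡ map u′ π′ → Thru x y π → Thru x′ y′ π′
          thru ex ey eπ (inj₁ e) = inj₁ (i-eq ex e)
          thru ex ey eπ (inj₂ (inj₁ e)) = inj₂ (inj₁ (i-eq ey e))
          thru {π = π} {π′ = π′} ex ey eπ (inj₂ (inj₂ (r , e))) = inj₂ (inj₂ (r , i-eq (at {π} {π′} eπ r) e))
          edge-u : ∀ {x y π} → ¬ Thru x y π → edge u′ x y π ≡ edge u x y π
          edge-u {x} {y} {π} ¬t = edge-local x y π (u′-old (¬t ∘ inj₁)) (u′-old (¬t ∘ inj₂ ∘ inj₁)) (λ r → u′-old (λ e → ¬t (inj₂ (inj₂ (r , e)))))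
          d-ext : ∀ {x y π x′ y′ π′} → u′ x ≡ u′ x′ → u′ y ≡ u′ y′ → map u′ π ≡ map u′ π′ → D x y π ≡ D x′ y′ π′
          d-ext {x} {y} {π} {x′} {y′} {π′} ex ey eπ with em {P = Thru x y π}
          ... | yes t = sym (D-yes (thru {π = π} {π′ = π′} ex ey eπ t))
          ... | no ¬t = trans (sym (edge-u ¬t)) (trans (cong₂ (λ a b → C a b _) ex ey) (trans (cong (C _ _) eπ)
                  (trans (edge-u ¬t′) (sym (D-no ¬t′)))))
            where
            ¬t′ : ¬ Thru x′ y′ π′
            ¬t′ t = ¬t (thru {π = π′} {π′ = π} (sym ex) (sym ey) (sym eπ) t)
          d-old : ∀ {x y π} → Legal (map u′ π) → u′ x ≢ u′ y → x ≢ i → y ≢ i → (∀ r → lookup π r ≢ i) → edge u′ x y π ≡ D x y π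
          d-old {x} {y} {π} _ _ x≢ y≢ π≢ = trans (edge-u ¬t) (sym (D-no ¬t))
            where
            ¬t : ¬ Thru x y π
            ¬t (inj₁ e) = x≢ e
            ¬t (inj₂ (inj₁ e)) = y≢ e
            ¬t (inj₂ (inj₂ (r , e))) = π≢ r e
          d-fit : ∀ {x y π} → Legal (map u′ π) → u′ x ≢ u′ y → Fit (part (u′ x)) (part (u′ y)) (D x y π)
          d-fit {x} {y} {π} _ ne with em {P = Thru x y π}
          ... | yes _ = nil
          ... | no ¬t = subst (Fit _ _) (edge-u ¬t) (C-fit _ _ _ ne)
          d-tri : ∀ x y v π → u′ x ≢ u′ y → u′ x ≢ u′ v → u′ y ≢ u′ v →
                  T1 (part (u′ x)) (part (u′ y)) (part (u′ v)) (D x y π) (D x v π) (D y v π) ×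
                  T3 (part (u′ x)) (part (u′ y)) (part (u′ v)) (D x y π) (D x v π) (D y v π) ×
                  T4 (part (u′ x)) (part (u′ y)) (part (u′ v)) (D x y π) (D x v π) (D y v π)
          d-tri x y v π _ _ _ = go em em em
            where
            Tri : (a b c : Col) → Set
            Tri a b c = T1 (part (u′ x)) (part (u′ y)) (part (u′ v)) a b c × T3 (part (u′ x)) (part (u′ y)) (part (u′ v)) a b c ×
                        T4 (part (u′ x)) (part (u′ y)) (part (u′ v)) a b c
            conv : ∀ {a b c} → D x y π ≡ a → D x v π ≡ b → D y v π ≡ c → Tri a b c → Tri (D x y π) (D x v π) (D y v π)
            conv refl refl refl h = h
            go : Dec (Thru x v π) → Dec (Thru x y π) → Dec (Thru y v π) → Tri (D x y π) (D x v π) (D y v π)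
            go (yes a) (yes b) (no c) = conv (D-yes b) (D-yes a) refl ((λ _ _ _ _ ()) , (λ _ _ _ ()) , λ _ _ _ ())
            go (yes a) _ (yes c) = conv refl (D-yes a) (D-yes c) ((λ _ _ _ _ ()) , (λ _ _ _ _ ()) , λ _ _ _ _ ())
            go (no a) (yes b) (yes c) = conv (D-yes b) refl (D-yes c) ((λ _ _ _ _ _ ()) , (λ _ _ _ ()) , λ _ _ _ ())
            go (no a) (no b) (no c) = conv (trans (D-no b) (sym (edge-u b))) (trans (D-no a) (sym (edge-u a)))
              (trans (D-no c) (sym (edge-u c))) (C-T1 _ _ _ _ , C-T3 _ _ _ _ , C-T4 _ _ _ _)
            go (yes (inj₁ e)) (no ¬t) (no _) = ⊥-elim (¬t (inj₁ e))
            go (yes (inj₂ (inj₁ e))) (no _) (no ¬t) = ⊥-elim (¬t (inj₂ (inj₁ e)))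
            go (yes (inj₂ (inj₂ e))) (no ¬t) (no _) = ⊥-elim (¬t (inj₂ (inj₂ e)))
            go (no ¬t) (yes (inj₁ e)) (no _) = ⊥-elim (¬t (inj₁ e))
            go (no _) (yes (inj₂ (inj₁ e))) (no ¬t) = ⊥-elim (¬t (inj₁ e))
            go (no ¬t) (yes (inj₂ (inj₂ e))) (no _) = ⊥-elim (¬t (inj₂ (inj₂ e)))
            go (no _) (no ¬t) (yes (inj₁ e)) = ⊥-elim (¬t (inj₂ (inj₁ e)))
            go (no ¬t) (no _) (yes (inj₂ (inj₁ e))) = ⊥-elim (¬t (inj₂ (inj₁ e)))
            go (no ¬t) (no _) (yes (inj₂ (inj₂ e))) = ⊥-elim (¬t (inj₂ (inj₂ e)))

      neutral : Σ[ z ∈ ℕ ] part z ≡ part (u i) ×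
                (∀ x y π → Thru x y π → edge (updateAt u i (const z)) x y π ≢ inf)
      neutral with create u i (part (u i)) D target
      ... | z , _ , pz , C≡D = z , pz , λ x y π t e →
        let isred = subst IsRed (sym e) inf
        in case trans (sym e) (trans (C≡D x y π (red-legal isred) (proj₁ (red-NonP isred))) (D-yes t)) of λ ()

    opaque
      -- Detach node x, make the rest real, and attach x again.
      approximate : Σ[ w ∈ (Fin n → ℕ) ] Sim L All u w × Real All w
      approximate with em {P = Σ[ x ∈ Fin n ] Σ[ y ∈ Fin n ] Σ[ π ∈ Vec (Fin n) k ] edge u x y π ≡ inf}
      ... | no ¬e = u , Sim-refl (λ _ _ → refl) , λ x y π _ _ _ e → ¬e (x , y , π , e)
      ... | yes (x , y , π , e) = detached (Neutral.neutral x)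
        where
        ends : u x ≢ u y × NonP (u x) × NonP (u y)
        ends = red-NonP (subst IsRed (sym e) inf)
        x≢y : x ≢ y
        x≢y refl = proj₁ ends refl
        detached : Σ[ z ∈ ℕ ] part z ≡ part (u x) ×
                   (∀ a b ρ → Neutral.Thru x a b ρ → edge (updateAt u x (const z)) a b ρ ≢ inf) →
                 Σ[ w ∈ (Fin n → ℕ) ] Sim L All u w × Real All w
        detached (z , pz , nt) = reattached (zigzag {u = u¹} {u¹} (Sim-refl (λ _ _ → refl)))
          where
          u¹ : Fin n → ℕ
          u¹ = updateAt u x (const z)
          u¹y : u¹ y ≡ u y
          u¹y = update-≢ u z (x≢y ∘ sym)
          real¹ : Real (_≢ y) u¹
          real¹ a b ρ a≢y b≢y ρ≢y e with em {P = Neutral.Thru x a b ρ}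
          ... | yes t = nt a b ρ t e
          ... | no ¬t = no-four-more ρ (legal-inj {u¹} ρ lg) {a} {b} {x} {y}
                  (proj₁ abn ∘ cong u¹) (¬t ∘ inj₁) a≢y (¬t ∘ inj₂ ∘ inj₁) b≢y x≢y
                  (legal-out {u¹} ρ lg (proj₁ (proj₂ abn))) (legal-out {u¹} ρ lg (proj₂ (proj₂ abn)))
                  (λ r q → ¬t (inj₂ (inj₂ (r , sym q)))) (λ r q → ρ≢y r (sym q))
            where
            isred : IsRed (edge u¹ a b ρ)
            isred = subst IsRed (sym e) inf
            lg : Legal (map u¹ ρ)
            lg = red-legal isred
            abn : u¹ a ≢ u¹ b × NonP (u¹ a) × NonP (u¹ b)
            abn = red-NonP isred
          reattached : Σ[ z₁ ∈ ℕ ] Sim L All u¹ (updateAt u¹ y (const z₁)) ×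
                       (NonP (u¹ y) → Real (_≢ y) u¹ → Real All (updateAt u¹ y (const z₁))) →
                       Σ[ w ∈ (Fin n → ℕ) ] Sim L All u w × Real All w
          reattached (z₁ , sim₁ , re₁) with zigzag {u = u} {updateAt u¹ y (const z₁)}
              (Sim-trans (Sim-refl {u = u} {u¹} (λ j j≢ → sym (update-≢ u z j≢))) (Sim-weaken ≤-refl (λ _ _ → tt) sim₁))
          ... | z₂ , sim₂ , re₂ = _ , sim₂ , re₂ (proj₁ (proj₂ ends))
                  (λ a b ρ _ _ _ → re₁ (λ r q → proj₂ (proj₂ ends) r (trans (cong part (sym u¹y)) q)) real¹ a b ρ tt tt (λ _ → tt))

-- Generated subalgebras of set algebras

sub-hit : ∀ {n} (i j : Fin n) → [ i ∣ j ] i ≡ j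
sub-hit i j = update-≡ id i j

sub-miss : ∀ {n} {i j l : Fin n} → l ≢ i → [ i ∣ j ] l ≡ l
sub-miss l≢i = update-≢ id _ l≢i

tra-hitˡ : ∀ {n} (i j : Fin n) → transpose i j i ≡ j
tra-hitˡ i j with i ≟ᶠ i
... | yes _ = refl
... | no i≢i = ⊥-elim (i≢i refl)

tra-hitʳ : ∀ {n} (i j : Fin n) → transpose i j j ≡ i
tra-hitʳ i j with j ≟ᶠ i
... | yes e = e
... | no _ with j ≟ᶠ j
...   | yes _ = refl
...   | no j≢j = ⊥-elim (j≢j refl)

tra-miss : ∀ {n} {i j l : Fin n} → l ≢ i → l ≢ j → transpose i j l ≡ l
tra-miss {i = i} {j} {l} l≢i l≢j with l ≟ᶠ i
... | yes e = ⊥-elim (l≢i e)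
... | no _ with l ≟ᶠ j
...   | yes e = ⊥-elim (l≢j e)
...   | no _ = refl

data Term (σ : SimType) (m : ℕ) (I : Set) : Set where
  leaf    : I → Term σ m I
  _⊕_ _⊗_ : Term σ m I → Term σ m I → Term σ m I
  ⊖_      : Term σ m I → Term σ m I
  ⊥ᵗ ⊤ᵗ   : Term σ m I
  app     : Op σ m → Term σ m I → Term σ m I
  cst     : Con σ m → Term σ m I

-- The subalgebra of the set algebra with base U generated by a family of sets.
-- Its elements are terms, so that it stays in the universe of U.
module Closure (σ : SimType) (m : ℕ) (U : Set) {I : Set} (gen : I → ℘ (Tuples {m} (λ _ → U))) where
  private module S = Algebra (SetAlgebra σ m U)

  ⟦_⟧ : Term σ m I → S.Carrier
  ⟦ leaf g ⟧  = gen g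
  ⟦ x ⊕ y ⟧   = ⟦ x ⟧ S.+ ⟦ y ⟧
  ⟦ x ⊗ y ⟧   = ⟦ x ⟧ S.· ⟦ y ⟧
  ⟦ ⊖ x ⟧     = S.- ⟦ x ⟧
  ⟦ ⊥ᵗ ⟧      = S.𝟘
  ⟦ ⊤ᵗ ⟧      = S.𝟙
  ⟦ app o x ⟧ = S.op o ⟦ x ⟧
  ⟦ cst d ⟧   = S.con d

  ⟨_⟩ : Term σ m I → (Fin m → U) → Set
  ⟨ x ⟩ = proj₁ ⟦ x ⟧

  resp : ∀ x {s t : Fin m → U} → s ≗ t → ⟨ x ⟩ s → ⟨ x ⟩ t
  resp x = proj₂ ⟦ x ⟧

  Clo : Algebra σ m 0ℓ 0ℓ
  Clo = record
    { Carrier = Term σ m I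
    ; _≈_ = λ x y → ⟦ x ⟧ S.≈ ⟦ y ⟧
    ; isEquivalence = record
        { refl = λ {x} → E.refl {⟦ x ⟧} ; sym = λ {x} {y} → E.sym {⟦ x ⟧} {⟦ y ⟧}
        ; trans = λ {x} {y} {z} → E.trans {⟦ x ⟧} {⟦ y ⟧} {⟦ z ⟧} }
    ; _+_ = _⊕_ ; _·_ = _⊗_ ; -_ = ⊖_ ; 𝟘 = ⊥ᵗ ; 𝟙 = ⊤ᵗ ; op = app ; con = cst
    ; +-cong = λ {x} {x′} {y} {y′} → S.+-cong {⟦ x ⟧} {⟦ x′ ⟧} {⟦ y ⟧} {⟦ y′ ⟧}
    ; ·-cong = λ {x} {x′} {y} {y′} → S.·-cong {⟦ x ⟧} {⟦ x′ ⟧} {⟦ y ⟧} {⟦ y′ ⟧}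
    ; -‿cong = λ {x} {x′} → S.-‿cong {⟦ x ⟧} {⟦ x′ ⟧}
    ; op-cong = λ o {x} {x′} → S.op-cong o {⟦ x ⟧} {⟦ x′ ⟧}
    }
    where module E = IsEquivalence S.isEquivalence

  _≡ₑ_ : Term σ m I → Term σ m I → Set
  _≡ₑ_ = Algebra._≈_ Clo

  module Laws (em : ∀ {ℓ} → ExcludedMiddle ℓ) where

    isBooleanᶜ : IsBoolean Clo
    isBooleanᶜ = record
      { isDistributiveLattice = record
          { isLattice = record
              { isEquivalence = Algebra.isEquivalence Clo
              ; ∨-comm = λ _ _ → Data.Sum.swap , Data.Sum.swap
              ; ∨-assoc = λ _ _ _ → Data.Sum.assocʳ , Data.Sum.assocˡ
              ; ∨-cong = λ {x} {y} {u} {v} → Algebra.+-cong Clo {x} {y} {u} {v}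
              ; ∧-comm = λ _ _ → Data.Product.swap , Data.Product.swap
              ; ∧-assoc = λ _ _ _ → (λ ((a , b) , c) → a , b , c) , λ (a , b , c) → (a , b) , c
              ; ∧-cong = λ {x} {y} {u} {v} → Algebra.·-cong Clo {x} {y} {u} {v}
              ; absorptive = (λ _ _ → (λ { (inj₁ a) → a ; (inj₂ (a , _)) → a }) , inj₁) ,
                             (λ _ _ → proj₁ , λ a → a , inj₁ a)
              }
          ; ∨-distrib-∧ =
              (λ _ _ _ → (λ { (inj₁ a) → inj₁ a , inj₁ a ; (inj₂ (b , c)) → inj₂ b , inj₂ c }) ,
                         (λ { (inj₁ a , _) → inj₁ a ; (inj₂ _ , inj₁ a) → inj₁ a ; (inj₂ b , inj₂ c) → inj₂ (b , c) })) ,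
              (λ _ _ _ → (λ { (inj₂ a) → inj₂ a , inj₂ a ; (inj₁ (b , c)) → inj₁ b , inj₁ c }) ,
                         (λ { (inj₂ a , _) → inj₂ a ; (inj₁ _ , inj₂ a) → inj₂ a ; (inj₁ b , inj₁ c) → inj₁ (b , c) }))
          ; ∧-distrib-∨ =
              (λ _ _ _ → (λ { (a , inj₁ b) → inj₁ (a , b) ; (a , inj₂ c) → inj₂ (a , c) }) ,
                         (λ { (inj₁ (a , b)) → a , inj₁ b ; (inj₂ (a , c)) → a , inj₂ c })) ,
              (λ _ _ _ → (λ { (inj₁ b , a) → inj₁ (b , a) ; (inj₂ c , a) → inj₂ (c , a) }) ,
                         (λ { (inj₁ (b , a)) → inj₁ b , a ; (inj₂ (c , a)) → inj₂ c , a }))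
          }
      ; ∨-complement = (λ x → (λ _ → _) , λ {s} _ → Data.Sum.swap (excluded x s)) , (λ x → (λ _ → _) , λ {s} _ → excluded x s)
      ; ∧-complement = (λ _ → (λ (f , a) → ⊥-elim (f a)) , λ ()) , (λ _ → (λ (a , f) → ⊥-elim (f a)) , λ ())
      ; ¬-cong = λ {x} {y} → Algebra.-‿cong Clo {x} {y}
      }
      where
      excluded : ∀ x (s : Fin m → U) → ⟨ x ⟩ s ⊎ ¬ ⟨ x ⟩ s
      excluded x s with em {P = ⟨ x ⟩ s}
      ... | yes p = inj₁ p
      ... | no ¬p = inj₂ ¬p

    cᶜ : Fin m → Term σ m I → Term σ m I
    cᶜ i = app (cyl i)

    c-𝟘ᶜ : ∀ i → cᶜ i ⊥ᵗ ≡ₑ ⊥ᵗ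
    c-𝟘ᶜ i = (λ { (_ , () , _) }) , λ ()

    c-extᶜ : ∀ i x → (x ⊗ cᶜ i x) ≡ₑ x
    c-extᶜ i x = proj₁ , λ {s} h → h , s , h , λ _ _ → refl

    c-·cᶜ : ∀ i x y → cᶜ i (x ⊗ cᶜ i y) ≡ₑ (cᶜ i x ⊗ cᶜ i y)
    c-·cᶜ i x y = (λ (t , (tx , r , ry , r≡t) , t≡s) → (t , tx , t≡s) , (r , ry , λ j j≢ → trans (r≡t j j≢) (t≡s j j≢))) ,
                  (λ ((t , tx , t≡s) , (r , ry , r≡s)) → t , (tx , r , ry , λ j j≢ → trans (r≡s j j≢) (sym (t≡s j j≢))) , t≡s)

    c-+ᶜ : ∀ i x y → cᶜ i (x ⊕ y) ≡ₑ (cᶜ i x ⊕ cᶜ i y)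
    c-+ᶜ i x y = (λ { (t , inj₁ h , e) → inj₁ (t , h , e) ; (t , inj₂ h , e) → inj₂ (t , h , e) }) ,
                 (λ { (inj₁ (t , h , e)) → t , inj₁ h , e ; (inj₂ (t , h , e)) → t , inj₂ h , e })

    c-commᶜ : ∀ i j x → cᶜ i (cᶜ j x) ≡ₑ cᶜ j (cᶜ i x)
    c-commᶜ i j x = half i j , half j i
      where
      half : ∀ i j {s} → ⟨ cᶜ i (cᶜ j x) ⟩ s → ⟨ cᶜ j (cᶜ i x) ⟩ s
      half i j {s} (t , (r , rx , r≡t) , t≡s) = q , (r , rx , r≡q) , λ l l≢j → update-≢ s (r j) l≢j
        where
        q : Fin m → U
        q = updateAt s j (const (r j))
        r≡q : ∀ l → l ≢ i → r l ≡ q l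
        r≡q l l≢i with l ≟ᶠ j
        ... | yes refl = sym (update-≡ s l (r l))
        ... | no l≢j = trans (r≡t l l≢j) (trans (t≡s l l≢i) (sym (update-≢ s (r j) l≢j)))

    module _ {p : T (hasSub σ)} where
      sᶜ : Fin m → Fin m → Term σ m I → Term σ m I
      sᶜ i j = app (sub {p = p} i j)

      s-idᶜ : ∀ i x → sᶜ i i x ≡ₑ x
      s-idᶜ i x = (λ {s} → resp x (eq s)) , (λ {s} → resp x (sym ∘ eq s))
        where
        eq : ∀ (s : Fin m → U) l → s ([ i ∣ i ] l) ≡ s l
        eq s l with l ≟ᶠ i
        ... | yes refl = cong s (sub-hit l l)
        ... | no l≢ = cong s (sub-miss l≢)

      s-endoᶜ : ∀ i j → IsBooleanEndo Clo (sᶜ i j)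
      s-endoᶜ i j = record { +-homo = λ _ _ → id , id ; ·-homo = λ _ _ → id , id ; -‿homo = λ _ → id , id
                           ; 𝟘-homo = id , id ; 𝟙-homo = id , id }

      s-cᶜ : ∀ i j x → sᶜ i j (cᶜ i x) ≡ₑ cᶜ i x
      s-cᶜ i j x = (λ {s} (t , tx , e) → t , tx , λ l l≢ → trans (e l l≢) (cong s (sub-miss l≢))) ,
                   (λ {s} (t , tx , e) → t , tx , λ l l≢ → trans (e l l≢) (cong s (sym (sub-miss l≢))))

      c-sᶜ : ∀ i j x → i ≢ j → cᶜ i (sᶜ i j x) ≡ₑ sᶜ i j x
      c-sᶜ i j x i≢j = (λ {s} (t , tx , e) → resp x (eq s t e) tx) , λ {s} h → s , h , λ _ _ → refl
        where
        eq : ∀ (s t : Fin m → U) → (∀ l → l ≢ i → t l ≡ s l) → ∀ l → t ([ i ∣ j ] l) ≡ s ([ i ∣ j ] l)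
        eq s t e l with l ≟ᶠ i
        ... | yes refl rewrite sub-hit l j = e j (i≢j ∘ sym)
        ... | no l≢ rewrite sub-miss {j = j} l≢ = e l l≢

      s-c-commᶜ : ∀ i j k x → k ≢ i → k ≢ j → sᶜ i j (cᶜ k x) ≡ₑ cᶜ k (sᶜ i j x)
      s-c-commᶜ i j k x k≢i k≢j = (λ {s} (t , tx , e) → updateAt s k (const (t k)) , resp x (to s t e) tx , λ l l≢ → update-≢ s (t k) l≢) ,
                                  (λ {s} (t , tx , e) → t ∘ [ i ∣ j ] , tx , from s t e)
        where
        to : ∀ (s t : Fin m → U) → (∀ l → l ≢ k → t l ≡ s ([ i ∣ j ] l)) → ∀ l → t l ≡ updateAt s k (const (t k)) ([ i ∣ j ] l)
        to s t e l with l ≟ᶠ i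
        ... | yes refl rewrite sub-hit l j = trans (e l (k≢i ∘ sym)) (trans (cong s (sub-hit l j)) (sym (update-≢ s (t k) (k≢j ∘ sym))))
        ... | no l≢i rewrite sub-miss {j = j} l≢i with l ≟ᶠ k
        ...   | yes refl = sym (update-≡ s l (t l))
        ...   | no l≢k = trans (e l l≢k) (trans (cong s (sub-miss l≢i)) (sym (update-≢ s (t k) l≢k)))
        from : ∀ (s t : Fin m → U) → (∀ l → l ≢ k → t l ≡ s l) → ∀ l → l ≢ k → t ([ i ∣ j ] l) ≡ s ([ i ∣ j ] l)
        from s t e l l≢k with l ≟ᶠ i
        ... | yes refl rewrite sub-hit l j = e j (k≢j ∘ sym)
        ... | no l≢i rewrite sub-miss {j = j} l≢i = e l l≢k

      c-s-swapᶜ : ∀ i j x → cᶜ i (sᶜ j i x) ≡ₑ cᶜ j (sᶜ i j x)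
      c-s-swapᶜ i j x = half i j , half j i
        where
        half : ∀ i j {s} → ⟨ cᶜ i (sᶜ j i x) ⟩ s → ⟨ cᶜ j (sᶜ i j x) ⟩ s
        half i j {s} (t , tx , e) = q , resp x eq tx , λ l l≢ → update-≢ s (t i) l≢
          where
          q : Fin m → U
          q = updateAt s j (const (t i))
          eq : ∀ l → t ([ j ∣ i ] l) ≡ q ([ i ∣ j ] l)
          eq l with l ≟ᶠ i | l ≟ᶠ j
          ... | yes refl | yes refl = trans (cong t (sub-hit l l)) (sym (trans (cong q (sub-hit l l)) (update-≡ s l (t l))))
          ... | yes refl | no l≢j = trans (cong t (sub-miss l≢j)) (sym (trans (cong q (sub-hit l j)) (update-≡ s j (t l))))
          ... | no l≢i | yes refl = trans (cong t (sub-hit l i)) (sym (trans (cong q (sub-miss l≢i)) (update-≡ s l (t i))))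
          ... | no l≢i | no l≢j = trans (cong t (sub-miss l≢j)) (trans (e l l≢i) (sym (trans (cong q (sub-miss l≢i)) (update-≢ s (t i) l≢j))))

      s-s-commᶜ : ∀ i j k l x → i ≢ j → i ≢ k → i ≢ l → j ≢ k → j ≢ l → k ≢ l → sᶜ j i (sᶜ l k x) ≡ₑ sᶜ l k (sᶜ j i x)
      s-s-commᶜ i j k l x ij ik il jk jl kl = (λ {s} → resp x (λ a → cong s (eq a))) , (λ {s} → resp x (λ a → cong s (sym (eq a))))
        where
        eq : ∀ a → [ j ∣ i ] ([ l ∣ k ] a) ≡ [ l ∣ k ] ([ j ∣ i ] a)
        eq a with a ≟ᶠ l | a ≟ᶠ j
        ... | yes refl | yes refl = ⊥-elim (jl refl)
        ... | yes refl | no a≢j = trans (cong [ j ∣ i ] (sub-hit a k)) (trans (sub-miss (jk ∘ sym)) (sym (trans (cong [ a ∣ k ] (sub-miss a≢j)) (sub-hit a k))))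
        ... | no a≢l | yes refl = trans (cong [ a ∣ i ] (sub-miss a≢l)) (trans (sub-hit a i) (sym (trans (cong [ l ∣ k ] (sub-hit a i)) (sub-miss il))))
        ... | no a≢l | no a≢j = trans (cong [ j ∣ i ] (sub-miss a≢l)) (trans (sub-miss a≢j) (sym (trans (cong [ l ∣ k ] (sub-miss a≢j)) (sub-miss a≢l))))

      s-sᶜ : ∀ i j l x → sᶜ l i (sᶜ j l x) ≡ₑ sᶜ l i (sᶜ j i x)
      s-sᶜ i j l x = (λ {s} → resp x (λ a → cong s (eq a))) , (λ {s} → resp x (λ a → cong s (sym (eq a))))
        where
        both : [ l ∣ i ] l ≡ [ l ∣ i ] i
        both with i ≟ᶠ l
        ... | yes refl = refl
        ... | no i≢l = trans (sub-hit l i) (sym (sub-miss i≢l))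
        eq : ∀ a → [ l ∣ i ] ([ j ∣ l ] a) ≡ [ l ∣ i ] ([ j ∣ i ] a)
        eq a with a ≟ᶠ j
        ... | yes refl = trans (cong [ l ∣ i ] (sub-hit a l)) (trans both (cong [ l ∣ i ] (sym (sub-hit a i))))
        ... | no a≢j = cong [ l ∣ i ] (trans (sub-miss a≢j) (sym (sub-miss a≢j)))

    module _ {p : T (hasTra σ)} where
      tᶜ : Fin m → Fin m → Term σ m I → Term σ m I
      tᶜ i j = app (tra {p = p} i j)

      private
        along : ∀ x {f g : Fin m → Fin m} → f ≗ g → (∀ {s : Fin m → U} → ⟨ x ⟩ (s ∘ f) → ⟨ x ⟩ (s ∘ g)) × (∀ {s : Fin m → U} → ⟨ x ⟩ (s ∘ g) → ⟨ x ⟩ (s ∘ f))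
        along x e = (λ {s} → resp x (λ a → cong s (e a))) , (λ {s} → resp x (λ a → cong s (sym (e a))))

      t-idᶜ : ∀ i x → tᶜ i i x ≡ₑ x
      t-idᶜ i x = along x eq
        where
        eq : ∀ a → transpose i i a ≡ a
        eq a with a ≟ᶠ i
        ... | yes refl = refl
        ... | no a≢i with a ≟ᶠ i
        ...   | yes e = ⊥-elim (a≢i e)
        ...   | no _ = refl

      t-symᶜ : ∀ i j x → tᶜ i j x ≡ₑ tᶜ j i x
      t-symᶜ i j x = along x eq
        where
        eq : ∀ a → transpose i j a ≡ transpose j i a
        eq a with a ≟ᶠ i in p | a ≟ᶠ j in q
        ... | yes refl | yes refl rewrite q = refl
        ... | yes refl | no _ rewrite p = refl
        ... | no _ | yes refl rewrite q = refl
        ... | no _ | no _ rewrite p | q = refl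

      t-endoᶜ : ∀ i j → IsBooleanEndo Clo (tᶜ i j)
      t-endoᶜ i j = record { +-homo = λ _ _ → id , id ; ·-homo = λ _ _ → id , id ; -‿homo = λ _ → id , id
                           ; 𝟘-homo = id , id ; 𝟙-homo = id , id }

      t-involᶜ : ∀ i j x → tᶜ i j (tᶜ i j x) ≡ₑ x
      t-involᶜ i j x = along x eq
        where
        eq : ∀ a → transpose i j (transpose i j a) ≡ a
        eq a with em {P = a ≡ i} | em {P = a ≡ j}
        ... | yes refl | _ = trans (cong (transpose a j) (tra-hitˡ a j)) (tra-hitʳ a j)
        ... | no a≢i | yes refl = trans (cong (transpose i a) (tra-hitʳ i a)) (tra-hitˡ i a)
        ... | no a≢i | no a≢j = trans (cong (transpose i j) (tra-miss a≢i a≢j)) (tra-miss a≢i a≢j)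

      t-tᶜ : ∀ i j k x → i ≢ j → i ≢ k → j ≢ k → tᶜ i j (tᶜ i k x) ≡ₑ tᶜ j k (tᶜ i j x)
      t-tᶜ i j k x ij ik jk = along x eq
        where
        eq : ∀ a → transpose i j (transpose i k a) ≡ transpose j k (transpose i j a)
        eq a with em {P = a ≡ i} | em {P = a ≡ j} | em {P = a ≡ k}
        ... | yes refl | _ | _ rewrite tra-hitˡ a k | tra-hitˡ a j | tra-hitˡ j k = tra-miss (ik ∘ sym) (jk ∘ sym)
        ... | no a≢i | yes refl | _ rewrite tra-miss {i = i} {k} a≢i jk | tra-hitʳ i a = sym (tra-miss ij ik)
        ... | no a≢i | no a≢j | yes refl rewrite tra-hitʳ i a | tra-miss {i = i} {j} a≢i a≢j | tra-hitʳ j a = tra-hitˡ i j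
        ... | no a≢i | no a≢j | no a≢k rewrite tra-miss {i = i} {k} a≢i a≢k | tra-miss {i = i} {j} a≢i a≢j = sym (tra-miss a≢j a≢k)

      t-sᶜ : ∀ {q : T (hasSub σ)} i j x → tᶜ i j (sᶜ {q} i j x) ≡ₑ sᶜ {q} j i x
      t-sᶜ i j x = along x eq
        where
        eq : ∀ a → transpose i j ([ i ∣ j ] a) ≡ [ j ∣ i ] a
        eq a with em {P = a ≡ i} | em {P = a ≡ j}
        ... | yes refl | yes refl = trans (cong (transpose a a) (sub-hit a a)) (trans (tra-hitˡ a a) (sym (sub-hit a a)))
        ... | yes refl | no a≢j = trans (cong (transpose a j) (sub-hit a j)) (trans (tra-hitʳ a j) (sym (sub-miss a≢j)))
        ... | no a≢i | yes refl = trans (cong (transpose i a) (sub-miss a≢i)) (trans (tra-hitʳ i a) (sym (sub-hit a i)))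
        ... | no a≢i | no a≢j = trans (cong (transpose i j) (sub-miss a≢i)) (trans (tra-miss a≢i a≢j) (sym (sub-miss a≢j)))

    module _ {p : T (hasDiag σ)} where
      dᶜ : Fin m → Fin m → Term σ m I
      dᶜ i j = cst (dia {p = p} i j)

      d-reflᶜ : ∀ i → dᶜ i i ≡ₑ ⊤ᵗ
      d-reflᶜ i = (λ _ → _) , λ _ → refl

      d-dᶜ : ∀ i j k → k ≢ i → k ≢ j → dᶜ i j ≡ₑ cᶜ k (dᶜ i k ⊗ dᶜ k j)
      d-dᶜ i j k k≢i k≢j =
        (λ {s} e → updateAt s k (const (s i)) ,
           (trans (update-≢ s (s i) (k≢i ∘ sym)) (sym (update-≡ s k (s i))) ,
            trans (update-≡ s k (s i)) (trans e (sym (update-≢ s (s i) (k≢j ∘ sym))))) ,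
           λ l l≢ → update-≢ s (s i) l≢) ,
        (λ {s} (t , (a , b) , e) → trans (sym (e i (k≢i ∘ sym))) (trans a (trans b (e j (k≢j ∘ sym)))))

      d-cᶜ : ∀ i j x → i ≢ j → (cᶜ i (dᶜ i j ⊗ x) ⊗ cᶜ i (dᶜ i j ⊗ (⊖ x))) ≡ₑ ⊥ᵗ
      d-cᶜ i j x i≢j = (λ {s} ((t , (a , tx) , e) , (r , (b , ¬rx) , f)) → ⊥-elim (¬rx (resp x (eq s t r a b e f) tx))) , λ ()
        where
        eq : ∀ (s t r : Fin m → U) → t i ≡ t j → r i ≡ r j → (∀ l → l ≢ i → t l ≡ s l) → (∀ l → l ≢ i → r l ≡ s l) → ∀ l → t l ≡ r l
        eq s t r a b e f l with l ≟ᶠ i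
        ... | yes refl = trans a (trans (e j (i≢j ∘ sym)) (sym (trans b (f j (i≢j ∘ sym)))))
        ... | no l≢ = trans (e l l≢) (sym (f l l≢))

      s-dᶜ : ∀ {q : T (hasSub σ)} i j → sᶜ {q} i j (dᶜ i j) ≡ₑ ⊤ᵗ
      s-dᶜ i j = (λ _ → _) , λ {s} _ → cong s (trans (sub-hit i j) (sym fix))
        where
        fix : [ i ∣ j ] j ≡ j
        fix with j ≟ᶠ i
        ... | yes refl = sub-hit j j
        ... | no j≢i = sub-miss j≢i

      ·d-sᶜ : ∀ {q : T (hasSub σ)} i j x → ((x ⊗ dᶜ i j) ⊗ sᶜ {q} i j x) ≡ₑ (x ⊗ dᶜ i j)
      ·d-sᶜ i j x = proj₁ , λ {s} (sx , e) → (sx , e) , resp x (eq s e) sx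
        where
        eq : ∀ (s : Fin m → U) → s i ≡ s j → ∀ l → s l ≡ s ([ i ∣ j ] l)
        eq s e l with l ≟ᶠ i
        ... | yes refl = trans e (cong s (sym (sub-hit l j)))
        ... | no l≢ = cong s (sym (sub-miss l≢))

module _ (em : ∀ {ℓ} → ExcludedMiddle ℓ) {m : ℕ} {U I : Set} (gen : I → ℘ (Tuples {m} (λ _ → U))) where

  Clo-isSc : IsSc (Closure.Clo scType m U gen)
  Clo-isSc = record
    { isBoolean = isBooleanᶜ ; c-𝟘 = c-𝟘ᶜ ; c-ext = c-extᶜ ; c-·c = c-·cᶜ ; c-comm = c-commᶜ ; s-id = s-idᶜ
    ; s-endo = s-endoᶜ ; s-c = s-cᶜ ; c-s = c-sᶜ ; s-c-comm = s-c-commᶜ ; c-s-swap = c-s-swapᶜ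
    ; s-s-comm = s-s-commᶜ ; s-s = s-sᶜ }
    where open Closure.Laws scType m U gen em

  Clo-isQA : IsQA (Closure.Clo qaType m U gen)
  Clo-isQA = record
    { isBoolean = isBooleanᶜ ; s-id = s-idᶜ ; t-id = t-idᶜ ; t-sym = t-symᶜ ; c-ext = c-extᶜ ; c-+ = c-+ᶜ
    ; s-c = s-cᶜ ; c-s = c-sᶜ ; s-c-comm = s-c-commᶜ ; s-endo = s-endoᶜ ; t-endo = t-endoᶜ
    ; t-invol = t-involᶜ ; t-t = t-tᶜ ; t-s = t-sᶜ }
    where open Closure.Laws qaType m U gen em

  Clo-isCA : IsCA (Closure.Clo caType m U gen)
  Clo-isCA = record
    { isBoolean = isBooleanᶜ ; c-𝟘 = c-𝟘ᶜ ; c-ext = c-extᶜ ; c-·c = c-·cᶜ ; c-comm = c-commᶜ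
    ; d-refl = d-reflᶜ ; d-d = d-dᶜ ; d-c = d-cᶜ }
    where open Closure.Laws caType m U gen em

  Clo-isPEA : IsPEA (Closure.Clo peaType m U gen)
  Clo-isPEA = record
    { isQA = record
      { isBoolean = isBooleanᶜ ; s-id = s-idᶜ ; t-id = t-idᶜ ; t-sym = t-symᶜ ; c-ext = c-extᶜ ; c-+ = c-+ᶜ
      ; s-c = s-cᶜ ; c-s = c-sᶜ ; s-c-comm = s-c-commᶜ ; s-endo = λ _ _ → record { +-homo = λ _ _ → id , id ; ·-homo = λ _ _ → id , id ; -‿homo = λ _ → id , id ; 𝟘-homo = id , id ; 𝟙-homo = id , id }
      ; t-endo = λ _ _ → record { +-homo = λ _ _ → id , id ; ·-homo = λ _ _ → id , id ; -‿homo = λ _ → id , id ; 𝟘-homo = id , id ; 𝟙-homo = id , id }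
      ; t-invol = t-involᶜ ; t-t = t-tᶜ ; t-s = t-sᶜ }
    ; d-refl = d-reflᶜ ; s-d = s-dᶜ ; ·d-s = ·d-sᶜ }
    where
    open Closure.Laws peaType m U gen em

  Clo-is : ∀ K → Is K (Closure.Clo (type K) m U gen)
  Clo-is Sc  = Clo-isSc
  Clo-is QA  = Clo-isQA
  Clo-is CA  = Clo-isCA
  Clo-is PEA = Clo-isPEA

-- The blurred algebra

enum-Op : ∀ {m} → Enumerable (Op peaType (suc m))
enum-Op = enum-image f onto (enum-× enum-Fin (enum-× enum-Fin enum-Fin))
  where
  f : ∀ {m} → Fin 3 × Fin (suc m) × Fin (suc m) → Op peaType (suc m)
  f (zero , i , j)           = cyl i
  f (suc zero , i , j)       = sub i j
  f (suc (suc zero) , i , j) = tra i j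
  onto : ∀ {m} (o : Op peaType (suc m)) → Σ[ a ∈ _ ] f a ≡ o
  onto (cyl i)   = (zero , i , i) , refl
  onto (sub i j) = (suc zero , i , j) , refl
  onto (tra i j) = (suc (suc zero) , i , j) , refl

enum-Con : ∀ {m} → Enumerable (Con peaType (suc m))
enum-Con = enum-image (λ (i , j) → dia i j) (λ { (dia i j) → (i , j) , refl }) (enum-× enum-Fin enum-Fin)

enum-Term : ∀ {σ m I} → Enumerable I → Enumerable (Op σ m) → Enumerable (Con σ m) → Enumerable (Term σ m I)
enum-Term {σ} {m} {I} eI eO eC = enum-image (λ (d , c) → f d c) onto (enum-× enum-ℕ enum-ℕ)
  where
  Shape : Set
  Shape = (I ⊎ Op σ m ⊎ Con σ m ⊎ Fin 5) × (ℕ × ℕ)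
  shapes : Enumerable Shape
  shapes = enum-× (enum-⊎ eI (enum-⊎ eO (enum-⊎ eC enum-Fin))) (enum-× enum-ℕ enum-ℕ)
  build : (ℕ → Term σ m I) → Shape → Term σ m I
  build f (inj₁ i , _)                                                  = leaf i
  build f (inj₂ (inj₁ o) , a , _)                                       = app o (f a)
  build f (inj₂ (inj₂ (inj₁ d)) , _)                                    = cst d
  build f (inj₂ (inj₂ (inj₂ zero)) , a , b)                             = f a ⊕ f b
  build f (inj₂ (inj₂ (inj₂ (suc zero))) , a , b)                       = f a ⊗ f b
  build f (inj₂ (inj₂ (inj₂ (suc (suc zero)))) , a , _)                 = ⊖ f a
  build f (inj₂ (inj₂ (inj₂ (suc (suc (suc zero))))) , _)               = ⊥ᵗ
  build f (inj₂ (inj₂ (inj₂ (suc (suc (suc (suc zero)))))) , _)         = ⊤ᵗ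
  f : ℕ → ℕ → Term σ m I
  f zero    c = ⊥ᵗ
  f (suc d) c = build (f d) (proj₁ shapes c)
  Coded : Term σ m I → ℕ → ℕ → Set
  Coded t d c = ∀ e → d ≤ e → f e c ≡ t
  coded : ∀ s d t → (∀ e → d ≤ e → build (f e) s ≡ t) → Σ[ d ∈ ℕ ] Σ[ c ∈ ℕ ] Coded t d c
  coded s d t h with proj₂ shapes s
  ... | c , eq = suc d , c , λ { (suc e) (s≤s le) → trans (cong (build (f e)) eq) (h e le) }
  code : ∀ t → Σ[ d ∈ ℕ ] Σ[ c ∈ ℕ ] Coded t d c
  code (leaf i) = coded (inj₁ i , 0 , 0) 0 _ (λ _ _ → refl)
  code (cst d)  = coded (inj₂ (inj₂ (inj₁ d)) , 0 , 0) 0 _ (λ _ _ → refl)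
  code ⊥ᵗ = coded (inj₂ (inj₂ (inj₂ (suc (suc (suc zero))))) , 0 , 0) 0 _ (λ _ _ → refl)
  code ⊤ᵗ = coded (inj₂ (inj₂ (inj₂ (suc (suc (suc (suc zero)))))) , 0 , 0) 0 _ (λ _ _ → refl)
  code (app o x) with code x
  ... | d , c , h = coded (inj₂ (inj₁ o) , c , 0) d _ (λ e le → cong (app o) (h e le))
  code (⊖ x) with code x
  ... | d , c , h = coded (inj₂ (inj₂ (inj₂ (suc (suc zero)))) , c , 0) d _ (λ e le → cong ⊖_ (h e le))
  code (x ⊕ y) with code x | code y
  ... | d , c , h | d′ , c′ , h′ = coded (inj₂ (inj₂ (inj₂ zero)) , c , c′) (d ⊔ d′) _
        (λ e le → cong₂ _⊕_ (h e (≤-trans (m≤m⊔n d d′) le)) (h′ e (≤-trans (m≤n⊔m d d′) le)))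
  code (x ⊗ y) with code x | code y
  ... | d , c , h | d′ , c′ , h′ = coded (inj₂ (inj₂ (inj₂ (suc zero))) , c , c′) (d ⊔ d′) _
        (λ e le → cong₂ _⊗_ (h e (≤-trans (m≤m⊔n d d′) le)) (h′ e (≤-trans (m≤n⊔m d d′) le)))
  onto : ∀ t → Σ[ a ∈ ℕ × ℕ ] f (proj₁ a) (proj₂ a) ≡ t
  onto t with code t
  ... | d , c , h = (d , c) , h d ≤-refl

height : Col → ℕ
height (red _ l) = suc l
height _         = 0

height-in : ∀ {L c} → c ≢ inf → height c ≤ L → ¬ Out L c
height-in ne _  inf     = ne refl
height-in ne lt (red q) = <-irrefl refl (≤-trans lt q)

module Blurred (em : ∀ {ℓ} → ExcludedMiddle ℓ) (k : ℕ) where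
  open Similarity em k public

  tuple : ℕ → Fin n → ℕ
  tuple c j = nth c (toℕ j)

  types : ℕ × ℕ → ℘ (Tuples {n} (λ _ → ℕ))
  types (L , c) = (λ w → Sim L All (tuple c) w) , λ e s → Sim-trans s (Sim-refl (λ j _ → e j))

  open Closure peaType n ℕ types public

  Blur : Algebra peaType n 0ℓ 0ℓ
  Blur = Clo

  module B = Algebra Blur

  opaque
    level : ∀ x → Σ[ L ∈ ℕ ] (∀ {u w} → Sim L All u w → ⟨ x ⟩ u → ⟨ x ⟩ w)
    level (leaf (L , c)) = L , λ s h → Sim-trans h s
    level (x ⊕ y) with level x | level y
    ... | L , f | M , g = L ⊔ M , λ { s (inj₁ h) → inj₁ (f (Sim-weaken (m≤m⊔n L M) _ s) h)
                                    ; s (inj₂ h) → inj₂ (g (Sim-weaken (m≤n⊔m L M) _ s) h) }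
    level (x ⊗ y) with level x | level y
    ... | L , f | M , g = L ⊔ M , λ { s (h , h′) → f (Sim-weaken (m≤m⊔n L M) _ s) h , g (Sim-weaken (m≤n⊔m L M) _ s) h′ }
    level (⊖ x) with level x
    ... | L , f = L , λ s h h′ → h (f (Sim-sym s) h′)
    level ⊥ᵗ = 0 , λ _ ()
    level ⊤ᵗ = 0 , λ _ _ → _
    level (app (cyl i) x) with level x
    ... | L , f = L , λ {u} {w} s (t , tx , e) →
          let z , s′ , _ = zigzag {L} {i} {t} {w} (Sim-trans (Sim-refl {u = t} {u} e) (Sim-weaken ≤-refl _ s)) in
          updateAt w i (const z) , f s′ tx , λ j j≢ → update-≢ w z j≢
    level (app (sub i j) x) with level x
    ... | L , f = L , λ s → f (Sim-∘ [ i ∣ j ] _ s)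
    level (app (tra i j) x) with level x
    ... | L , f = L , λ s → f (Sim-∘ (transpose i j) _ s)
    level (cst (dia i j)) = 0 , λ s → eqs s i j _ _

  _∼_ : (Fin n → ℕ) → (Fin n → ℕ) → Set
  u ∼ w = ∀ L → Sim L All u w

  ∼-invariant : ∀ x {u w} → u ∼ w → ⟨ x ⟩ u → ⟨ x ⟩ w
  ∼-invariant x s = proj₂ (level x) (s _)

  ∼-edge : ∀ {u w} → Real All u → u ∼ w → ∀ x y π → edge u x y π ≡ edge w x y π
  ∼-edge {u} re s x y π = sym (≈-in (≈-sym (cols (s (height (edge u x y π))) x y π _ _ _)) (height-in (re x y π _ _ _) ≤-refl))

  opaque
    isolated : ∀ {u} → Real All u → Σ[ L ∈ ℕ ] (∀ {w} → Sim L All u w → u ∼ w)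
    isolated {u} re with boundedᵛ (2 ℕ.+ k) (λ { (x ∷ y ∷ π) → height (edge u x y π) })
    ... | L , h = L , λ s M → record
      { parts = parts s ; eqs = eqs s ; eqs⁻ = eqs⁻ s
      ; cols = λ x y π _ _ _ → ≈-reflexive (sym (≈-in (≈-sym (cols s x y π _ _ _)) (height-in (re x y π _ _ _) (h (x ∷ y ∷ π))))) }

  ∼-real : ∀ {u w} → Real All u → u ∼ w → Real All w
  ∼-real re s x y π _ _ _ e = re x y π _ _ _ (trans (∼-edge re s x y π) e)

  ∼-sym : ∀ {u w} → u ∼ w → w ∼ u
  ∼-sym s L = Sim-sym (s L)

  opaque
    class : ∀ {u} → Real All u → B.Carrier
    class {u} re = leaf (proj₁ (isolated re) , proj₁ (nth-surjective u))

    class-to : ∀ {u} (re : Real All u) {w} → ⟨ class re ⟩ w → u ∼ w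
    class-to {u} re s = proj₂ (isolated re) (Sim-trans (Sim-refl (λ j _ → sym (proj₂ (nth-surjective u) j))) s)

    class-from : ∀ {u} (re : Real All u) {w} → u ∼ w → ⟨ class re ⟩ w
    class-from {u} re s = Sim-trans (Sim-refl (λ j _ → proj₂ (nth-surjective u) j)) (s _)

  inhabited : ∀ x → ¬ (x B.≈ B.𝟘) → Σ[ u ∈ (Fin n → ℕ) ] ⟨ x ⟩ u
  inhabited x ne with em {P = Σ[ u ∈ (Fin n → ℕ) ] ⟨ x ⟩ u}
  ... | yes h = h
  ... | no ¬h = ⊥-elim (ne ((λ h → ⊥-elim (¬h (_ , h))) , λ ()))

  class-atom : ∀ {u} (re : Real All u) → B.IsAtom (class re)
  class-atom {u} re = (λ e → case proj₁ e (class-from re (λ _ → Sim-refl (λ _ _ → refl))) of λ ()) , λ y le → below y le em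
    where
    below : ∀ y → y B.≲ class re → Dec (Σ[ w ∈ _ ] ⟨ y ⟩ w) → y B.≈ B.𝟘 ⊎ y B.≈ class re
    below y le (no ¬h) = inj₁ ((λ h → ⊥-elim (¬h (_ , h))) , λ ())
    below y le (yes (w , yw)) = inj₂ ((λ h → proj₂ (proj₂ le h)) , λ h →
      ∼-invariant y (λ L → Sim-trans (∼-sym (class-to re (proj₂ (proj₂ le yw))) L) (class-to re h L)) yw)

  opaque
    real-point : ∀ x {u} → ⟨ x ⟩ u → Σ[ w ∈ (Fin n → ℕ) ] ⟨ x ⟩ w × Real All w
    real-point x {u} h with Density.approximate (proj₁ (level x)) u
    ... | w , s , re = w , proj₂ (level x) s h , re

  class-≲ : ∀ {u} (re : Real All u) x → ⟨ x ⟩ u → class re B.≲ x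
  class-≲ re x h = proj₁ , λ c → c , ∼-invariant x (class-to re c) h

  atomic : B.Atomic
  atomic x ne with real-point x (proj₂ (inhabited x ne))
  ... | u , h , re = class re , class-atom re , class-≲ re x h

  opaque
    atom-type : ∀ x → B.IsAtom x → Σ[ u ∈ (Fin n → ℕ) ] Real All u × ⟨ x ⟩ u × (∀ {w} → ⟨ x ⟩ w → u ∼ w)
    atom-type x (ne , least) with real-point x (proj₂ (inhabited x ne))
    ... | u , h , re with least (class re) (class-≲ re x h)
    ...   | inj₁ e = ⊥-elim (proj₁ (class-atom re) e)
    ...   | inj₂ e = u , re , h , λ xw → class-to re (proj₂ e xw)

  countable : B.Countable
  countable with enum-Term enum-ℕ² enum-Op enum-Con
    where
    enum-ℕ² : Enumerable (ℕ × ℕ)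
    enum-ℕ² = enum-× enum-ℕ enum-ℕ
  ... | f , onto = f , λ y → proj₁ (onto y) , λ { refl → subst (B._≈ y) (sym (proj₂ (onto y))) (id , id) }

kind⊑pea : ∀ K → type K ⊑ peaType
kind⊑pea Sc  = sc⊑pea
kind⊑pea QA  = qa⊑pea
kind⊑pea CA  = record { sub⊑ = λ () ; tra⊑ = λ () ; diag⊑ = id }
kind⊑pea PEA = ⊑-refl

module Extension {n m : ℕ} (n≤m : n ≤ m) where

  into : Fin n → Fin m
  into i = inject≤ i n≤m

  into-injective : ∀ {i j} → into i ≡ into j → i ≡ j
  into-injective {i} {j} = inject≤-injective n≤m n≤m i j

  extension : (u : Fin n → ℕ) → Σ[ s ∈ (Fin m → ℕ) ] s ∘ into ≗ u
  extension u = s , λ i → eq i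
    where
    pad : ∀ {l} → Dec (l < n) → ℕ
    pad (yes lt) = u (fromℕ< lt)
    pad (no _)   = 0
    s : Fin m → ℕ
    s j = pad (toℕ j <? n)
    eq : ∀ i → s (into i) ≡ u i
    eq i with toℕ (into i) <? n
    ... | yes lt = cong u (toℕ-injective (trans (toℕ-fromℕ< lt) (toℕ-inject≤ i n≤m)))
    ... | no ¬lt = ⊥-elim (¬lt (subst (_< n) (sym (toℕ-inject≤ i n≤m)) (toℕ<n i)))

module Positive (em : ∀ {ℓ} → ExcludedMiddle ℓ) (k : ℕ) where
  open Blurred em k public

  module Neat {σ} (le : σ ⊑ peaType) {m} (n≤m : n ≤ m) where
    open Extension n≤m

    cylinder : B.Carrier → ℘ (Tuples {m} (λ _ → ℕ))
    cylinder x = (λ s → ⟨ x ⟩ (s ∘ into)) , λ e → resp x (e ∘ into)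

    private module D = Closure σ m ℕ cylinder

    Dilation : Algebra σ m 0ℓ 0ℓ
    Dilation = D.Clo

    embedding : Reduct le id Blur ↪ Rdₙ n≤m Dilation
    embedding = record
      { ⟦_⟧ = leaf
      ; ⟦⟧-cong = λ (f , g) → (λ {s} h → f {s ∘ into} h) , (λ {s} h → g {s ∘ into} h)
      ; injective = λ {x} {y} (f , g) → incl x y (λ {s} → f {s}) , incl y x (λ {s} → g {s})
      ; +-homo = λ _ _ → id , id ; ·-homo = λ _ _ → id , id ; -‿homo = λ _ → id , id
      ; 𝟘-homo = id , id ; 𝟙-homo = id , id
      ; op-homo = op-homo
      ; con-homo = λ { (dia i j) → id , id }
      }
      where
      incl : ∀ x y → (∀ {s} → ⟨ x ⟩ (s ∘ into) → ⟨ y ⟩ (s ∘ into)) → ∀ {u} → ⟨ x ⟩ u → ⟨ y ⟩ u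
      incl x y f {u} h with extension u
      ... | s , e = resp y e (f {s} (resp x (sym ∘ e) h))
      op-homo : ∀ o x → leaf (app (mapOp le id o) x) D.≡ₑ app (mapOp ⊑-refl into o) (leaf x)
      op-homo (cyl i) x =
        (λ {s} (t , tx , e) → updateAt s (into i) (const (t i)) , resp x (eq s t e) tx , λ j j≢ → update-≢ s (t i) j≢) ,
        (λ {s} (t , tx , e) → t ∘ into , tx , λ j j≢ → e (into j) (j≢ ∘ into-injective))
        where
        eq : ∀ (s : Fin m → ℕ) (t : Fin n → ℕ) → (∀ j → j ≢ i → t j ≡ s (into j)) →
             ∀ j → t j ≡ updateAt s (into i) (const (t i)) (into j)
        eq s t e j with j ≟ᶠ i
        ... | yes refl = sym (update-≡ s (into j) (t j))
        ... | no j≢ = trans (e j j≢) (sym (update-≢ s (t i) (j≢ ∘ into-injective)))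
      op-homo (sub i j) x = (λ {s} → resp x (λ l → cong s (eq l))) , (λ {s} → resp x (λ l → cong s (sym (eq l))))
        where
        eq : ∀ l → into ([ i ∣ j ] l) ≡ [ into i ∣ into j ] (into l)
        eq l with l ≟ᶠ i
        ... | yes refl = trans (cong into (sub-hit l j)) (sym (sub-hit (into l) (into j)))
        ... | no l≢ = trans (cong into (sub-miss l≢)) (sym (sub-miss (l≢ ∘ into-injective)))
      op-homo (tra i j) x = (λ {s} → resp x (λ l → cong s (eq l))) , (λ {s} → resp x (λ l → cong s (sym (eq l))))
        where
        eq : ∀ l → into (transpose i j l) ≡ transpose (into i) (into j) (into l)
        eq l with em {P = l ≡ i} | em {P = l ≡ j}
        ... | yes refl | _ = trans (cong into (tra-hitˡ l j)) (sym (tra-hitˡ (into l) (into j)))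
        ... | no _ | yes refl = trans (cong into (tra-hitʳ i l)) (sym (tra-hitʳ (into i) (into l)))
        ... | no l≢i | no l≢j = trans (cong into (tra-miss l≢i l≢j)) (sym (tra-miss (l≢i ∘ into-injective) (l≢j ∘ into-injective)))

    neat : ∀ x → leaf x ∈ Nr n≤m Dilation
    neat x i n≤i = (λ {s} (t , tx , e) → resp x (λ j → e (into j) (λ q → away j q)) tx) , (λ {s} h → s , h , λ _ _ → refl)
      where
      away : ∀ j → into j ≡ i → ⊥
      away j refl = <⇒≢ (<-≤-trans (toℕ<n j) (≤-trans n≤i (≤-reflexive (toℕ-inject≤ j n≤m)))) refl

  blur-SNr : ∀ K {m} (n≤m : n ≤ m) → SNr K n≤m (Reduct (kind⊑pea K) id Blur)
  blur-SNr K n≤m = Dilation , Clo-is em cylinder K , embedding , neat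
    where open Neat (kind⊑pea K) n≤m

  module Full {σ} (le : σ ⊑ peaType) where

    Subset : Set
    Subset = Σ[ f ∈ ((Fin n → ℕ) → Bool) ] (∀ {s t} → s ≗ t → T (f s) → T (f t))

    members : Subset → ℘ (Tuples {n} (λ _ → ℕ))
    members (f , r) = (λ s → T (f s)) , r

    private module F = Closure σ n ℕ members

    FullSet : Algebra σ n 0ℓ 0ℓ
    FullSet = F.Clo

    private module A = Algebra FullSet

    T-em : ∀ {Q : Set} → (T (does (em {P = Q})) → Q) × (Q → T (does (em {P = Q})))
    T-em {Q} with em {P = Q}
    ... | yes p = (λ _ → p) , λ _ → tt
    ... | no ¬p = (λ ()) , ¬p

    comprehend : ℘ (Tuples {n} (λ _ → ℕ)) → A.Carrier
    comprehend (Q , r) = leaf ((λ s → does (em {P = Q s})) , λ e h → proj₂ T-em (r e (proj₁ T-em h)))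

    complete : A.Complete
    complete Q = comprehend ((λ s → Σ[ x ∈ A.Carrier ] x ∈ Q × F.⟨ x ⟩ s) , λ e (x , xP , h) → x , xP , F.resp x e h) ,
      (λ x xP → proj₁ , λ h → h , proj₂ T-em (x , xP , h)) ,
      (λ y ub → proj₁ , λ h → h , (let x , xP , hx = proj₁ T-em h in proj₂ (proj₂ (ub x xP) hx)))

    point : (Fin n → ℕ) → A.Carrier
    point s = comprehend ((λ t → t ≗ s) , λ e h i → trans (sym (e i)) (h i))

    point-in : ∀ {s t} → t ≗ s → F.⟨ point s ⟩ t
    point-in = proj₂ T-em

    in-point : ∀ {s t} → F.⟨ point s ⟩ t → t ≗ s
    in-point = proj₁ T-em

    point-cong : ∀ {s t} → s ≗ t → point s A.≈ point t
    point-cong e = (λ h → point-in (λ i → trans (in-point h i) (e i))) , (λ h → point-in (λ i → trans (in-point h i) (sym (e i))))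

    point-≲ : ∀ x {s} → F.⟨ x ⟩ s → point s A.≲ x
    point-≲ x h = proj₁ , λ p → p , F.resp x (λ i → sym (in-point p i)) h

    point-atom : ∀ s → A.IsAtom (point s)
    point-atom s = (λ e → case proj₁ e (point-in (λ _ → refl)) of λ ()) , λ y le → below y le em
      where
      below : ∀ y → y A.≲ point s → Dec (Σ[ t ∈ _ ] F.⟨ y ⟩ t) → y A.≈ A.𝟘 ⊎ y A.≈ point s
      below y le (no ¬h) = inj₁ ((λ h → ⊥-elim (¬h (_ , h))) , λ ())
      below y le (yes (t , yt)) = inj₂ ((λ h → proj₂ (proj₂ le h)) , λ p →
        F.resp y (λ i → trans (in-point (proj₂ (proj₂ le yt)) i) (sym (in-point p i))) yt)

    has-point : ∀ x → ¬ (x A.≈ A.𝟘) → Σ[ s ∈ _ ] F.⟨ x ⟩ s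
    has-point x ne with em {P = Σ[ s ∈ (Fin n → ℕ) ] F.⟨ x ⟩ s}
    ... | yes h = h
    ... | no ¬h = ⊥-elim (ne ((λ h → ⊥-elim (¬h (_ , h))) , λ ()))

    full-atomic : A.Atomic
    full-atomic x ne with has-point x ne
    ... | s , h = point s , point-atom s , point-≲ x h

    atom-point : ∀ x → A.IsAtom x → ∀ {s} → F.⟨ x ⟩ s → point s A.≈ x
    atom-point x (_ , least) {s} h with least (point s) (point-≲ x h)
    ... | inj₁ e = ⊥-elim (proj₁ (point-atom s) e)
    ... | inj₂ e = e

    embedding : Reduct le id Blur ↪ FullSet
    embedding = record
      { ⟦_⟧ = λ x → comprehend ⟦ x ⟧
      ; ⟦⟧-cong = λ {x} {y} (f , g) → (λ h → to y (f (from x h))) , (λ h → to x (g (from y h)))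
      ; injective = λ {x} {y} (f , g) → (λ h → from y (f (to x h))) , (λ h → from x (g (to y h)))
      ; +-homo = λ x y → (λ h → ⊎-map (to x) (to y) (from (x ⊕ y) h)) , (λ h → to (x ⊕ y) (⊎-map (from x) (from y) h))
      ; ·-homo = λ x y → (λ h → Data.Product.map (to x) (to y) (from (x ⊗ y) h)) , (λ h → to (x ⊗ y) (Data.Product.map (from x) (from y) h))
      ; -‿homo = λ x → (λ h h′ → from (⊖ x) h (from x h′)) , (λ h → to (⊖ x) (h ∘ to x))
      ; 𝟘-homo = (λ {s} h → from ⊥ᵗ {s} h) , (λ ())
      ; 𝟙-homo = (λ _ → _) , (λ {s} _ → to ⊤ᵗ {s} _)
      ; op-homo = op-homo
      ; con-homo = λ { (dia i j) → (λ h → proj₁ T-em h) , (λ h → proj₂ T-em h) }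
      }
      where
      to : ∀ x {s} → ⟨ x ⟩ s → F.⟨ comprehend ⟦ x ⟧ ⟩ s
      to x = proj₂ T-em
      from : ∀ x {s} → F.⟨ comprehend ⟦ x ⟧ ⟩ s → ⟨ x ⟩ s
      from x = proj₁ T-em
      op-homo : ∀ o x → comprehend ⟦ app (mapOp le id o) x ⟧ F.≡ₑ app o (comprehend ⟦ x ⟧)
      op-homo o@(cyl i) x = (λ h → let t , tx , e = from (app (cyl i) x) h in t , to x tx , e) ,
                            (λ (t , tx , e) → to (app (cyl i) x) (t , from x tx , e))
      op-homo (sub i j) x = (λ {s} h → to x {s ∘ [ i ∣ j ]} (from (app (sub i j) x) {s} h)) , (λ {s} h → to (app (sub i j) x) {s} (from x {s ∘ [ i ∣ j ]} h))
      op-homo (tra i j) x = (λ {s} h → to x {s ∘ transpose i j} (from (app (tra i j) x) {s} h)) , (λ {s} h → to (app (tra i j) x) {s} (from x {s ∘ transpose i j} h))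

    module _ {m} (n<m : n < m) where
      open Extension (<⇒≤ n<m)

      network : (Fin m → ℕ) → Network FullSet m
      network f = record
        { label = λ δ → point (f ∘ δ) , point-atom (f ∘ δ)
        ; N-cong = λ e → point-cong (λ i → cong f (e i))
        ; N-cyl = λ δ i z → proj₁ , λ h → h , f ∘ δ , point-in (λ _ → refl) ,
            λ j j≢ → sym (trans (in-point h j) (cong f (update-≢ δ z j≢)))
        ; N-diag = λ δ i j → proj₁ , λ h → h , trans (in-point h i)
            (trans (cong f (trans (update-≡ δ i (δ j)) (sym (keep δ i j)))) (sym (in-point h j)))
        ; N-sub = λ _ δ i j → proj₁ , λ h → h , point-in (λ l → in-point h ([ i ∣ j ] l))
        ; N-tra = λ δ i j → (λ {s} h → point-in (λ l → trans (in-point h (transpose i j l)) (cong (f ∘ δ) (invol i j l)))) ,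
                            (λ {s} h → point-in (λ l → trans (cong s (sym (invol i j l))) (in-point h (transpose i j l))))
        }
        where
        keep : ∀ (δ : Fin n → Fin m) i j → updateAt δ i (const (δ j)) j ≡ δ j
        keep δ i j with j ≟ᶠ i
        ... | yes refl = update-≡ δ j (δ j)
        ... | no j≢ = update-≢ δ (δ j) j≢
        invol : ∀ i j l → transpose {n} i j (transpose i j l) ≡ l
        invol i j l with em {P = l ≡ i} | em {P = l ≡ j}
        ... | yes refl | _ = trans (cong (transpose l j) (tra-hitˡ l j)) (tra-hitʳ l j)
        ... | no _ | yes refl = trans (cong (transpose i l) (tra-hitʳ i l)) (tra-hitˡ i l)
        ... | no l≢i | no l≢j = trans (cong (transpose i j) (tra-miss l≢i l≢j)) (tra-miss l≢i l≢j)

      Networks : Pred (Network FullSet m) 0ℓ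
      Networks M = Σ[ f ∈ (Fin m → ℕ) ] (∀ δ → Network.N M δ A.≈ point (f ∘ δ))

      ≈-transᴬ : ∀ {x y z} → x A.≈ y → y A.≈ z → x A.≈ z
      ≈-transᴬ {x} {y} {z} = IsEquivalence.trans A.isEquivalence {x} {y} {z}

      ≈-symᴬ : ∀ {x y} → x A.≈ y → y A.≈ x
      ≈-symᴬ {x} {y} = IsEquivalence.sym A.isEquivalence {x} {y}

      basis : IsBasis FullSet n<m Networks
      basis = record { atoms = atoms ; extend = extend }
        where
        atoms : ∀ x → A.IsAtom x → Σ[ M ∈ Network FullSet m ] M ∈ Networks × Network.N M (λ i → inject≤ i (<⇒≤ n<m)) A.≈ x
        atoms x at with has-point x (proj₁ at)
        ... | s , h with extension s
        ...   | f , e = network f , (f , λ δ → id , id) , atom-point x at (F.resp x (sym ∘ e) h)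
        extend : ∀ M → M ∈ Networks → ∀ δ i x → A.IsAtom x → Network.N M δ A.≲ A.c i x →
                 ∀ z → (∀ j → j ≢ i → δ j ≢ z) →
                 Σ[ M′ ∈ Network FullSet m ] M′ ∈ Networks × (∀ ε → (∀ j → ε j ≢ z) → Network.N M′ ε A.≈ Network.N M ε) ×
                         Network.N M′ (δ [ i ↦ z ]) A.≈ x
        extend M (f , eM) δ i x at le z fresh with proj₂ (proj₂ le (proj₂ (eM δ) (point-in (λ _ → refl))))
        ... | t , tx , e = network f′ , (f′ , λ _ → id , id) ,
            (λ ε out → ≈-transᴬ {point (f′ ∘ ε)} {point (f ∘ ε)} {Network.N M ε}
                         (point-cong (λ j → update-≢ f (t i) (out j))) (≈-symᴬ {Network.N M ε} {point (f ∘ ε)} (eM ε))) ,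
            atom-point x at (F.resp x eq tx)
          where
          f′ : Fin m → ℕ
          f′ = updateAt f z (const (t i))
          eq : ∀ j → t j ≡ f′ ((δ [ i ↦ z ]) j)
          eq j with j ≟ᶠ i
          ... | yes refl = sym (trans (cong f′ (update-≡ δ j z)) (update-≡ f z (t j)))
          ... | no j≢ = trans (e j j≢) (sym (trans (cong f′ (update-≢ δ z j≢)) (update-≢ f (t i) (fresh j j≢))))

  blur-CB : ∀ K {m} (n<m : n < m) → CB K n<m (Reduct (kind⊑pea K) id Blur)
  blur-CB K n<m = FullSet , Clo-is em members K , complete , full-atomic , (Networks n<m , basis n<m) , embedding
    where open Full (kind⊑pea K)

  -- The sets of atoms below an element form a copy of Blur inside the complex
  -- algebra; since it contains the atoms, it contains the term algebra.
  private
    module CmB = Algebra (Cm (At Blur))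

  pt : B.Atom → Fin n → ℕ
  pt (x , at) = proj₁ (atom-type x at)

  pt-∈ : ∀ a → ⟨ proj₁ a ⟩ (pt a)
  pt-∈ (x , at) = proj₁ (proj₂ (proj₂ (atom-type x at)))

  pt-real : ∀ a → Real All (pt a)
  pt-real (x , at) = proj₁ (proj₂ (atom-type x at))

  pt-∼ : ∀ a {w} → ⟨ proj₁ a ⟩ w → pt a ∼ w
  pt-∼ (x , at) = proj₂ (proj₂ (proj₂ (atom-type x at)))

  ≲-pt : ∀ a x → proj₁ a B.≲ x → ⟨ x ⟩ (pt a)
  ≲-pt a x le = proj₂ (proj₂ le (pt-∈ a))

  pt-≲ : ∀ a x → ⟨ x ⟩ (pt a) → proj₁ a B.≲ x
  pt-≲ a x h = proj₁ , λ h′ → h′ , ∼-invariant x (pt-∼ a h′) h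

  atomOf : ∀ {u} → Real All u → B.Atom
  atomOf re = class re , class-atom re

  -- Operators are completely additive, and the points of an atom reach atoms only.
  op-atom : ∀ o x a → ⟨ app o x ⟩ (pt a) → Σ[ b ∈ B.Atom ] proj₁ b B.≲ x × proj₁ a B.≲ app o (proj₁ b)
  op-atom (cyl i) x a (t , tx , e) with real-point (x ⊗ app (cyl i) (proj₁ a)) {t} (tx , pt a , pt-∈ a , λ j j≢ → sym (e j j≢))
  ... | w , (wx , r , ra , r≡w) , re = atomOf re , class-≲ re x wx ,
        pt-≲ a (app (cyl i) (class re)) (∼-invariant (app (cyl i) (class re)) (∼-sym (pt-∼ a ra))
          (w , class-from re (λ _ → Sim-refl (λ _ _ → refl)) , λ j j≢ → sym (r≡w j j≢)))
  op-atom (sub i j) x a h = atomOf re , class-≲ re x h , pt-≲ a (app (sub i j) (class re)) (class-from re (λ _ → Sim-refl (λ _ _ → refl)))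
    where
    re : Real All (pt a ∘ [ i ∣ j ])
    re = Real-∘ [ i ∣ j ] _ (pt-real a)
  op-atom (tra i j) x a h = atomOf re , class-≲ re x h , pt-≲ a (app (tra i j) (class re)) (class-from re (λ _ → Sim-refl (λ _ _ → refl)))
    where
    re : Real All (pt a ∘ transpose i j)
    re = Real-∘ (transpose i j) _ (pt-real a)

  op-mono : ∀ o {x y} → (∀ {s} → ⟨ x ⟩ s → ⟨ y ⟩ s) → ∀ {s} → ⟨ app o x ⟩ s → ⟨ app o y ⟩ s
  op-mono (cyl i) f (t , tx , e) = t , f tx , e
  op-mono (sub i j) f = f
  op-mono (tra i j) f = f

  Represents : B.Carrier → CmB.Carrier → Set
  Represents x Z = (∀ a → a ∈ proj₁ Z → ⟨ x ⟩ (pt a)) × (∀ a → ⟨ x ⟩ (pt a) → a ∈ proj₁ Z)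

  represent : ∀ {Z} → Generated (Cm (At Blur)) CmB.IsAtom Z → Σ B.Carrier λ x → Represents x Z
  represent (gen {Z} (ne , least)) = single (em {P = Σ[ a ∈ B.Atom ] a ∈ proj₁ Z})
    where
    ≈-transᴮ : ∀ {x y z} → x B.≈ y → y B.≈ z → x B.≈ z
    ≈-transᴮ {x} {y} {z} = IsEquivalence.trans B.isEquivalence {x} {y} {z}
    ≈-symᴮ : ∀ {x y} → x B.≈ y → y B.≈ x
    ≈-symᴮ {x} {y} = IsEquivalence.sym B.isEquivalence {x} {y}
    single : Dec (Σ[ a ∈ B.Atom ] a ∈ proj₁ Z) → Σ B.Carrier λ x → Represents x Z
    single (no ¬h) = ⊥-elim (ne ((λ h → ⊥-elim (¬h (_ , h))) , λ ()))
    single (yes (a , aZ)) with least ((λ b → proj₁ b B.≈ proj₁ a) , λ {b} {c} e h → ≈-transᴮ {proj₁ c} {proj₁ b} {proj₁ a} (≈-symᴮ {proj₁ b} {proj₁ c} e) h)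
                                     (proj₁ , λ {b} e → e , proj₂ Z (≈-symᴮ {proj₁ b} {proj₁ a} e) aZ)
    ... | inj₁ e = ⊥-elim (case proj₁ e {a} (id , id) of λ ())
    ... | inj₂ e = proj₁ a , (λ b bZ → proj₁ (proj₂ e bZ) (pt-∈ b)) , (λ b h → proj₁ e (eq b h))
      where
      eq : ∀ b → ⟨ proj₁ a ⟩ (pt b) → proj₁ b B.≈ proj₁ a
      eq b h = (λ h′ → ∼-invariant (proj₁ a) (pt-∼ b h′) h) ,
               (λ h′ → ∼-invariant (proj₁ b) (λ L → Sim-trans (∼-sym (pt-∼ a h) L) (pt-∼ a h′ L)) (pt-∈ b))
  represent (plus p q) with represent p | represent q
  ... | x , f , g | y , f′ , g′ = x ⊕ y , (λ { a (inj₁ h) → inj₁ (f a h) ; a (inj₂ h) → inj₂ (f′ a h) }) ,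
                                          (λ { a (inj₁ h) → inj₁ (g a h) ; a (inj₂ h) → inj₂ (g′ a h) })
  represent (times p q) with represent p | represent q
  ... | x , f , g | y , f′ , g′ = x ⊗ y , (λ a (h , h′) → f a h , f′ a h′) , (λ a (h , h′) → g a h , g′ a h′)
  represent (neg p) with represent p
  ... | x , f , g = ⊖ x , (λ a h h′ → h (g a h′)) , (λ a h h′ → h (f a h′))
  represent zero = ⊥ᵗ , (λ _ ()) , (λ _ ())
  represent one  = ⊤ᵗ , _ , _
  represent (apply o p) with represent p
  ... | x , f , g = app o x ,
    (λ a (b , bZ , le) → op-mono o {proj₁ b} {x} (λ h → proj₂ (proj₂ (pt-≲ b x (f b bZ)) h)) (≲-pt a (app o (proj₁ b)) le)) ,
    (λ a h → let b , b≲x , le = op-atom o x a h in b , g b (≲-pt b x b≲x) , le)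
  represent (fixed d) = cst d , (λ a (lift le) → ≲-pt a (cst d) le) , (λ a h → lift (pt-≲ a (cst d) h))

  represents-cong : ∀ {x y Z W} → Represents x Z → Represents y W → Z CmB.≈ W → x B.≈ y
  represents-cong {x} {y} {Z} {W} rx ry (f , g) = half x y Z W rx ry f , half y x W Z ry rx g
    where
    half : ∀ x y (Z W : CmB.Carrier) → Represents x Z → Represents y W → (∀ {a} → a ∈ proj₁ Z → a ∈ proj₁ W) → ∀ {u} → ⟨ x ⟩ u → ⟨ y ⟩ u
    half x y Z W (_ , gx) (fy , _) inc {u} xu with em {P = ⟨ y ⟩ u}
    ... | yes yu = yu
    ... | no ¬yu with real-point (x ⊗ (⊖ y)) (xu , ¬yu)
    ...   | w , (xw , ¬yw) , re = ⊥-elim (¬yw (∼-invariant y (pt-∼ a w∈) (fy a (inc (gx a (∼-invariant x (∼-sym (pt-∼ a w∈)) xw))))))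
      where
      a : B.Atom
      a = atomOf re
      w∈ : ⟨ proj₁ a ⟩ w
      w∈ = class-from re (λ _ → Sim-refl (λ _ _ → refl))

  Blur-Tm : RPEA n (Tm (At Blur))
  Blur-Tm = Lift _ ⊤ , (λ _ → Lift _ ℕ) , record
    { ⟦_⟧ = λ (Z , p) _ → up (proj₁ (represent p))
    ; ⟦⟧-cong = λ { {Z , p} {W , q} e _ → let f , g = represents-cong {proj₁ (represent p)} {proj₁ (represent q)} {Z} {W} (proj₂ (represent p)) (proj₂ (represent q)) e in
                   (λ (lift h) → lift (f h)) , (λ (lift h) → lift (g h)) }
    ; injective = λ { {Z , p} {W , q} e → let f , g = e (lift tt) ; (a , b) = proj₂ (represent p) ; (c , d) = proj₂ (represent q) in
                   (λ {x} h → d x (lower (f {lift ∘ pt x} (lift (a x h))))) , (λ {x} h → b x (lower (g {lift ∘ pt x} (lift (c x h))))) }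
    ; +-homo = λ _ _ _ → (λ { (lift (inj₁ h)) → inj₁ (lift h) ; (lift (inj₂ h)) → inj₂ (lift h) }) ,
                         (λ { (inj₁ (lift h)) → lift (inj₁ h) ; (inj₂ (lift h)) → lift (inj₂ h) })
    ; ·-homo = λ _ _ _ → (λ (lift (h , h′)) → lift h , lift h′) , (λ (lift h , lift h′) → lift (h , h′))
    ; -‿homo = λ _ _ → (λ (lift h) (lift h′) → h h′) , (λ h → lift (λ h′ → h (lift h′)))
    ; 𝟘-homo = λ _ → (λ ()) , (λ ())
    ; 𝟙-homo = λ _ → (λ _ → _) , (λ _ → _)
    ; op-homo = λ o (Z , p) _ → op-up o (proj₁ (represent p))
    ; con-homo = λ { (dia i j) _ → (λ (lift h) → cong lift h) , (λ h → lift (cong lower h)) }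
    }
    where
    module Q = Algebra (SetAlgebra peaType n (Lift (lsuc 0ℓ) ℕ))
    up : B.Carrier → Q.Carrier
    up x = (λ s → Lift _ (⟨ x ⟩ (lower ∘ s))) , λ e (lift h) → lift (resp x (λ i → cong lower (e i)) h)
    op-up : ∀ o x → up (app o x) Q.≈ Q.op o (up x)
    op-up (cyl i) x = (λ (lift (t , tx , e)) → lift ∘ t , lift tx , λ j j≢ → cong lift (e j j≢)) ,
                      (λ (t , lift tx , e) → lift (lower ∘ t , tx , λ j j≢ → cong lower (e j j≢)))
    op-up (sub i j) x = id , id
    op-up (tra i j) x = id , id

-- Substitutions in the four classes

module Kit {σ α a ℓ} (A : Algebra σ α a ℓ) (isB : IsBoolean A) where
  open Algebra A
  private
    module E = IsEquivalence isEquivalence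
    module L = IsBooleanAlgebra isB
    bundle : BooleanAlgebra a ℓ
    bundle = record { isBooleanAlgebra = isB }
    module Q = BAP bundle
  open SetoidReasoning setoid

  ≲-refl : ∀ {x} → x ≲ x
  ≲-refl {x} = Q.∧-idem x

  ≈⇒≲ : ∀ {x y} → x ≈ y → x ≲ y
  ≈⇒≲ e = E.trans (·-cong E.refl (E.sym e)) ≲-refl

  ≲-trans : ∀ {x y z} → x ≲ y → y ≲ z → x ≲ z
  ≲-trans {x} {y} {z} p q = begin
    x · z       ≈⟨ ·-cong (E.sym p) E.refl ⟩
    x · y · z   ≈⟨ L.∧-assoc x y z ⟩
    x · (y · z) ≈⟨ ·-cong E.refl q ⟩
    x · y       ≈⟨ p ⟩
    x           ∎

  ≲-antisym : ∀ {x y} → x ≲ y → y ≲ x → x ≈ y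
  ≲-antisym {x} {y} p q = E.trans (E.sym p) (E.trans (L.∧-comm x y) q)

  ·-lbˡ : ∀ {x y} → x · y ≲ x
  ·-lbˡ {x} {y} = begin
    x · y · x   ≈⟨ L.∧-comm _ _ ⟩
    x · (x · y) ≈⟨ L.∧-assoc x x y ⟨
    x · x · y   ≈⟨ ·-cong (Q.∧-idem x) E.refl ⟩
    x · y       ∎

  ·-lbʳ : ∀ {x y} → x · y ≲ y
  ·-lbʳ {x} {y} = ≲-trans (≈⇒≲ (L.∧-comm x y)) ·-lbˡ

  ·-glb : ∀ {x y z} → z ≲ x → z ≲ y → z ≲ x · y
  ·-glb {x} {y} {z} p q = E.trans (E.sym (L.∧-assoc z x y)) (E.trans (·-cong p E.refl) q)

  +-ubˡ : ∀ {x y} → x ≲ x + y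
  +-ubˡ = L.∧-absorbs-∨ _ _

  +-ubʳ : ∀ {x y} → y ≲ x + y
  +-ubʳ {x} {y} = ≲-trans +-ubˡ (≈⇒≲ (L.∨-comm y x))

  +-lub : ∀ {x y z} → x ≲ z → y ≲ z → x + y ≲ z
  +-lub {x} {y} {z} p q = E.trans (L.∧-distribʳ-∨ z x y) (+-cong p q)

  𝟘-least : ∀ {x} → 𝟘 ≲ x
  𝟘-least {x} = Q.∧-zeroˡ x

  ≲𝟘 : ∀ {x} → x ≲ 𝟘 → x ≈ 𝟘
  ≲𝟘 p = ≲-antisym p 𝟘-least

  𝟙-greatest : ∀ {x} → x ≲ 𝟙
  𝟙-greatest {x} = Q.∧-identityʳ x

  ·-mono : ∀ {x x′ y y′} → x ≲ x′ → y ≲ y′ → x · y ≲ x′ · y′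
  ·-mono p q = ·-glb (≲-trans ·-lbˡ p) (≲-trans ·-lbʳ q)

  +-mono : ∀ {x x′ y y′} → x ≲ x′ → y ≲ y′ → x + y ≲ x′ + y′
  +-mono p q = +-lub (≲-trans p +-ubˡ) (≲-trans q +-ubʳ)

  disjoint⇒≲- : ∀ {x y} → x · y ≈ 𝟘 → x ≲ - y
  disjoint⇒≲- {x} {y} p = E.sym (begin
    x               ≈⟨ Q.∧-identityʳ x ⟨
    x · 𝟙           ≈⟨ ·-cong E.refl (L.∨-complementʳ y) ⟨
    x · (y + - y)   ≈⟨ L.∧-distribˡ-∨ x y (- y) ⟩
    x · y + x · - y ≈⟨ +-cong p E.refl ⟩
    𝟘 + x · - y     ≈⟨ Q.∨-identityˡ _ ⟩
    x · - y         ∎)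

  ≲-⇒disjoint : ∀ {x y} → x ≲ - y → x · y ≈ 𝟘
  ≲-⇒disjoint {x} {y} p = ≲𝟘 (≲-trans (·-mono p ≲-refl) (≈⇒≲ (L.∧-complementˡ y)))

  disjoint-⇒≲ : ∀ {x y} → x · - y ≈ 𝟘 → x ≲ y
  disjoint-⇒≲ {x} {y} p = ≲-trans (disjoint⇒≲- p) (≈⇒≲ (Q.¬-involutive y))

  ·-comm : ∀ x y → x · y ≈ y · x
  ·-comm = L.∧-comm

  ·-assoc : ∀ x y z → x · y · z ≈ x · (y · z)
  ·-assoc = L.∧-assoc

  distribˡ : ∀ x y z → x · (y + z) ≈ x · y + x · z
  distribˡ = L.∧-distribˡ-∨

  ≲-double : ∀ {x} → x ≲ - - x
  ≲-double {x} = ≈⇒≲ (E.sym (Q.¬-involutive x))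

  ≲-double⁻ : ∀ {x} → - - x ≲ x
  ≲-double⁻ {x} = ≈⇒≲ (Q.¬-involutive x)

  split : ∀ {x y z} → x · - y ≲ z → x ≲ y + z
  split {x} {y} {z} p = begin
    x · (y + z)           ≈⟨ distribˡ x y z ⟩
    x · y + x · z         ≈⟨ ≲-antisym (+-lub ·-lbˡ ·-lbˡ) lower-bound ⟩
    x                     ∎
    where
    lower-bound : x ≲ x · y + x · z
    lower-bound = ≲-trans (≈⇒≲ (begin
      x                 ≈⟨ Q.∧-identityʳ x ⟨
      x · 𝟙             ≈⟨ ·-cong E.refl (L.∨-complementʳ y) ⟨
      x · (y + - y)     ≈⟨ distribˡ x y (- y) ⟩
      x · y + x · - y   ∎)) (+-mono ≲-refl (·-glb ·-lbˡ p))

record Cylindric {σ α a ℓ} (A : Algebra σ α a ℓ) : Set (a ⊔ˡ ℓ) where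
  open Algebra A
  field
    isBoolean : IsBoolean A
    c-𝟘       : ∀ i → c i 𝟘 ≈ 𝟘
    c-ext     : ∀ i x → x ≲ c i x
    c-·c      : ∀ i x y → c i (x · c i y) ≈ c i x · c i y
    c-comm    : ∀ i j x → c i (c j x) ≈ c j (c i x)

module CylKit {σ α a ℓ} {A : Algebra σ α a ℓ} (isC : Cylindric A) where
  open Algebra A
  open Cylindric isC public
  open Kit A isBoolean public
  private module E = IsEquivalence isEquivalence
  open SetoidReasoning setoid

  c-cong : ∀ i {x y} → x ≈ y → c i x ≈ c i y
  c-cong i = op-cong (cyl i)

  c-mono : ∀ i {x y} → x ≲ y → c i x ≲ c i y
  c-mono i {x} {y} p = E.sym (begin
    c i x           ≈⟨ c-cong i (≲-trans p (c-ext i y)) ⟨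
    c i (x · c i y) ≈⟨ c-·c i x y ⟩
    c i x · c i y   ∎)

  c-·-closed : ∀ i x {y} → c i y ≈ y → c i (x · y) ≈ c i x · y
  c-·-closed i x {y} q = begin
    c i (x · y)     ≈⟨ c-cong i (·-cong E.refl q) ⟨
    c i (x · c i y) ≈⟨ c-·c i x y ⟩
    c i x · c i y   ≈⟨ ·-cong E.refl q ⟩
    c i x · y       ∎

  c-closed-· : ∀ i {x y} → c i x ≈ x → c i y ≈ y → c i (x · y) ≈ x · y
  c-closed-· i {x} p q = E.trans (c-·-closed i x q) (·-cong p E.refl)

  c-𝟙 : ∀ i → c i 𝟙 ≈ 𝟙
  c-𝟙 i = ≲-antisym 𝟙-greatest (c-ext i 𝟙)

  c-idem : ∀ i x → c i (c i x) ≈ c i x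
  c-idem i x = begin
    c i (c i x)     ≈⟨ c-cong i (E.trans (·-comm _ _) 𝟙-greatest) ⟨
    c i (𝟙 · c i x) ≈⟨ c-·c i 𝟙 x ⟩
    c i 𝟙 · c i x   ≈⟨ ·-cong (c-𝟙 i) E.refl ⟩
    𝟙 · c i x       ≈⟨ ·-comm _ _ ⟩
    c i x · 𝟙       ≈⟨ 𝟙-greatest ⟩
    c i x           ∎

  c-disjoint : ∀ i {x y} → c i x · y ≈ 𝟘 → c i x · c i y ≈ 𝟘
  c-disjoint i {x} {y} p = begin
    c i x · c i y   ≈⟨ ·-comm _ _ ⟩
    c i y · c i x   ≈⟨ c-·c i y x ⟨
    c i (y · c i x) ≈⟨ c-cong i (·-comm _ _) ⟩
    c i (c i x · y) ≈⟨ c-cong i p ⟩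
    c i 𝟘           ≈⟨ c-𝟘 i ⟩
    𝟘               ∎

  c-compl : ∀ i x → c i (- c i x) ≈ - c i x
  c-compl i x = ≲-antisym
    (disjoint⇒≲- (E.trans (·-comm _ _) (c-disjoint i (E.trans (·-comm _ _) (≲-⇒disjoint ≲-refl)))))
    (c-ext i _)

  c-+ : ∀ i x y → c i (x + y) ≈ c i x + c i y
  c-+ i x y = ≲-antisym (split upper) (+-lub (c-mono i +-ubˡ) (c-mono i +-ubʳ))
    where
    upper : c i (x + y) · - c i x ≲ c i y
    upper = ≲-trans (≈⇒≲ (E.sym (c-·-closed i (x + y) (c-compl i x)))) (c-mono i
      (≲-trans (≈⇒≲ (E.trans (·-comm _ _) (distribˡ _ x y)))
        (+-lub (≲-trans (≈⇒≲ (E.trans (·-comm _ _) (≲-⇒disjoint (≲-trans (c-ext i x) (≲-double))))) 𝟘-least) ·-lbʳ)))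

record Renaming {σ α a ℓ} (A : Algebra σ α a ℓ) : Set (a ⊔ˡ ℓ) where
  open Algebra A
  field
    cylindric : Cylindric A
    r      : Fin α → Fin α → Carrier → Carrier
    r-cong : ∀ i j {x y} → x ≈ y → r i j x ≈ r i j y
    r-·    : ∀ i j x y → r i j (x · y) ≈ r i j x · r i j y
    r-+    : ∀ i j x y → r i j (x + y) ≈ r i j x + r i j y
    r-𝟘    : ∀ i j → r i j 𝟘 ≈ 𝟘
    r-id   : ∀ i x → r i i x ≈ x
    r-skip : ∀ i j {x} → c i x ≈ x → r i j x ≈ x
    r-r    : ∀ i l j {x} → i ≢ l → j ≢ l → i ≢ j → c l x ≈ x → c j x ≈ x → r l j (r i l x) ≈ r i j x
    r-comm : ∀ i j k l {x} → i ≢ j → i ≢ k → i ≢ l → j ≢ k → j ≢ l → k ≢ l → c j x ≈ x → c l x ≈ x →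
             r i j (r k l x) ≈ r k l (r i j x)
    r-pres : ∀ i l j {x} → j ≢ i → j ≢ l → c j x ≈ x → c j (r i l x) ≈ r i l x
    r-free : ∀ i l x → i ≢ l → c i (r i l x) ≈ r i l x
    c-r    : ∀ i l {x} → i ≢ l → c l x ≈ x → c l (r i l x) ≈ c i x

Sc-cylindric : ∀ {α a ℓ} {A : Algebra scType α a ℓ} → IsSc A → Cylindric A
Sc-cylindric h = record { isBoolean = isBoolean ; c-𝟘 = c-𝟘 ; c-ext = c-ext ; c-·c = c-·c ; c-comm = c-comm }
  where open IsSc h

CA-cylindric : ∀ {α a ℓ} {A : Algebra caType α a ℓ} → IsCA A → Cylindric A
CA-cylindric h = record { isBoolean = isBoolean ; c-𝟘 = c-𝟘 ; c-ext = c-ext ; c-·c = c-·c ; c-comm = c-comm }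
  where open IsCA h

Sc-renaming : ∀ {α a ℓ} {A : Algebra scType α a ℓ} → IsSc A → Renaming A
Sc-renaming {A = A} h = record
  { cylindric = Sc-cylindric h
  ; r      = s
  ; r-cong = λ i j → op-cong (sub i j)
  ; r-·    = λ i j → IsBooleanEndo.·-homo (s-endo i j)
  ; r-+    = λ i j → IsBooleanEndo.+-homo (s-endo i j)
  ; r-𝟘    = λ i j → IsBooleanEndo.𝟘-homo (s-endo i j)
  ; r-id   = s-id
  ; r-skip = skip
  ; r-r    = λ i l j {x} i≢l j≢l i≢j cl cj → E.trans (s-s j i l x) (skip l j (pres i j l (i≢l ∘ sym) (j≢l ∘ sym) cl))
  ; r-comm = λ i j k l {x} ij ik il jk jl kl _ _ → s-s-comm j i l k x (ij ∘ sym) jl jk il ik (kl ∘ sym)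
  ; r-pres = pres
  ; r-free = λ i l x i≢l → c-s i l x i≢l
  ; c-r    = λ i l {x} _ cl → E.trans (c-s-swap l i x) (op-cong (cyl i) (skip l i cl))
  }
  where
  open IsSc h
  open Algebra A
  module E = IsEquivalence isEquivalence
  skip : ∀ i j {x} → c i x ≈ x → s i j x ≈ x
  skip i j {x} e = E.trans (op-cong (sub i j) (E.sym e)) (E.trans (s-c i j x) e)
  pres : ∀ i l j {x} → j ≢ i → j ≢ l → c j x ≈ x → c j (s i l x) ≈ s i l x
  pres i l j {x} j≢i j≢l e = E.trans (E.sym (s-c-comm i l j x j≢i j≢l)) (op-cong (sub i l) e)

third : ∀ {m} (i j : Fin (3 ℕ.+ m)) → Σ[ l ∈ _ ] l ≢ i × l ≢ j
third zero                zero          = suc zero , (λ ()) , λ ()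
third zero                (suc zero)    = suc (suc zero) , (λ ()) , λ ()
third zero                (suc (suc _)) = suc zero , (λ ()) , λ ()
third (suc zero)          zero          = suc (suc zero) , (λ ()) , λ ()
third (suc (suc _))       zero          = suc zero , (λ ()) , λ ()
third (suc _)             (suc _)       = zero , (λ ()) , λ ()

module _ {m a ℓ} {A : Algebra qaType (3 ℕ.+ m) a ℓ} (h : IsQA A) where
  open IsQA h
  open Algebra A
  open Kit A isBoolean
  private
    module E = IsEquivalence isEquivalence
    N = 3 ℕ.+ m
  open SetoidReasoning setoid

  private
    c-cong : ∀ i {x y} → x ≈ y → c i x ≈ c i y
    c-cong i = op-cong (cyl i)

    s-cong : ∀ i j {x y} → x ≈ y → s i j x ≈ s i j y
    s-cong i j = op-cong (sub i j)

    t-cong : ∀ i j {x y} → x ≈ y → t i j x ≈ t i j y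
    t-cong i j = op-cong (tra i j)

    closed-s : ∀ i j {x} → i ≢ j → s i j x ≈ x → c i x ≈ x
    closed-s i j {x} i≢j e = E.trans (c-cong i (E.sym e)) (E.trans (c-s i j x i≢j) e)

    s-closed : ∀ i j {x} → c i x ≈ x → s i j x ≈ x
    s-closed i j {x} e = E.trans (s-cong i j (E.sym e)) (E.trans (s-c i j x) e)

    other : ∀ (i : Fin N) → Σ[ j ∈ Fin N ] i ≢ j
    other i = let l , l≢i , _ = third i i in l , l≢i ∘ sym

    c-idem : ∀ i x → c i (c i x) ≈ c i x
    c-idem i x = let j , i≢j = other i in closed-s i j i≢j (s-c i j x)

    c-mono : ∀ i {x y} → x ≲ y → c i x ≲ c i y
    c-mono i {x} {y} p = ≲-trans +-ubˡ (≈⇒≲ (E.trans (E.sym (c-+ i x y)) (c-cong i (≲-antisym (+-lub p ≲-refl) +-ubʳ))))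

    c-compl : ∀ i x → c i (- c i x) ≈ - c i x
    c-compl i x = let j , i≢j = other i in closed-s i j i≢j
      (E.trans (IsBooleanEndo.-‿homo (s-endo i j) (c i x)) (-‿cong (s-c i j x)))

    c-least : ∀ i {x y} → c i y ≈ y → x ≲ y → c i x ≲ y
    c-least i e p = ≲-trans (c-mono i p) (≈⇒≲ e)

    t-c : ∀ i j {x} → i ≢ j → c i x ≈ x → c j (t i j x) ≈ t i j x
    t-c i j {x} i≢j e = closed-s j i (i≢j ∘ sym) (begin
      s j i (t i j x)         ≈⟨ s-cong j i (t-cong i j (s-closed i j e)) ⟨
      s j i (t i j (s i j x)) ≈⟨ s-cong j i (t-s i j x) ⟩
      s j i (s j i x)         ≈⟨ s-closed j i (c-s j i x (i≢j ∘ sym)) ⟩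
      s j i x                 ≈⟨ t-s i j x ⟨
      t i j (s i j x)         ≈⟨ t-cong i j (s-closed i j e) ⟩
      t i j x                 ∎)

    s-pres : ∀ i l j {x} → j ≢ i → j ≢ l → c j x ≈ x → c j (s i l x) ≈ s i l x
    s-pres i l j {x} j≢i j≢l e = E.trans (E.sym (s-c-comm i l j x j≢i j≢l)) (s-cong i l e)

    half-comm : ∀ i j x → c i (c j x) ≲ c j (c i x)
    half-comm i j x with i ≟ᶠ j
    ... | yes refl = ≲-refl
    ... | no i≢j with third i j
    ...   | l , l≢i , l≢j = c-least i (closed-s i l (l≢i ∘ sym)
              (E.trans (s-c-comm i l j (c i x) (i≢j ∘ sym) (l≢j ∘ sym)) (c-cong j (s-c i l x))))
              (c-mono j (c-ext i x))

    -- The laws of substitutions that are not axioms of QA come from those of transpositions.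
    s-t : ∀ i l {x} → c l x ≈ x → s i l x ≈ t i l x
    s-t i l {x} e = begin
      s i l x         ≈⟨ t-s l i x ⟨
      t l i (s l i x) ≈⟨ t-cong l i (s-closed l i e) ⟩
      t l i x         ≈⟨ t-sym l i x ⟩
      t i l x         ∎

    t-conj : ∀ i k l y → i ≢ k → i ≢ l → k ≢ l → t i k (t i l (t i k y)) ≈ t k l y
    t-conj i k l y ik il kl = E.trans (t-t i k l (t i k y) ik il kl) (t-cong k l (t-invol i k y))

    t-comm : ∀ i j k l y → i ≢ j → i ≢ k → i ≢ l → j ≢ k → j ≢ l → k ≢ l → t i j (t k l y) ≈ t k l (t i j y)
    t-comm i j k l y ij ik il jk jl kl = begin
      t i j (t k l y)                 ≈⟨ t-cong i j (t-conj i k l y ik il kl) ⟨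
      t i j (t i k (t i l (t i k y))) ≈⟨ t-t i j k _ ij ik jk ⟩
      t j k (t i j (t i l (t i k y))) ≈⟨ t-cong j k (t-t i j l _ ij il jl) ⟩
      t j k (t j l (t i j (t i k y))) ≈⟨ t-cong j k (t-cong j l (t-t i j k y ij ik jk)) ⟩
      t j k (t j l (t j k (t i j y))) ≈⟨ t-conj j k l (t i j y) jk jl kl ⟩
      t k l (t i j y)                 ∎

    c-t : ∀ i l x → i ≢ l → c l (t i l x) ≈ t i l (c i x)
    c-t i l x i≢l = ≲-antisym
      (c-least l (t-c i l i≢l (c-idem i x)) (t-mono i l (c-ext i x)))
      (≲-trans (t-mono i l (c-least i
         (E.trans (c-cong i (t-sym i l _)) (E.trans (t-c l i (i≢l ∘ sym) (c-idem l _)) (t-sym l i _)))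
         (≲-trans (≈⇒≲ (E.sym (t-invol i l x))) (t-mono i l (c-ext l _)))))
       (≈⇒≲ (t-invol i l _)))
      where
      t-mono : ∀ i j {x y} → x ≲ y → t i j x ≲ t i j y
      t-mono i j p = E.trans (E.sym (IsBooleanEndo.·-homo (t-endo i j) _ _)) (t-cong i j p)

  QA-cylindric : Cylindric A
  QA-cylindric = record
    { isBoolean = isBoolean
    ; c-𝟘 = λ i → let j , i≢j = other i in closed-s i j i≢j (IsBooleanEndo.𝟘-homo (s-endo i j))
    ; c-ext = c-ext
    ; c-·c = λ i x y → ≲-antisym
        (·-glb (c-mono i ·-lbˡ) (c-least i (c-idem i y) ·-lbʳ))
        (≲-trans (·-mono (c-least i (closed-sum i x y) (split′ i x y)) ≲-refl) (absorb i x y))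
    ; c-comm = λ i j x → ≲-antisym (half-comm i j x) (half-comm j i x)
    }
    where
    closed-sum : ∀ i x y → c i (- c i y + c i (x · c i y)) ≈ - c i y + c i (x · c i y)
    closed-sum i x y = E.trans (c-+ i _ _) (+-cong (c-compl i y) (c-idem i _))
    split′ : ∀ i x y → x ≲ - c i y + c i (x · c i y)
    split′ i x y = split (≲-trans (·-mono ≲-refl ≲-double⁻) (c-ext i _))
    absorb : ∀ i x y → (- c i y + c i (x · c i y)) · c i y ≲ c i (x · c i y)
    absorb i x y = ≲-trans (≈⇒≲ (E.trans (·-comm _ _) (distribˡ _ _ _)))
      (+-lub (≲-trans (≈⇒≲ (E.trans (·-comm _ _) (≲-⇒disjoint ≲-refl))) 𝟘-least) ·-lbʳ)

  QA-renaming : Renaming A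
  QA-renaming = record
    { cylindric = QA-cylindric
    ; r      = s
    ; r-cong = s-cong
    ; r-·    = λ i j → IsBooleanEndo.·-homo (s-endo i j)
    ; r-+    = λ i j → IsBooleanEndo.+-homo (s-endo i j)
    ; r-𝟘    = λ i j → IsBooleanEndo.𝟘-homo (s-endo i j)
    ; r-id   = s-id
    ; r-skip = s-closed
    ; r-r    = λ i l j {x} i≢l j≢l i≢j cl cj → begin
        s l j (s i l x) ≈⟨ s-t l j (s-pres i l j (i≢j ∘ sym) j≢l cj) ⟩
        t l j (s i l x) ≈⟨ t-cong l j (s-t i l cl) ⟩
        t l j (t i l x) ≈⟨ t-cong l j (t-sym i l x) ⟩
        t l j (t l i x) ≈⟨ t-t l j i x (j≢l ∘ sym) (i≢l ∘ sym) (i≢j ∘ sym) ⟩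
        t j i (t l j x) ≈⟨ t-cong j i (s-t l j cj) ⟨
        t j i (s l j x) ≈⟨ t-cong j i (s-closed l j cl) ⟩
        t j i x         ≈⟨ t-sym j i x ⟩
        t i j x         ≈⟨ s-t i j cj ⟨
        s i j x         ∎
    ; r-comm = λ i j k l {x} ij ik il jk jl kl cj cl → begin
        s i j (s k l x) ≈⟨ s-t i j (s-pres k l j jk jl cj) ⟩
        t i j (s k l x) ≈⟨ t-cong i j (s-t k l cl) ⟩
        t i j (t k l x) ≈⟨ t-comm i j k l x ij ik il jk jl kl ⟩
        t k l (t i j x) ≈⟨ t-cong k l (s-t i j cj) ⟨
        t k l (s i j x) ≈⟨ s-t k l (s-pres i j l (il ∘ sym) (jl ∘ sym) cl) ⟨
        s k l (s i j x) ∎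
    ; r-pres = s-pres
    ; r-free = λ i l x i≢l → c-s i l x i≢l
    ; c-r    = λ i l {x} i≢l cl → begin
        c l (s i l x)   ≈⟨ c-cong l (s-t i l cl) ⟩
        c l (t i l x)   ≈⟨ c-t i l x i≢l ⟩
        t i l (c i x)   ≈⟨ s-t i l (E.trans (Cylindric.c-comm QA-cylindric l i x) (c-cong i cl)) ⟨
        s i l (c i x)   ≈⟨ s-c i l x ⟩
        c i x           ∎
    }

module _ {α a ℓ} {A : Algebra caType α a ℓ} (h : IsCA A) where
  open IsCA h using (d-refl; d-d; d-c)
  open Algebra A
  open CylKit (CA-cylindric h)
  private module E = IsEquivalence isEquivalence
  open SetoidReasoning setoid

  private
    d-closed : ∀ i j l → l ≢ i → l ≢ j → c l (d i j) ≈ d i j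
    d-closed i j l l≢i l≢j = E.trans (c-cong l (d-d i j l l≢i l≢j)) (E.trans (c-idem l _) (E.sym (d-d i j l l≢i l≢j)))

    d-totalˡ : ∀ i j → i ≢ j → c i (d i j) ≈ 𝟙
    d-totalˡ i j i≢j = ≲-antisym 𝟙-greatest
      (≲-trans (≈⇒≲ (E.trans (E.sym (d-refl j)) (d-d j j i i≢j i≢j))) (c-mono i ·-lbʳ))

    d-totalʳ : ∀ i j → i ≢ j → c j (d i j) ≈ 𝟙
    d-totalʳ i j i≢j = ≲-antisym 𝟙-greatest
      (≲-trans (≈⇒≲ (E.trans (E.sym (d-refl i)) (d-d i i j (i≢j ∘ sym) (i≢j ∘ sym)))) (c-mono j ·-lbˡ))

    ·-swap : ∀ x y z → x · (y · z) ≈ y · (x · z)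
    ·-swap x y z = begin
      x · (y · z) ≈⟨ ·-assoc x y z ⟨
      x · y · z   ≈⟨ ·-cong (·-comm x y) E.refl ⟩
      y · x · z   ≈⟨ ·-assoc y x z ⟩
      y · (x · z) ∎

    c-closed-·ˡ : ∀ i {x} y → c i x ≈ x → c i (x · y) ≈ x · c i y
    c-closed-·ˡ i y e = E.trans (c-cong i (·-comm _ _)) (E.trans (c-·-closed i y e) (·-comm _ _))

    s′ : ∀ i j → Dec (i ≡ j) → Carrier → Carrier
    s′ i j (yes _) x = x
    s′ i j (no _)  x = c i (d i j · x)

  caSub : Fin α → Fin α → Carrier → Carrier
  caSub i j = s′ i j (i ≟ᶠ j)

  caSub-≢ : ∀ i j x → i ≢ j → caSub i j x ≈ c i (d i j · x)
  caSub-≢ i j x i≢j with i ≟ᶠ j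
  ... | yes e = ⊥-elim (i≢j e)
  ... | no _  = E.refl

  private
    congˢ : ∀ i j (e : Dec (i ≡ j)) {x y} → x ≈ y → s′ i j e x ≈ s′ i j e y
    congˢ i j (yes _) p = p
    congˢ i j (no _)  p = c-cong i (·-cong E.refl p)

    reflect : ∀ i j y → i ≢ j → d i j · c i (d i j · y) ≲ y
    reflect i j y i≢j = disjoint-⇒≲ (≲𝟘 (≲-trans
      (·-glb (≲-trans ·-lbˡ ·-lbʳ) (≲-trans (·-mono ·-lbˡ ≲-refl) (c-ext i _)))
      (≈⇒≲ (d-c i j y i≢j))))

    ·ˢ : ∀ i j (e : Dec (i ≡ j)) x y → s′ i j e (x · y) ≈ s′ i j e x · s′ i j e y
    ·ˢ i j (yes _) x y = E.refl
    ·ˢ i j (no i≢j) x y = ≲-antisym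
      (·-glb (c-mono i (·-mono ≲-refl ·-lbˡ)) (c-mono i (·-mono ≲-refl ·-lbʳ)))
      (≲-trans (≈⇒≲ (E.sym (c-·c i _ _))) (c-mono i
        (·-glb (≲-trans ·-lbˡ ·-lbˡ) (·-glb (≲-trans ·-lbˡ ·-lbʳ) (≲-trans (·-mono ·-lbˡ ≲-refl) (reflect i j y i≢j))))))

    +ˢ : ∀ i j (e : Dec (i ≡ j)) x y → s′ i j e (x + y) ≈ s′ i j e x + s′ i j e y
    +ˢ i j (yes _) x y = E.refl
    +ˢ i j (no _) x y = E.trans (c-cong i (distribˡ _ x y)) (c-+ i _ _)

    𝟘ˢ : ∀ i j (e : Dec (i ≡ j)) → s′ i j e 𝟘 ≈ 𝟘
    𝟘ˢ i j (yes _) = E.refl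
    𝟘ˢ i j (no _) = E.trans (c-cong i (≲𝟘 ·-lbʳ)) (c-𝟘 i)

    idˢ : ∀ i (e : Dec (i ≡ i)) x → s′ i i e x ≈ x
    idˢ i (yes _) x = E.refl
    idˢ i (no i≢i) x = ⊥-elim (i≢i refl)

    skipˢ : ∀ i j (e : Dec (i ≡ j)) {x} → c i x ≈ x → s′ i j e x ≈ x
    skipˢ i j (yes _) p = E.refl
    skipˢ i j (no i≢j) {x} p = begin
      c i (d i j · x) ≈⟨ c-·-closed i (d i j) p ⟩
      c i (d i j) · x ≈⟨ ·-cong (d-totalˡ i j i≢j) E.refl ⟩
      𝟙 · x           ≈⟨ ·-comm _ _ ⟩
      x · 𝟙           ≈⟨ 𝟙-greatest ⟩
      x               ∎

    presˢ : ∀ i l (e : Dec (i ≡ l)) j {x} → j ≢ i → j ≢ l → c j x ≈ x → c j (s′ i l e x) ≈ s′ i l e x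
    presˢ i l (yes _) j _ _ p = p
    presˢ i l (no _) j j≢i j≢l p = E.trans (c-comm j i _) (c-cong i (c-closed-· j (d-closed i l j j≢i j≢l) p))

  CA-renaming : Renaming A
  CA-renaming = record
    { cylindric = CA-cylindric h
    ; r      = caSub
    ; r-cong = λ i j → congˢ i j (i ≟ᶠ j)
    ; r-·    = λ i j → ·ˢ i j (i ≟ᶠ j)
    ; r-+    = λ i j → +ˢ i j (i ≟ᶠ j)
    ; r-𝟘    = λ i j → 𝟘ˢ i j (i ≟ᶠ j)
    ; r-id   = λ i → idˢ i (i ≟ᶠ i)
    ; r-skip = λ i j → skipˢ i j (i ≟ᶠ j)
    ; r-r    = λ i l j {x} i≢l j≢l i≢j cl cj → begin
        caSub l j (caSub i l x)           ≈⟨ congˢ l j (l ≟ᶠ j) (caSub-≢ i l x i≢l) ⟩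
        caSub l j (c i (d i l · x))       ≈⟨ caSub-≢ l j _ (j≢l ∘ sym) ⟩
        c l (d l j · c i (d i l · x))     ≈⟨ c-cong l (c-closed-·ˡ i _ (d-closed l j i i≢l i≢j)) ⟨
        c l (c i (d l j · (d i l · x)))   ≈⟨ c-comm l i _ ⟩
        c i (c l (d l j · (d i l · x)))   ≈⟨ c-cong i (c-cong l (E.trans (·-swap _ _ _) (E.sym (·-assoc _ _ _)))) ⟩
        c i (c l (d i l · d l j · x))     ≈⟨ c-cong i (c-·-closed l _ cl) ⟩
        c i (c l (d i l · d l j) · x)     ≈⟨ c-cong i (·-cong (d-d i j l (i≢l ∘ sym) (j≢l ∘ sym)) E.refl) ⟨
        c i (d i j · x)                   ≈⟨ caSub-≢ i j x i≢j ⟨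
        caSub i j x                       ∎
    ; r-comm = λ i j k l {x} ij ik il jk jl kl cj cl → begin
        caSub i j (caSub k l x)           ≈⟨ congˢ i j (i ≟ᶠ j) (caSub-≢ k l x kl) ⟩
        caSub i j (c k (d k l · x))       ≈⟨ caSub-≢ i j _ ij ⟩
        c i (d i j · c k (d k l · x))     ≈⟨ c-cong i (c-closed-·ˡ k _ (d-closed i j k (ik ∘ sym) (jk ∘ sym))) ⟨
        c i (c k (d i j · (d k l · x)))   ≈⟨ c-comm i k _ ⟩
        c k (c i (d i j · (d k l · x)))   ≈⟨ c-cong k (c-cong i (·-swap _ _ _)) ⟩
        c k (c i (d k l · (d i j · x)))   ≈⟨ c-cong k (c-closed-·ˡ i _ (d-closed k l i ik il)) ⟩
        c k (d k l · c i (d i j · x))     ≈⟨ caSub-≢ k l _ kl ⟨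
        caSub k l (c i (d i j · x))       ≈⟨ congˢ k l (k ≟ᶠ l) (caSub-≢ i j x ij) ⟨
        caSub k l (caSub i j x)           ∎
    ; r-pres = λ i l j → presˢ i l (i ≟ᶠ l) j
    ; r-free = λ i l x i≢l → begin
        c i (caSub i l x)     ≈⟨ c-cong i (caSub-≢ i l x i≢l) ⟩
        c i (c i (d i l · x)) ≈⟨ c-idem i _ ⟩
        c i (d i l · x)       ≈⟨ caSub-≢ i l x i≢l ⟨
        caSub i l x           ∎
    ; c-r    = λ i l {x} i≢l cl → begin
        c l (caSub i l x)     ≈⟨ c-cong l (caSub-≢ i l x i≢l) ⟩
        c l (c i (d i l · x)) ≈⟨ c-comm l i _ ⟩
        c i (c l (d i l · x)) ≈⟨ c-cong i (c-·-closed l _ cl) ⟩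
        c i (c l (d i l) · x) ≈⟨ c-cong i (·-cong (d-totalʳ i l i≢l) E.refl) ⟩
        c i (𝟙 · x)           ≈⟨ c-cong i (E.trans (·-comm _ _) 𝟙-greatest) ⟩
        c i x                 ∎
    }

-- The complex algebra of the atoms

-- Relations between two nodes, given by their parts and the colour of their edge.
data Bin : Set where
  On   : Bool → Fin 4 → Bin
  NotW : Bool → Fin 4 → Fin 4 → Bin
  Rd   : Bool → Fin 4 → Fin 4 → Bin

full : Vec Bool 4
full = true ∷ true ∷ true ∷ true ∷ []

∈-full : ∀ s → s ∈ˡ lab full
∈-full zero                   = tt
∈-full (suc zero)             = tt
∈-full (suc (suc zero))       = tt
∈-full (suc (suc (suc zero))) = tt

#0 #1 #2 : ∀ {k} → Fin (3 ℕ.+ k)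
#0 = zero
#1 = suc zero
#2 = suc (suc zero)

-- What the refutations use: bᵢⱼ E says that the nodes at i and j are related
-- by E, and the elements eᵢⱼ play the role of diagonals in the diagonal-free case.
record Facts {σ k a ℓ} (C : Algebra σ (3 ℕ.+ k) a ℓ) : Set (a ⊔ˡ ℓ) where
  open Algebra C
  field
    b01 b02 b12 : Bin → Carrier
    apex        : Fin 4 → Carrier
    e01 e02 e12 : Carrier
    b01-closed : ∀ E → c #2 (b01 E) ≈ b01 E
    b02-closed : ∀ E → c #1 (b02 E) ≈ b02 E
    b12-closed : ∀ E → c #0 (b12 E) ≈ b12 E
    e01-closed : c #2 e01 ≈ e01
    e02-closed : c #1 e02 ≈ e02
    e12-closed : c #0 e12 ≈ e12
    e01-total  : c #0 e01 ≈ 𝟙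
    e02-total  : c #0 e02 ≈ 𝟙
    e12-total  : c #1 e12 ≈ 𝟙
    e-trans    : e02 · e12 ≲ e01
    e12-to     : ∀ E → e12 · b02 E ≲ b01 E
    e01-to     : ∀ E → e01 · b12 E ≲ b02 E
    b02-sub    : ∀ {p} E → b02 E ≈ s {p} #1 #2 (b01 E)
    b12-sub    : ∀ {p} E → b12 E ≈ s {p} #0 #1 (b02 E)
    b02-dia    : ∀ {p} E → b02 E ≈ c #1 (d {p} #1 #2 · b01 E)
    b12-dia    : ∀ {p} E → b12 E ≈ c #0 (d {p} #0 #1 · b02 E)
    e01-sub    : ∀ {p} → s {p} #0 #1 e01 ≈ 𝟙
    e02-sub    : ∀ {p} → s {p} #0 #2 e02 ≈ 𝟙
    e12-sub    : ∀ {p} → s {p} #1 #2 e12 ≈ 𝟙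
    e01-dia    : ∀ {p} → d {p} #0 #1 ≲ e01
    e02-dia    : ∀ {p} → d {p} #0 #2 ≲ e02
    e12-dia    : ∀ {p} → d {p} #1 #2 ≲ e12
    apex-on₀   : ∀ s → apex s ≲ b02 (On false s)
    apex-on₁   : ∀ s → apex s ≲ b12 (On true s)
    apex-c     : ∀ s t → apex s ≲ c #2 (apex t)
    apex-≉𝟘    : ∀ s → ¬ (apex s ≈ 𝟘)
    forced     : ∀ β {s t} → s ≢ t → b01 (On β s) · b02 (On β t) ≲ b12 (NotW β s t)
    reds       : ∀ {s t} → s ≢ t → b12 (NotW false s t) · b12 (NotW true s t) ≲ b12 (Rd false s t) + b12 (Rd true s t)
    parity     : ∀ {i j m s t u} → i xor (j xor m) ≢ ε s t u → b01 (Rd i s t) · b02 (Rd j s u) · b12 (Rd m t u) ≈ 𝟘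

module CmBlur (em : ∀ {ℓ} → ExcludedMiddle ℓ) (k : ℕ) where
  open Positive em k public

  ps : (Fin n → ℕ) → Vec ℕ k
  ps u = tabulate (λ r → u (suc (suc (suc r))))

  col : (Fin n → ℕ) → Fin n → Fin n → Col
  col u x y = C (u x) (u y) (ps u)

  π₀ : Vec (Fin n) k
  π₀ = tabulate (λ r → suc (suc (suc r)))

  col-edge : ∀ u x y → edge u x y π₀ ≡ col u x y
  col-edge u x y = cong (C (u x) (u y)) (sym (tabulate-∘ u (λ r → suc (suc (suc r)))))

  LegalP : (Fin n → ℕ) → Set
  LegalP u = ∀ r → part (u (suc (suc (suc r)))) ≡ P r

  Sat : Bin → Part k → Part k → Col → Set
  Sat (On β s) p q c     = p ≡ V β × q ≡ X s × c ≡ on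
  Sat (NotW β s t) p q c = p ≡ X s × q ≡ X t × c ≢ white β
  Sat (Rd i s t) p q c   = p ≡ X s × q ≡ X t × Σ[ l ∈ ℕ ] c ≡ red i l

  module Transversal (s : Fin 4) where

    τ : Fin n → Part k
    τ zero                = V false
    τ (suc zero)          = V true
    τ (suc (suc zero))    = X s
    τ (suc (suc (suc r))) = P r

    τ-inj : ∀ x y → τ x ≡ τ y → x ≡ y
    τ-inj zero zero _ = refl
    τ-inj zero (suc zero) ()
    τ-inj zero (suc (suc zero)) ()
    τ-inj zero (suc (suc (suc _))) ()
    τ-inj (suc zero) zero ()
    τ-inj (suc zero) (suc zero) _ = refl
    τ-inj (suc zero) (suc (suc zero)) ()
    τ-inj (suc zero) (suc (suc (suc _))) ()
    τ-inj (suc (suc zero)) zero ()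
    τ-inj (suc (suc zero)) (suc zero) ()
    τ-inj (suc (suc zero)) (suc (suc zero)) _ = refl
    τ-inj (suc (suc zero)) (suc (suc (suc _))) ()
    τ-inj (suc (suc (suc _))) zero ()
    τ-inj (suc (suc (suc _))) (suc zero) ()
    τ-inj (suc (suc (suc _))) (suc (suc zero)) ()
    τ-inj (suc (suc (suc _))) (suc (suc (suc _))) refl = refl

    τ-X : ∀ {x t} → τ x ≡ X t → x ≡ #2
    τ-X {suc (suc zero)} refl = refl

    module _ (b c : Col) where
      κ : Fin n → Fin n → Col
      κ zero             (suc zero)       = lab full
      κ (suc zero)       zero             = lab full
      κ zero             (suc (suc zero)) = b
      κ (suc (suc zero)) zero             = b
      κ (suc zero)       (suc (suc zero)) = c
      κ (suc (suc zero)) (suc zero)       = c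
      κ _                _                = nil

      κ-sym : ∀ x y → κ x y ≡ κ y x
      κ-sym zero zero = refl
      κ-sym zero (suc zero) = refl
      κ-sym zero (suc (suc zero)) = refl
      κ-sym zero (suc (suc (suc _))) = refl
      κ-sym (suc zero) zero = refl
      κ-sym (suc zero) (suc zero) = refl
      κ-sym (suc zero) (suc (suc zero)) = refl
      κ-sym (suc zero) (suc (suc (suc _))) = refl
      κ-sym (suc (suc zero)) zero = refl
      κ-sym (suc (suc zero)) (suc zero) = refl
      κ-sym (suc (suc zero)) (suc (suc zero)) = refl
      κ-sym (suc (suc zero)) (suc (suc (suc _))) = refl
      κ-sym (suc (suc (suc _))) zero = refl
      κ-sym (suc (suc (suc _))) (suc zero) = refl
      κ-sym (suc (suc (suc _))) (suc (suc zero)) = refl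
      κ-sym (suc (suc (suc _))) (suc (suc (suc _))) = refl

      module _ (fb : Fit {k} (V false) (X s) b) (fc : Fit {k} (V true) (X s) c) where

        κ-fit : ∀ x y → Fit (τ x) (τ y) (κ x y)
        κ-fit zero zero = nil
        κ-fit zero (suc zero) = lab
        κ-fit zero (suc (suc zero)) = fb
        κ-fit zero (suc (suc (suc _))) = nil
        κ-fit (suc zero) zero = lab
        κ-fit (suc zero) (suc zero) = nil
        κ-fit (suc zero) (suc (suc zero)) = fc
        κ-fit (suc zero) (suc (suc (suc _))) = nil
        κ-fit (suc (suc zero)) zero = Fit-sym fb
        κ-fit (suc (suc zero)) (suc zero) = Fit-sym fc
        κ-fit (suc (suc zero)) (suc (suc zero)) = nil
        κ-fit (suc (suc zero)) (suc (suc (suc _))) = nil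
        κ-fit (suc (suc (suc _))) zero = nil
        κ-fit (suc (suc (suc _))) (suc zero) = nil
        κ-fit (suc (suc (suc _))) (suc (suc zero)) = nil
        κ-fit (suc (suc (suc _))) (suc (suc (suc _))) = nil

        not-red : ∀ x y → ¬ IsRed (κ x y)
        not-red x y r = go (κ-fit x y) r refl refl
          where
          go : ∀ {p q c} → Fit p q c → IsRed c → τ x ≡ p → τ y ≡ q → ⊥
          go (inf s≢t) _ e f = s≢t (X-inj (trans (sym e) (trans (cong τ (trans (τ-X {x} e) (sym (τ-X {y} f)))) f)))
          go (red s≢t) _ e f = s≢t (X-inj (trans (sym e) (trans (cong τ (trans (τ-X {x} e) (sym (τ-X {y} f)))) f)))

        κ-T3 : ∀ x y v → T3 (τ x) (τ y) (τ v) (κ x y) (κ x v) (κ y v)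
        κ-T3 zero _ _ ()
        κ-T3 (suc zero) _ _ ()
        κ-T3 (suc (suc (suc _))) _ _ ()
        κ-T3 (suc (suc zero)) zero (suc zero) {s = t} _ _ _ _ _ = ∈-full t
        κ-T3 (suc (suc zero)) (suc zero) zero {s = t} _ _ _ _ _ = ∈-full t
        κ-T3 (suc (suc zero)) zero zero _ refl ()
        κ-T3 (suc (suc zero)) (suc zero) (suc zero) _ refl ()
        κ-T3 (suc (suc zero)) zero (suc (suc zero)) _ refl ()
        κ-T3 (suc (suc zero)) zero (suc (suc (suc _))) _ refl ()
        κ-T3 (suc (suc zero)) (suc zero) (suc (suc zero)) _ refl ()
        κ-T3 (suc (suc zero)) (suc zero) (suc (suc (suc _))) _ refl ()
        κ-T3 (suc (suc zero)) (suc (suc zero)) _ _ ()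
        κ-T3 (suc (suc zero)) (suc (suc (suc _))) _ _ ()

        update-part : ∀ w i z → part z ≡ τ i → (∀ j → j ≢ i → part (w j) ≡ τ j) → ∀ j → part (updateAt w i (const z) j) ≡ τ j
        update-part w i z pz pw j with j ≟ᶠ i
        ... | yes refl = trans (cong part (update-≡ w j z)) pz
        ... | no j≢ = trans (cong part (update-≢ w z j≢)) (pw j j≢)

        parts-inj : ∀ (w : Fin n → ℕ) → (∀ j → part (w j) ≡ τ j) → ∀ {x y} → w x ≡ w y → x ≡ y
        parts-inj w pw {x} {y} e = τ-inj x y (trans (sym (pw x)) (trans (cong part e) (pw y)))

        transversal : ∀ w i → (∀ r → suc (suc (suc r)) ≢ i) → (∀ j → j ≢ i → part (w j) ≡ τ j) →
                      (∀ x y → x ≢ i → y ≢ i → x ≢ y → NonP (w x) → NonP (w y) → col w x y ≡ κ x y) →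
                      Σ[ z ∈ ℕ ] let w′ = updateAt w i (const z) in
                      (∀ j → part (w′ j) ≡ τ j) × (∀ x y → x ≢ y → col w′ x y ≡ κ x y) × Real All w′
        transversal w i P≢i pw old with create w i (τ i) (λ x y _ → κ x y) target
          where
          target : ∀ z → (∀ j → w j < z) → part z ≡ τ i → Target (updateAt w i (const z)) i (λ x y _ → κ x y)
          target z big pz = record
            { d-sym = λ x y _ → κ-sym x y
            ; d-ext = λ ex ey _ → cong₂ κ (w′-inj ex) (w′-inj ey)
            ; d-old = λ {x} {y} {π} lg ne x≢ y≢ _ → trans (cong (C (w′ x) (w′ y)) (legal-ps π lg)) (off x y ne x≢ y≢)
            ; d-fit = λ {x} {y} _ _ → subst₂ (λ p q → Fit p q (κ x y)) (sym (pw′ x)) (sym (pw′ y)) (κ-fit x y)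
            ; d-tri = λ {x} {y} {v} _ xy xv yv →
                (λ px py s≢t _ _ _ _ → xy (cong w′ (trans (τ-X {x} (trans (sym (pw′ x)) px)) (sym (τ-X {y} (trans (sym (pw′ y)) py)))))) ,
                (λ px py pv a b → κ-T3 x y v (trans (sym (pw′ x)) px) (trans (sym (pw′ y)) py) (trans (sym (pw′ v)) pv) a b) ,
                (λ _ _ _ r _ _ → ⊥-elim (not-red x y r))
            }
            where
            w′ : Fin n → ℕ
            w′ = updateAt w i (const z)
            pw′ = update-part w i z pz pw
            w′-inj = parts-inj w′ pw′
            legal-ps : ∀ π → Legal (map w′ π) → map w′ π ≡ ps w′
            legal-ps π lg = lookup-ext _ _ λ r → trans (lookup-map r w′ π) (trans
              (cong w′ (τ-inj _ (suc (suc (suc r))) (trans (sym (pw′ _)) (trans (cong part (sym (lookup-map r w′ π))) (lg r)))))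
              (sym (lookup∘tabulate (λ r → w′ (suc (suc (suc r)))) r)))
            κ-P : ∀ x y → (Σ[ r ∈ Fin k ] τ x ≡ P r) ⊎ (Σ[ r ∈ Fin k ] τ y ≡ P r) → κ x y ≡ nil
            κ-P x y (inj₁ (r , e)) = Fit-Pˡ e (κ-fit x y)
            κ-P x y (inj₂ (r , e)) = Fit-Pʳ e (κ-fit x y)
            off : ∀ x y → w′ x ≢ w′ y → x ≢ i → y ≢ i → C (w′ x) (w′ y) (ps w′) ≡ κ x y
            off x y ne x≢ y≢ with nonP? (w x) | nonP? (w y)
            ... | inj₁ nx | inj₁ ny = trans (trans (cong₂ (λ a b → C a b (ps w′)) (update-≢ w z x≢) (update-≢ w z y≢))
                    (cong (C (w x) (w y)) (tabulate-cong (λ r → update-≢ w z (P≢i r))))) (old x y x≢ y≢ (λ { refl → ne refl }) nx ny)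
            ... | inj₂ (r , e) | _ = trans (Fit-Pˡ (trans (cong part (update-≢ w z x≢)) e) (C-fit _ _ _ ne))
                    (sym (κ-P x y (inj₁ (r , trans (sym (pw x x≢)) e))))
            ... | inj₁ _ | inj₂ (r , e) = trans (Fit-Pʳ (trans (cong part (update-≢ w z y≢)) e) (C-fit _ _ _ ne))
                    (sym (κ-P x y (inj₂ (r , trans (sym (pw y y≢)) e))))
        ... | z , big , pz , C≡κ = z , pw′ , cols′ , real
          where
          w′ : Fin n → ℕ
          w′ = updateAt w i (const z)
          pw′ = update-part w i z pz pw
          w′-inj = parts-inj w′ pw′
          legal₀ : Legal (map w′ π₀)
          legal₀ r = trans (cong part (trans (lookup-map r w′ π₀) (cong w′ (lookup∘tabulate (λ r → suc (suc (suc r))) r)))) (pw′ (suc (suc (suc r))))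
          cols′ : ∀ x y → x ≢ y → col w′ x y ≡ κ x y
          cols′ x y x≢y = trans (sym (col-edge w′ x y)) (C≡κ x y π₀ legal₀ (x≢y ∘ w′-inj))
          real : Real All w′
          real x y π _ _ _ e = not-red x y (subst IsRed (trans (sym e) (C≡κ x y π (red-legal isred) (proj₁ (red-NonP isred)))) inf)
            where
            isred : IsRed (edge w′ x y π)
            isred = subst IsRed (sym e) inf

    Apex : (Fin n → ℕ) → Set
    Apex u = (∀ j → part (u j) ≡ τ j) × col u #0 #1 ≡ lab full × col u #0 #2 ≡ on × col u #1 #2 ≡ on

    attach : ∀ w → (∀ j → j ≢ #2 → part (w j) ≡ τ j) → col w #0 #1 ≡ lab full →
             Σ[ z ∈ ℕ ] Real All (updateAt w #2 (const z)) × Apex (updateAt w #2 (const z))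
    attach w pw e with transversal on on onʳ onʳ w #2 (λ _ ()) pw old
      where
      old : ∀ x y → x ≢ #2 → y ≢ #2 → x ≢ y → NonP (w x) → NonP (w y) → col w x y ≡ κ on on x y
      old zero zero _ _ ne = ⊥-elim (ne refl)
      old zero (suc zero) _ _ _ _ _ = e
      old zero (suc (suc zero)) _ ne = ⊥-elim (ne refl)
      old zero (suc (suc (suc r))) _ _ _ _ np = ⊥-elim (np r (pw (suc (suc (suc r))) (λ ())))
      old (suc zero) zero _ _ _ _ _ = trans (C-sym _ _ _) e
      old (suc zero) (suc zero) _ _ ne = ⊥-elim (ne refl)
      old (suc zero) (suc (suc zero)) _ ne = ⊥-elim (ne refl)
      old (suc zero) (suc (suc (suc r))) _ _ _ _ np = ⊥-elim (np r (pw (suc (suc (suc r))) (λ ())))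
      old (suc (suc zero)) _ ne = ⊥-elim (ne refl)
      old (suc (suc (suc r))) _ _ _ _ np = ⊥-elim (np r (pw (suc (suc (suc r))) (λ ())))
    ... | z , pw′ , cols′ , re = z , re , pw′ , cols′ #0 #1 (λ ()) , cols′ #0 #2 (λ ()) , cols′ #1 #2 (λ ())

    apex-exists : Σ[ u ∈ (Fin n → ℕ) ] Real All u × Apex u
    apex-exists = finish (transversal (col u #0 #2) nil (fit′ zero (λ ())) nil u #1 (λ _ ()) (λ j _ → pu j) old)
      where
      u : Fin n → ℕ
      u j = proj₁ (node (λ _ → 0) zero (τ j) (λ _ _ _ → nil))
      pu : ∀ j → part (u j) ≡ τ j
      pu j = proj₁ (proj₂ (proj₂ (node (λ _ → 0) zero (τ j) (λ _ _ _ → nil))))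
      fit′ : ∀ x → x ≢ #2 → Fit (τ x) (X s) (C (u x) (u #2) (ps u))
      fit′ x x≢2 = subst₂ (λ p q → Fit p q (C (u x) (u #2) (ps u))) (pu x) (pu #2)
        (C-fit _ _ _ (λ e → x≢2 (τ-inj x #2 (trans (sym (pu x)) (trans (cong part e) (pu #2))))))
      old : ∀ x y → x ≢ #1 → y ≢ #1 → x ≢ y → NonP (u x) → NonP (u y) → col u x y ≡ κ (col u #0 #2) nil x y
      old zero zero _ _ ne = ⊥-elim (ne refl)
      old zero (suc zero) _ ne = ⊥-elim (ne refl)
      old zero (suc (suc zero)) _ _ _ _ _ = refl
      old (suc zero) _ ne = ⊥-elim (ne refl)
      old (suc (suc zero)) zero _ _ _ _ _ = C-sym _ _ _
      old (suc (suc zero)) (suc zero) _ ne = ⊥-elim (ne refl)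
      old (suc (suc zero)) (suc (suc zero)) _ _ ne = ⊥-elim (ne refl)
      old (suc (suc (suc r))) _ _ _ _ np = ⊥-elim (np r (pu (suc (suc (suc r)))))
      old zero (suc (suc (suc r))) _ _ _ _ np = ⊥-elim (np r (pu (suc (suc (suc r)))))
      old (suc (suc zero)) (suc (suc (suc r))) _ _ _ _ np = ⊥-elim (np r (pu (suc (suc (suc r)))))
      finish : (Σ[ z ∈ ℕ ] let w′ = updateAt u #1 (const z) in
                (∀ j → part (w′ j) ≡ τ j) × (∀ x y → x ≢ y → col w′ x y ≡ κ (col u #0 #2) nil x y) × Real All w′) →
               Σ[ u ∈ (Fin n → ℕ) ] Real All u × Apex u
      finish (z₁ , pw , cols₁ , _) with attach (updateAt u #1 (const z₁)) (λ j _ → pw j) (cols₁ #0 #1 (λ ()))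
      ... | z₂ , re , ap = _ , re , ap

  module Cmσ {σ} (le : σ ⊑ peaType) where

    CmA : Algebra σ n (lsuc 0ℓ) 0ℓ
    CmA = Cm (At (Reduct le id Blur))

    private module M = Algebra CmA

    record Property : Set₁ where
      constructor property
      field
        holds : (Fin n → ℕ) → Set
        inv   : ∀ {u w} → Real All u → u ∼ w → holds u → holds w
    open Property

    ⟪_⟫ : Property → M.Carrier
    ⟪ Q ⟫ = (λ a → holds Q (pt a)) , λ {a} {b} e → inv Q (pt-real a) (pt-∼ a (proj₂ e (pt-∈ b)))

    ∼-refl : ∀ {u w} → u ≗ w → u ∼ w
    ∼-refl e _ = Sim-refl (λ j _ → e j)

    atom-∼ : ∀ {u} (re : Real All u) → pt (atomOf re) ∼ u
    atom-∼ re = pt-∼ (atomOf re) (class-from re (∼-refl (λ _ → refl)))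

    c-in : ∀ i Q a → a ∈ proj₁ (M.c i ⟪ Q ⟫) → Σ[ t ∈ (Fin n → ℕ) ] Real All t × t ≡[ i ] pt a × holds Q t
    c-in i Q a (b , Qb , b≲) with ≲-pt a (app (cyl i) (proj₁ b)) b≲
    ... | t , tb , e = t , ∼-real (pt-real b) (pt-∼ b tb) , e , inv Q (pt-real b) (pt-∼ b tb) Qb

    in-c : ∀ i Q a {t} → Real All t → t ≡[ i ] pt a → holds Q t → a ∈ proj₁ (M.c i ⟪ Q ⟫)
    in-c i Q a {t} re e Qt = atomOf re , inv Q re (∼-sym (atom-∼ re)) Qt ,
      pt-≲ a (app (cyl i) (class re)) (t , class-from re (∼-refl (λ _ → refl)) , e)

    c-closed : ∀ i Q → (∀ u w → Real All u → Real All w → u ≡[ i ] w → holds Q u → holds Q w) → M.c i ⟪ Q ⟫ M.≈ ⟪ Q ⟫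
    c-closed i Q h = (λ {a} m → let t , re , e , Qt = c-in i Q a m in h t (pt a) re (pt-real a) e Qt) ,
                     (λ {a} Qa → in-c i Q a (pt-real a) (λ _ _ → refl) Qa)

    s-char : ∀ {p} i j Q Q′ → (∀ u → holds Q′ u → holds Q (u ∘ [ i ∣ j ])) → (∀ u → holds Q (u ∘ [ i ∣ j ]) → holds Q′ u) →
             ⟪ Q′ ⟫ M.≈ M.s {p} i j ⟪ Q ⟫
    s-char i j Q Q′ to from =
      (λ {a} h → let re = Real-∘ [ i ∣ j ] _ (pt-real a) in
         atomOf re , inv Q re (∼-sym (atom-∼ re)) (to (pt a) h) , pt-≲ a (app (sub i j) (class re)) (class-from re (∼-refl (λ _ → refl)))) ,
      (λ {a} (b , Qb , b≲) → from (pt a) (inv Q (pt-real b) (pt-∼ b (≲-pt a (app (sub i j) (proj₁ b)) b≲)) Qb))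

    d-char : ∀ {p} i j Q Q′ → i ≢ j → (∀ u → holds Q′ u → holds Q (u ∘ [ i ∣ j ])) → (∀ u → holds Q (u ∘ [ i ∣ j ]) → holds Q′ u) →
             ⟪ Q′ ⟫ M.≈ M.c i (M.d {p} i j M.· ⟪ Q ⟫)
    d-char i j Q Q′ i≢j to from =
      (λ {a} h → let re = Real-∘ [ i ∣ j ] _ (pt-real a) in
         atomOf re ,
         (lift (pt-≲ (atomOf re) (cst (dia i j)) (eqs⁻ (atom-∼ re 0) i j _ _ (trans (cong (pt a) (sub-hit i j)) (cong (pt a) (sym (sub-miss (i≢j ∘ sym))))))) ,
          inv Q re (∼-sym (atom-∼ re)) (to (pt a) h)) ,
         pt-≲ a (app (cyl i) (class re)) (pt a ∘ [ i ∣ j ] , class-from re (∼-refl (λ _ → refl)) , λ l l≢ → cong (pt a) (sub-miss l≢))) ,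
      (λ {a} (b , (lift d≲ , Qb) , b≲) → from (pt a) (back a b (≲-pt b (cst (dia i j)) d≲) Qb (≲-pt a (app (cyl i) (proj₁ b)) b≲)))
      where
      back : ∀ a b → pt b i ≡ pt b j → holds Q (pt b) → ⟨ app (cyl i) (proj₁ b) ⟩ (pt a) → holds Q (pt a ∘ [ i ∣ j ])
      back a b e Qb (t , tb , t≡) = inv Q (pt-real b) (λ L → Sim-trans (pt-∼ b tb L) (∼-refl eq L)) Qb
        where
        eq : ∀ l → t l ≡ pt a ([ i ∣ j ] l)
        eq l with l ≟ᶠ i
        ... | yes refl = trans (eqs (pt-∼ b tb 0) l j _ _ e) (trans (t≡ j (i≢j ∘ sym)) (cong (pt a) (sym (sub-hit l j))))
        ... | no l≢ = trans (t≡ l l≢) (cong (pt a) (sym (sub-miss l≢)))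

    Rel : Bin → Fin n → Fin n → Property
    Rel E i j = property (λ u → LegalP u × Sat E (part (u i)) (part (u j)) (col u i j)) go
      where
      go : ∀ {u w} → Real All u → u ∼ w → LegalP u × Sat E (part (u i)) (part (u j)) (col u i j) →
           LegalP w × Sat E (part (w i)) (part (w j)) (col w i j)
      go {u} {w} re s (lg , h) = (λ r → trans (sym (parts (s 0) _ _)) (lg r)) ,
        subst (Sat E _ _) (trans (sym (col-edge u i j)) (trans (∼-edge re s i j π₀) (col-edge w i j)))
          (subst₂ (λ p q → Sat E p q (col u i j)) (parts (s 0) i _) (parts (s 0) j _) h)

    ApexP : Fin 4 → Property
    ApexP s = property (Transversal.Apex s) go
      where
      open Transversal s
      go : ∀ {u w} → Real All u → u ∼ w → Apex u → Apex w
      go {u} {w} re s′ (pu , a , b , c) = (λ j → trans (sym (parts (s′ 0) j _)) (pu j)) , trans (eq #0 #1) a , trans (eq #0 #2) b , trans (eq #1 #2) c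
        where
        eq : ∀ x y → col w x y ≡ col u x y
        eq x y = sym (trans (sym (col-edge u x y)) (trans (∼-edge re s′ x y π₀) (col-edge w x y)))

    Same : Fin n → Fin n → Property
    Same i j = property (λ u → u i ≡ u j) (λ _ s → eqs (s 0) i j _ _)

    local : ∀ E {u w} i j → u i ≡ w i → u j ≡ w j → (∀ r → u (suc (suc (suc r))) ≡ w (suc (suc (suc r)))) →
            holds (Rel E i j) u → holds (Rel E i j) w
    local E {u} {w} i j ei ej eP (lg , h) = (λ r → trans (cong part (sym (eP r))) (lg r)) ,
      subst (Sat E _ _) (trans (cong₂ (λ a b → C a b (ps u)) ei ej) (cong (C (w i) (w j)) (tabulate-cong eP)))
        (subst₂ (λ p q → Sat E p q (col u i j)) (cong part ei) (cong part ej) h)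

    col-real : ∀ a x y → col (pt a) x y ≢ inf
    col-real a x y e = pt-real a x y π₀ _ _ _ (trans (col-edge (pt a) x y) e)

    facts : Facts CmA
    facts = record
      { b01 = λ E → ⟪ Rel E #0 #1 ⟫
      ; b02 = λ E → ⟪ Rel E #0 #2 ⟫
      ; b12 = λ E → ⟪ Rel E #1 #2 ⟫
      ; apex = λ s → ⟪ ApexP s ⟫
      ; e01 = ⟪ Same #0 #1 ⟫ ; e02 = ⟪ Same #0 #2 ⟫ ; e12 = ⟪ Same #1 #2 ⟫
      ; b01-closed = λ E → c-closed #2 (Rel E #0 #1) (λ u w _ _ e → local E {u} {w} #0 #1 (e #0 (λ ())) (e #1 (λ ())) (λ r → e _ (λ ())))
      ; b02-closed = λ E → c-closed #1 (Rel E #0 #2) (λ u w _ _ e → local E {u} {w} #0 #2 (e #0 (λ ())) (e #2 (λ ())) (λ r → e _ (λ ())))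
      ; b12-closed = λ E → c-closed #0 (Rel E #1 #2) (λ u w _ _ e → local E {u} {w} #1 #2 (e #1 (λ ())) (e #2 (λ ())) (λ r → e _ (λ ())))
      ; e01-closed = c-closed #2 (Same #0 #1) (λ u w _ _ e h → trans (sym (e #0 (λ ()))) (trans h (e #1 (λ ()))))
      ; e02-closed = c-closed #1 (Same #0 #2) (λ u w _ _ e h → trans (sym (e #0 (λ ()))) (trans h (e #2 (λ ()))))
      ; e12-closed = c-closed #0 (Same #1 #2) (λ u w _ _ e h → trans (sym (e #1 (λ ()))) (trans h (e #2 (λ ()))))
      ; e01-total = total #0 #1 (λ ())
      ; e02-total = total #0 #2 (λ ())
      ; e12-total = total #1 #2 (λ ())
      ; e-trans = proj₁ , λ (a , b) → (a , b) , trans a (sym b)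
      ; e12-to   = λ E → proj₁ , λ {a} (e , h) → (e , h) , local₂ E {pt a} #0 #2 #0 #1 refl (sym e) h
      ; e01-to   = λ E → proj₁ , λ {a} (e , h) → (e , h) , local₂ E {pt a} #1 #2 #0 #2 (sym e) refl h
      ; b02-sub = λ {p} E → s-char {p} #1 #2 (Rel E #0 #1) (Rel E #0 #2) (λ _ h → h) (λ _ h → h)
      ; b12-sub = λ {p} E → s-char {p} #0 #1 (Rel E #0 #2) (Rel E #1 #2) (λ _ h → h) (λ _ h → h)
      ; b02-dia = λ {p} E → d-char {p} #1 #2 (Rel E #0 #1) (Rel E #0 #2) (λ ()) (λ _ h → h) (λ _ h → h)
      ; b12-dia = λ {p} E → d-char {p} #0 #1 (Rel E #0 #2) (Rel E #1 #2) (λ ()) (λ _ h → h) (λ _ h → h)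
      ; e01-sub = λ {p} → same-sub {p} #0 #1 (λ ())
      ; e02-sub = λ {p} → same-sub {p} #0 #2 (λ ())
      ; e12-sub = λ {p} → same-sub {p} #1 #2 (λ ())
      ; e01-dia = λ {p} → same-dia {p} #0 #1
      ; e02-dia = λ {p} → same-dia {p} #0 #2
      ; e12-dia = λ {p} → same-dia {p} #1 #2
      ; apex-on₀ = λ s → proj₁ , λ (p , a , b , c) → (p , a , b , c) , (λ r → p _) , p #0 , p #2 , b
      ; apex-on₁ = λ s → proj₁ , λ (p , a , b , c) → (p , a , b , c) , (λ r → p _) , p #1 , p #2 , c
      ; apex-c = λ s t → proj₁ , λ {a} h → h , joined s t a h
      ; apex-≉𝟘 = λ s e → let u , re , ap = Transversal.apex-exists s in
          case proj₁ e {atomOf re} (inv (ApexP s) re (∼-sym (atom-∼ re)) ap) of λ ()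
      ; forced = λ β s≢t → proj₁ , λ {a} ((lg , p0 , p1 , e01) , (_ , _ , p2 , e02)) →
          ((lg , p0 , p1 , e01) , (lg , p0 , p2 , e02)) , lg , p1 , p2 ,
          C-T1 (pt a #1) (pt a #2) (pt a #0) (ps (pt a)) p1 p2 s≢t p0 (trans (C-sym _ _ _) e01) (trans (C-sym _ _ _) e02)
      ; reds = λ s≢t → proj₁ , λ {a} ((lg , p1 , p2 , n0) , (_ , _ , _ , n1)) →
          ((lg , p1 , p2 , n0) , (lg , p1 , p2 , n1)) , red-or a s≢t lg p1 p2 n0 n1
      ; parity = λ {i} {j} {m} {s} {t} {u} ne → (λ {a} (((_ , p0 , p1 , l , e01) , (_ , _ , p2 , l′ , e02)) , (_ , _ , _ , l″ , e12)) →
          ⊥-elim (ne (match e01 e02 e12 (C-T4 (pt a #0) (pt a #1) (pt a #2) (ps (pt a)) p0 p1 p2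
            (subst IsRed (sym e01) red) (subst IsRed (sym e02) red) (subst IsRed (sym e12) red))))) , λ ()
      }
      where
      on-[∣] : ∀ (u : Fin n → ℕ) i j → j ≢ i → u ([ i ∣ j ] i) ≡ u ([ i ∣ j ] j)
      on-[∣] u i j j≢i = trans (cong u (sub-hit i j)) (cong u (sym (sub-miss j≢i)))
      total : ∀ i j → j ≢ i → M.c i ⟪ Same i j ⟫ M.≈ M.𝟙
      total i j j≢i = (λ _ → _) , λ {a} _ → in-c i (Same i j) a (Real-∘ [ i ∣ j ] _ (pt-real a)) (λ l l≢ → cong (pt a) (sub-miss l≢))
        (on-[∣] (pt a) i j j≢i)
      same-sub : ∀ {p} i j → j ≢ i → M.s {p} i j ⟪ Same i j ⟫ M.≈ M.𝟙
      same-sub i j j≢i = (λ _ → _) , λ {a} _ → let re = Real-∘ [ i ∣ j ] _ (pt-real a) in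
        atomOf re , inv (Same i j) re (∼-sym (atom-∼ re)) (on-[∣] (pt a) i j j≢i) ,
        pt-≲ a (app (sub i j) (class re)) (class-from re (∼-refl (λ _ → refl)))
      same-dia : ∀ {p} i j → M.d {p} i j M.≲ ⟪ Same i j ⟫
      same-dia i j = proj₁ , λ {a} (lift d≲) → lift d≲ , ≲-pt a (cst (dia i j)) d≲
      local₂ : ∀ E {u} i j i′ j′ → u i ≡ u i′ → u j ≡ u j′ → holds (Rel E i j) u → holds (Rel E i′ j′) u
      local₂ E {u} i j i′ j′ ei ej (lg , h) = lg ,
        subst (Sat E _ _) (cong₂ (λ a b → C a b (ps u)) ei ej) (subst₂ (λ p q → Sat E p q (col u i j)) (cong part ei) (cong part ej) h)
      joined : ∀ s t a → Transversal.Apex s (pt a) → a ∈ proj₁ (M.c #2 ⟪ ApexP t ⟫)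
      joined s t a (p , e , _) with Transversal.attach t (pt a) off e
        where
        off : ∀ j → j ≢ #2 → part (pt a j) ≡ Transversal.τ t j
        off zero _ = p zero
        off (suc zero) _ = p (suc zero)
        off (suc (suc zero)) ne = ⊥-elim (ne refl)
        off (suc (suc (suc r))) _ = p (suc (suc (suc r)))
      ... | z , re , ap = in-c #2 (ApexP t) a re (λ j j≢ → update-≢ (pt a) z j≢) ap
      red-or : ∀ a {s t} → s ≢ t → LegalP (pt a) → part (pt a #1) ≡ X s → part (pt a #2) ≡ X t →
               col (pt a) #1 #2 ≢ nil → col (pt a) #1 #2 ≢ w1 → holds (Rel (Rd false s t) #1 #2) (pt a) ⊎ holds (Rel (Rd true s t) #1 #2) (pt a)
      red-or a {s} {t} s≢t lg p1 p2 n0 n1 = go (C-fit (pt a #1) (pt a #2) (ps (pt a)) (λ e → s≢t (X-inj (trans (sym p1) (trans (cong part e) p2))))) refl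
        where
        go : ∀ {c} → Fit (part (pt a #1)) (part (pt a #2)) c → col (pt a) #1 #2 ≡ c →
             holds (Rel (Rd false s t) #1 #2) (pt a) ⊎ holds (Rel (Rd true s t) #1 #2) (pt a)
        go f e rewrite p1 | p2 with f
        ... | nil = ⊥-elim (n0 e)
        ... | w1 _ = ⊥-elim (n1 e)
        ... | inf _ = ⊥-elim (col-real a #1 #2 e)
        ... | red {i = false} _ = inj₁ (lg , refl , refl , _ , e)
        ... | red {i = true} _ = inj₂ (lg , refl , refl , _ , e)
      match : ∀ {e a b c i j m l l′ l″} → a ≡ red i l → b ≡ red j l′ → c ≡ red m l″ → Match e a b c → i xor (j xor m) ≡ e
      match refl refl refl (red h) = h

-- Refutations

xor-≡ : ∀ a b → a xor b ≡ false → a ≡ b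
xor-≡ false false _ = refl
xor-≡ true  true  _ = refl

parity-clash : ∀ b01 b02 b12 b03 b13 b23 → b01 xor (b02 xor b12) ≡ true → b01 xor (b03 xor b13) ≡ false →
               b02 xor (b03 xor b23) ≡ false → b12 xor (b13 xor b23) ≡ false → ⊥
parity-clash b01 b02 b12 b03 b13 b23 p q r s
  rewrite xor-≡ b01 _ q | xor-≡ b02 _ r | xor-≡ b12 _ s = go b03 b13 b23 p
  where
  go : ∀ d e f → (d xor e) xor ((d xor f) xor (e xor f)) ≡ true → ⊥
  go false false false ()
  go false false true  ()
  go false true  false ()
  go false true  true  ()
  go true  false false ()
  go true  false true  ()
  go true  true  false ()
  go true  true  true  ()

#3 : Fin 4
#3 = suc (suc (suc zero))

-- What a diagonal-free representation and a basis have in common: four apexes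
-- over one base that admits all tints, each with copies at the other coordinates.
record Valuation {σ k a ℓ} {C : Algebra σ (3 ℕ.+ k) a ℓ} (F : Facts C) (w v : Level) : Set (a ⊔ˡ ℓ ⊔ˡ lsuc w ⊔ˡ lsuc v) where
  open Algebra C
  open Facts F
  field
    W₀ W₁ W₂ : Set w
    Holds    : W₀ → W₁ → W₂ → Carrier → Set v
    mono     : ∀ {x y a b c} → x ≲ y → Holds a b c x → Holds a b c y
    meet     : ∀ {x y a b c} → Holds a b c x → Holds a b c y → Holds a b c (x · y)
    join     : ∀ {x y a b c} → Holds a b c (x + y) → Holds a b c x ⊎ Holds a b c y
    none     : ∀ {x a b c} → x ≈ 𝟘 → ¬ (Holds a b c x)
    indep₀   : ∀ {x a a′ b c} → Algebra.c C #0 x ≈ x → Holds a b c x → Holds a′ b c x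
    indep₁   : ∀ {x a b b′ c} → Algebra.c C #1 x ≈ x → Holds a b c x → Holds a b′ c x
    indep₂   : ∀ {x a b c c′} → Algebra.c C #2 x ≈ x → Holds a b c x → Holds a b c′ x
    v₀       : W₀
    v₁       : W₁
    v₁⁰      : W₀
    x⁰       : Fin 4 → W₀
    x¹       : Fin 4 → W₁
    x²       : Fin 4 → W₂
    apexes   : ∀ s → Holds v₀ v₁ (x² s) (apex s)
    link01   : ∀ c → Holds v₁⁰ v₁ c e01
    link02   : ∀ s b → Holds (x⁰ s) b (x² s) e02
    link12   : ∀ s a → Holds a (x¹ s) (x² s) e12

  inconsistent : ⊥
  inconsistent = parity-clash (bit #0 #1) (bit #0 #2) (bit #1 #2) (bit #0 #3) (bit #1 #3) (bit #2 #3)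
    (parities #0 #1 #2 z<s (s<s z<s)) (parities #0 #1 #3 z<s (s<s z<s))
    (parities #0 #2 #3 z<s (s<s (s<s z<s))) (parities #1 #2 #3 (s<s z<s) (s<s (s<s z<s)))
    where
    white-free : ∀ β {s t} → s ≢ t → ∀ a → Holds a (x¹ s) (x² t) (b12 (NotW β s t))
    white-free β {s} {t} s≢t a = indep₀ (b12-closed _) (go β)
      where
      go : ∀ β → Holds (if β then v₁⁰ else v₀) (x¹ s) (x² t) (b12 (NotW β s t))
      go false = mono (forced false s≢t) (meet
        (indep₂ (b01-closed _) (mono (e12-to _) (meet (link12 s v₀) (indep₁ (b02-closed _) (mono (apex-on₀ s) (apexes s))))))
        (indep₁ (b02-closed _) (mono (apex-on₀ t) (apexes t))))
      go true = mono (forced true s≢t) (meet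
        (indep₂ (b01-closed _) (mono (e12-to _) (meet (link12 s v₁⁰) (indep₁ (b02-closed _) (on₁ s)))))
        (indep₁ (b02-closed _) (on₁ t)))
        where
        on₁ : ∀ s → Holds v₁⁰ v₁ (x² s) (b02 (On true s))
        on₁ s = mono (e01-to _) (meet (link01 (x² s)) (indep₀ (b12-closed _) (mono (apex-on₁ s) (apexes s))))

    pick : ∀ s t → s ≢ t → Σ[ i ∈ Bool ] (∀ a → Holds a (x¹ s) (x² t) (b12 (Rd i s t)))
    pick s t s≢t with join (mono (reds s≢t) (meet (white-free false s≢t v₀) (white-free true s≢t v₀)))
    ... | inj₁ h = false , λ a → indep₀ (b12-closed _) h
    ... | inj₂ h = true , λ a → indep₀ (b12-closed _) h

    bit′ : ∀ s t → Dec (s ≡ t) → Bool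
    bit′ s t (yes _)  = false
    bit′ s t (no s≢t) = proj₁ (pick s t s≢t)

    bit : Fin 4 → Fin 4 → Bool
    bit s t = bit′ s t (s ≟ᶠ t)

    red12 : ∀ s t → s ≢ t → ∀ a → Holds a (x¹ s) (x² t) (b12 (Rd (bit s t) s t))
    red12 s t s≢t a with s ≟ᶠ t
    ... | yes e = ⊥-elim (s≢t e)
    ... | no ne = proj₂ (pick s t ne) a

    link01ˣ : ∀ s c → Holds (x⁰ s) (x¹ s) c e01
    link01ˣ s c = indep₂ e01-closed (mono e-trans (meet (link02 s (x¹ s)) (link12 s (x⁰ s))))

    red02 : ∀ s t → s ≢ t → ∀ b → Holds (x⁰ s) b (x² t) (b02 (Rd (bit s t) s t))
    red02 s t s≢t b = indep₁ (b02-closed _) (mono (e01-to _) (meet (link01ˣ s (x² t)) (red12 s t s≢t (x⁰ s))))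

    red01 : ∀ s t → s ≢ t → ∀ c → Holds (x⁰ s) (x¹ t) c (b01 (Rd (bit s t) s t))
    red01 s t s≢t c = indep₂ (b01-closed _) (mono (e12-to _) (meet (link12 t (x⁰ s)) (red02 s t s≢t (x¹ t))))

    <⇒≢ᶠ : ∀ {s t : Fin 4} → toℕ s < toℕ t → s ≢ t
    <⇒≢ᶠ lt refl = <-irrefl refl lt

    parities : ∀ s t u → toℕ s < toℕ t → toℕ t < toℕ u → bit s t xor (bit s u xor bit t u) ≡ ε s t u
    parities s t u s<t t<u with (bit s t xor (bit s u xor bit t u)) ≟ᵇ ε s t u
    ... | yes e = e
    ... | no ne = ⊥-elim (none (parity ne) (meet (meet (red01 s t (<⇒≢ᶠ s<t) (x² u)) (red02 s u (<⇒≢ᶠ (<-trans s<t t<u)) (x¹ t)))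
                                                 (red12 t u (<⇒≢ᶠ t<u) (x⁰ s))))

module RefuteDf (em : ∀ {ℓ} → ExcludedMiddle ℓ) {k a ℓ} {C : Algebra dfType (3 ℕ.+ k) a ℓ} (F : Facts C) where
  open Algebra C
  open Facts F

  not-RDf : ¬ RDf (3 ℕ.+ k) C
  not-RDf (I , U , h) = go em
    where
    open _↪_ h
    module Eq = IsEquivalence isEquivalence
    at : ∀ {x y} → x ≈ y → ∀ i {f} → proj₁ (⟦ x ⟧ i) f → proj₁ (⟦ y ⟧ i) f
    at e i = proj₁ (⟦⟧-cong e i)
    go : Dec (Σ[ i ∈ I ] Σ[ f ∈ (∀ j → U i j) ] proj₁ (⟦ apex #0 ⟧ i) f) → ⊥
    go (no ¬e) = apex-≉𝟘 #0 (injective λ i → (λ {f} m → ⊥-elim (¬e (i , f , m))) , λ m → ⊥-elim (case proj₁ (𝟘-homo i) m of λ ()))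
    go (yes (i , f , f∈)) = Valuation.inconsistent val
      where
      pnt : U i #0 → U i #1 → U i #2 → ∀ j → U i j
      pnt a b c zero                = a
      pnt a b c (suc zero)          = b
      pnt a b c (suc (suc zero))    = c
      pnt a b c (suc (suc (suc r))) = f (suc (suc (suc r)))
      Holds : U i #0 → U i #1 → U i #2 → Carrier → Set _
      Holds a b c x = proj₁ (⟦ x ⟧ i) (pnt a b c)
      monoᴴ : ∀ {x y g} → x ≲ y → proj₁ (⟦ x ⟧ i) g → proj₁ (⟦ y ⟧ i) g
      monoᴴ {x} {y} le m = proj₂ (proj₁ (·-homo x y i) (at (Eq.sym le) i m))
      cyl-in : ∀ l {x g} → proj₁ (⟦ c l x ⟧ i) g → Σ[ t ∈ _ ] proj₁ (⟦ x ⟧ i) t × t ≡[ l ] g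
      cyl-in l {x} m = proj₁ (op-homo (cyl l) x i) m
      in-cyl : ∀ l {x g} t → proj₁ (⟦ x ⟧ i) t → t ≡[ l ] g → proj₁ (⟦ c l x ⟧ i) g
      in-cyl l {x} t m e = proj₂ (op-homo (cyl l) x i) (t , m , e)
      resp : ∀ x {g g′} → (∀ j → g j ≡ g′ j) → proj₁ (⟦ x ⟧ i) g → proj₁ (⟦ x ⟧ i) g′
      resp x = proj₂ (⟦ x ⟧ i)
      eta : ∀ g → (∀ r → g (suc (suc (suc r))) ≡ f (suc (suc (suc r)))) → ∀ j → g j ≡ pnt (g #0) (g #1) (g #2) j
      eta g e zero                = refl
      eta g e (suc zero)          = refl
      eta g e (suc (suc zero))    = refl
      eta g e (suc (suc (suc r))) = e r
      pnt-≡ : ∀ {a a′ b b′ c c′} → a ≡ a′ → b ≡ b′ → c ≡ c′ → ∀ j → pnt a b c j ≡ pnt a′ b′ c′ j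
      pnt-≡ refl refl refl j = refl
      everything : ∀ g → proj₁ (⟦ 𝟙 ⟧ i) g
      everything g = proj₂ (𝟙-homo i) _
      x² : ∀ s → Σ[ c ∈ U i #2 ] Holds (f #0) (f #1) c (apex s)
      x² s with cyl-in #2 (monoᴴ (apex-c #0 s) f∈)
      ... | t , m , e = t #2 , resp (apex s) (λ j → trans (eta t (λ r → e _ (λ ())) j) (pnt-≡ (e #0 (λ ())) (e #1 (λ ())) refl j)) m
      x⁰ : ∀ s → Σ[ a ∈ U i #0 ] Holds a (f #1) (proj₁ (x² s)) e02
      x⁰ s with cyl-in #0 (at (Eq.sym e02-total) i (everything (pnt (f #0) (f #1) (proj₁ (x² s)))))
      ... | t , m , e = t #0 , resp e02 (λ j → trans (eta t (λ r → e _ (λ ())) j) (pnt-≡ refl (e #1 (λ ())) (e #2 (λ ())) j)) m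
      x¹ : ∀ s → Σ[ b ∈ U i #1 ] Holds (f #0) b (proj₁ (x² s)) e12
      x¹ s with cyl-in #1 (at (Eq.sym e12-total) i (everything (pnt (f #0) (f #1) (proj₁ (x² s)))))
      ... | t , m , e = t #1 , resp e12 (λ j → trans (eta t (λ r → e _ (λ ())) j) (pnt-≡ (e #0 (λ ())) refl (e #2 (λ ())) j)) m
      v⁰ : Σ[ a ∈ U i #0 ] Holds a (f #1) (f #2) e01
      v⁰ with cyl-in #0 (at (Eq.sym e01-total) i (everything (pnt (f #0) (f #1) (f #2))))
      ... | t , m , e = t #0 , resp e01 (λ j → trans (eta t (λ r → e _ (λ ())) j) (pnt-≡ refl (e #1 (λ ())) (e #2 (λ ())) j)) m
      ind₀ : ∀ {x a a′ b c′} → c #0 x ≈ x → Holds a b c′ x → Holds a′ b c′ x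
      ind₀ {a = a} {b = b} {c′} e m = at e i (in-cyl #0 (pnt a b c′) m λ { zero ne → ⊥-elim (ne refl) ; (suc zero) _ → refl ; (suc (suc zero)) _ → refl ; (suc (suc (suc r))) _ → refl })
      ind₁ : ∀ {x a b b′ c′} → c #1 x ≈ x → Holds a b c′ x → Holds a b′ c′ x
      ind₁ {a = a} {b} {c′ = c′} e m = at e i (in-cyl #1 (pnt a b c′) m λ { zero _ → refl ; (suc zero) ne → ⊥-elim (ne refl) ; (suc (suc zero)) _ → refl ; (suc (suc (suc r))) _ → refl })
      ind₂ : ∀ {x a b c′ c″} → c #2 x ≈ x → Holds a b c′ x → Holds a b c″ x
      ind₂ {a = a} {b} {c′} e m = at e i (in-cyl #2 (pnt a b c′) m λ { zero _ → refl ; (suc zero) _ → refl ; (suc (suc zero)) ne → ⊥-elim (ne refl) ; (suc (suc (suc r))) _ → refl })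
      val : Valuation F _ _
      val = record
        { W₀ = U i #0 ; W₁ = U i #1 ; W₂ = U i #2 ; Holds = Holds
        ; mono = monoᴴ
        ; meet = λ {x} {y} m m′ → proj₂ (·-homo x y i) (m , m′)
        ; join = λ {x} {y} m → proj₁ (+-homo x y i) m
        ; none = λ e m → case proj₁ (𝟘-homo i) (at e i m) of λ ()
        ; indep₀ = ind₀ ; indep₁ = ind₁ ; indep₂ = ind₂
        ; v₀ = f #0 ; v₁ = f #1 ; v₁⁰ = proj₁ v⁰
        ; x⁰ = proj₁ ∘ x⁰ ; x¹ = proj₁ ∘ x¹ ; x² = proj₁ ∘ x²
        ; apexes = proj₂ ∘ x²
        ; link01 = λ _ → ind₂ e01-closed (proj₂ v⁰)
        ; link02 = λ s _ → ind₁ e02-closed (proj₂ (x⁰ s))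
        ; link12 = λ s _ → ind₀ e12-closed (proj₂ (x¹ s))
        }

cylindric : ∀ K {m a ℓ} {A : Algebra (type K) (3 ℕ.+ m) a ℓ} → Is K A → Cylindric A
cylindric Sc  h = Sc-cylindric h
cylindric QA  h = QA-cylindric h
cylindric CA  h = CA-cylindric h
cylindric PEA h = record { isBoolean = Q.isBoolean ; c-𝟘 = Q.c-𝟘 ; c-ext = Q.c-ext ; c-·c = Q.c-·c ; c-comm = Q.c-comm }
  where module Q = Cylindric (QA-cylindric (IsPEA.isQA h))

is-renaming : ∀ K {m a ℓ} {A : Algebra (type K) (3 ℕ.+ m) a ℓ} → Is K A → Renaming A
is-renaming Sc  h = Sc-renaming h
is-renaming QA  h = QA-renaming h
is-renaming CA  h = CA-renaming h
is-renaming PEA h = record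
  { cylindric = cylindric PEA h ; r = Q.r ; r-cong = Q.r-cong ; r-· = Q.r-· ; r-+ = Q.r-+ ; r-𝟘 = Q.r-𝟘 ; r-id = Q.r-id
  ; r-skip = Q.r-skip ; r-r = Q.r-r ; r-comm = Q.r-comm ; r-pres = Q.r-pres ; r-free = Q.r-free ; c-r = Q.c-r }
  where module Q = Renaming (QA-renaming (IsPEA.isQA h))

module EmbeddingKit {σ α a ℓ b ℓ′} {A : Algebra σ α a ℓ} {B : Algebra σ α b ℓ′} (h : A ↪ B) where
  private
    module A = Algebra A
    module B = Algebra B
    module E = IsEquivalence B.isEquivalence
  open _↪_ h

  ↪-mono : ∀ {x y} → x A.≲ y → ⟦ x ⟧ B.≲ ⟦ y ⟧
  ↪-mono {x} {y} p = E.trans (E.sym (·-homo x y)) (⟦⟧-cong p)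

  ↪-≉𝟘 : ∀ {x} → ¬ (x A.≈ A.𝟘) → ¬ (⟦ x ⟧ B.≈ B.𝟘)
  ↪-≉𝟘 ne e = ne (injective (E.trans e (E.sym 𝟘-homo)))

  ↪-closed : ∀ i {x} → A.c i x A.≈ x → B.c i ⟦ x ⟧ B.≈ ⟦ x ⟧
  ↪-closed i {x} e = E.trans (E.sym (op-homo (cyl i) x)) (⟦⟧-cong e)

module Extras {k m : ℕ} (n≤m : 3 ℕ.+ k ≤ m) (room : 6 ℕ.+ k ≤ m) where

  into : Fin (3 ℕ.+ k) → Fin m
  into i = inject≤ i n≤m

  into-≢ : ∀ {i j} → i ≢ j → into i ≢ into j
  into-≢ {i} {j} i≢j e = i≢j (inject≤-injective n≤m n≤m i j e)

  opaque
    extra : ∀ j → j < 3 → Fin m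
    extra j j<3 = fromℕ< {j ℕ.+ (3 ℕ.+ k)} (≤-trans (ℕₚ.+-monoˡ-< (3 ℕ.+ k) j<3) room)

    toℕ-extra : ∀ j lt → toℕ (extra j lt) ≡ j ℕ.+ (3 ℕ.+ k)
    toℕ-extra j lt = toℕ-fromℕ< (≤-trans (ℕₚ.+-monoˡ-< (3 ℕ.+ k) lt) room)

  into≢extra : ∀ i j lt → into i ≢ extra j lt
  into≢extra i j lt e = <⇒≢ (<-≤-trans (toℕ<n i) (m≤n+m (3 ℕ.+ k) j))
    (trans (sym (toℕ-inject≤ i n≤m)) (trans (cong toℕ e) (toℕ-extra j lt)))

  extra-≢ : ∀ {i j} lt lt′ → i ≢ j → extra i lt ≢ extra j lt′
  extra-≢ {i} {j} lt lt′ i≢j e = i≢j (ℕₚ.+-cancelʳ-≡ (3 ℕ.+ k) i j (trans (sym (toℕ-extra i lt)) (trans (cong toℕ e) (toℕ-extra j lt′))))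

module RefuteCB (K : Kind) {k m a ℓ} {C : Algebra (type K) (3 ℕ.+ k) a ℓ} (F : Facts C)
                (n<m : 3 ℕ.+ k < m) (room : 6 ℕ.+ k ≤ m) where
  open Facts F
  open Extras (<⇒≤ n<m) room

  spot : Fin 4 → Fin m
  spot zero                   = into #2
  spot (suc zero)             = extra 0 z<s
  spot (suc (suc zero))       = extra 1 (s<s z<s)
  spot (suc (suc (suc zero))) = extra 2 (s<s (s<s z<s))

  not-CB : ¬ CB K n<m C
  not-CB (B , isB , _ , atomic , (H , basis) , h) = contra (atomic ⟦ apex #0 ⟧ (↪-≉𝟘 (apex-≉𝟘 #0)))
    where
    open _↪_ h
    open EmbeddingKit h
    open Algebra B
    open CylKit (cylindric K isB)
    open IsBasis basis
    open Network using (N; N-cong; N-cyl; N-diag; N-sub; label)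
    module E = IsEquivalence isEquivalence

    atom-or : ∀ {u} → IsAtom u → ∀ y → u ≲ y ⊎ u · y ≈ 𝟘
    atom-or {u} (_ , least) y with least (u · y) ·-lbˡ
    ... | inj₁ e = inj₂ e
    ... | inj₂ e = inj₁ e

    meets : ∀ i {u v} → ¬ (u ≈ 𝟘) → u ≲ c i v → ¬ (v · c i u ≈ 𝟘)
    meets i {u} {v} ne u≲ e = ne (≲𝟘 (≲-trans (·-glb u≲ (c-ext i u))
      (≈⇒≲ (E.trans (E.sym (c-·c i v u)) (E.trans (c-cong i e) (c-𝟘 i))))))

    below : ∀ i {u y} → IsAtom u → u ≲ c i y → Σ[ x ∈ Carrier ] IsAtom x × x ≲ y × u ≲ c i x
    below i {u} {y} at u≲ with atomic (y · c i u) (meets i (proj₁ at) u≲)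
    ... | x , atx , x≲ with atom-or at (c i x)
    ...   | inj₁ u≲x = x , atx , ≲-trans x≲ ·-lbˡ , u≲x
    ...   | inj₂ e = ⊥-elim (meets i (proj₁ atx) (≲-trans x≲ ·-lbʳ) e)

    point : Fin m → Fin m → Fin m → Fin (3 ℕ.+ k) → Fin m
    point a b c zero                = a
    point a b c (suc zero)          = b
    point a b c (suc (suc zero))    = c
    point a b c (suc (suc (suc r))) = into (suc (suc (suc r)))

    base : Fin m → Fin (3 ℕ.+ k) → Fin m
    base z = point (into #0) (into #1) z

    base-into : ∀ i → base (into #2) i ≡ into i
    base-into zero                = refl
    base-into (suc zero)          = refl
    base-into (suc (suc zero))    = refl
    base-into (suc (suc (suc r))) = refl

    base-avoids : ∀ z j lt → z ≢ extra j lt → ∀ i → base z i ≢ extra j lt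
    base-avoids z j lt ne zero                = into≢extra #0 j lt
    base-avoids z j lt ne (suc zero)          = into≢extra #1 j lt
    base-avoids z j lt ne (suc (suc zero))    = ne
    base-avoids z j lt ne (suc (suc (suc r))) = into≢extra (suc (suc (suc r))) j lt

    step : ∀ M → M ∈ H → N M (base (into #2)) ≲ ⟦ apex #0 ⟧ → ∀ t j lt →
           Σ[ M′ ∈ Network B m ] M′ ∈ H × (∀ z → z ≢ extra j lt → N M′ (base z) ≈ N M (base z)) ×
                                 N M′ (base (extra j lt)) ≲ ⟦ apex t ⟧
    step M M∈ le t j lt
      with below #2 (proj₂ (label M (base (into #2)))) (≲-trans le (≲-trans (↪-mono (apex-c #0 t)) (≈⇒≲ (op-homo (cyl #2) (apex t)))))
    ... | x , atx , x≲ , N≲ with extend M M∈ (base (into #2)) #2 x atx N≲ (extra j lt) (λ { i i≢2 → base-avoids (into #2) j lt (into≢extra #2 j lt) i })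
    ...   | M′ , M′∈ , agree , e = M′ , M′∈ , (λ z ne → agree (base z) (base-avoids z j lt ne)) ,
            ≲-trans (≈⇒≲ (E.trans (N-cong M′ (λ { zero → refl ; (suc zero) → refl ; (suc (suc zero)) → refl ; (suc (suc (suc r))) → refl })) e)) x≲

    finish : ∀ M → (∀ s → N M (base (spot s)) ≲ ⟦ apex s ⟧) → ⊥
    finish M at-spot = Valuation.inconsistent val
      where
      Holds : Fin m → Fin m → Fin m → Algebra.Carrier C → Set _
      Holds a b c x = N M (point a b c) ≲ ⟦ x ⟧

      replace : ∀ i z {δ δ′ y} → δ [ i ↦ z ] ≗ δ′ → Algebra._≈_ C (Algebra.c C i y) y → N M δ ≲ ⟦ y ⟧ → N M δ′ ≲ ⟦ y ⟧
      replace i z {δ} e cl le = ≲-trans (≈⇒≲ (E.sym (N-cong M e))) (≲-trans (N-cyl M δ i z)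
        (≲-trans (c-mono i le) (≈⇒≲ (↪-closed i cl))))

      N-𝟘 : ∀ δ → ¬ (N M δ ≲ 𝟘)
      N-𝟘 δ le = proj₁ (proj₂ (label M δ)) (≲𝟘 le)

      linked : ∀ i j e → (∀ {p} → Algebra._≈_ C (Algebra.s C {p} i j e) (Algebra.𝟙 C)) → (∀ {p} → Algebra._≲_ C (Algebra.d C {p} i j) e) →
               ∀ δ δ′ → δ ∘ [ i ∣ j ] ≗ δ′ → N M δ′ ≲ ⟦ e ⟧
      linked i j e sub-e dia-e δ δ′ eq = ≲-trans (≈⇒≲ (E.sym (N-cong M eq))) (by-kind K refl)
        where
        via-sub : ∀ {p} → ¬ T (hasDiag (type K)) → IsBooleanEndo B (s {p} i j) → N M (δ ∘ [ i ∣ j ]) ≲ ⟦ e ⟧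
        via-sub {p} nd endo with atom-or (proj₂ (label M (δ ∘ [ i ∣ j ]))) ⟦ e ⟧
        ... | inj₁ le = le
        ... | inj₂ dj = ⊥-elim (N-𝟘 δ (≲-trans (N-sub M nd {p} δ i j) (≲-trans (mono-s (disjoint⇒≲- dj)) (≈⇒≲ zero-s))))
          where
          open IsBooleanEndo endo using () renaming (-‿homo to s-neg; ·-homo to s-meet)
          mono-s : ∀ {x y} → x ≲ y → s {p} i j x ≲ s {p} i j y
          mono-s {x} {y} q = E.trans (E.sym (s-meet x y)) (op-cong (sub i j) q)
          all-s : s {p} i j ⟦ e ⟧ ≈ 𝟙
          all-s = E.trans (E.sym (op-homo (sub {p = p} i j) e)) (E.trans (⟦⟧-cong (sub-e {p})) 𝟙-homo)
          zero-s : s {p} i j (- ⟦ e ⟧) ≈ 𝟘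
          zero-s = E.trans (s-neg ⟦ e ⟧) (≲𝟘 (≲-trans (·-glb 𝟙-greatest ≲-refl) (≈⇒≲ (E.trans (·-cong (E.sym all-s) E.refl) (E.trans (·-comm _ _) (≲-⇒disjoint ≲-refl))))))
        via-dia : ∀ {p} → N M (δ ∘ [ i ∣ j ]) ≲ ⟦ e ⟧
        via-dia {p} = ≲-trans (≈⇒≲ (N-cong M at)) (≲-trans (N-diag M {p} δ i j)
          (≲-trans (≈⇒≲ (E.sym (con-homo (dia {p = p} i j)))) (↪-mono (dia-e {p}))))
          where
          at : ∀ l → δ ([ i ∣ j ] l) ≡ (δ [ i ↦ δ j ]) l
          at l with l ≟ᶠ i
          ... | yes refl = trans (cong δ (sub-hit l j)) (sym (update-≡ δ l (δ j)))
          ... | no l≢ = trans (cong δ (sub-miss l≢)) (sym (update-≢ δ (δ j) l≢))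
        by-kind : ∀ K′ → K ≡ K′ → N M (δ ∘ [ i ∣ j ]) ≲ ⟦ e ⟧
        by-kind Sc  refl = via-sub (λ ()) (IsSc.s-endo isB i j)
        by-kind QA  refl = via-sub (λ ()) (IsQA.s-endo isB i j)
        by-kind CA  refl = via-dia
        by-kind PEA refl = via-dia

      val : Valuation F _ _
      val = record
        { W₀ = Fin m ; W₁ = Fin m ; W₂ = Fin m ; Holds = Holds
        ; mono = λ p q → ≲-trans q (↪-mono p)
        ; meet = λ p q → ≲-trans (·-glb p q) (≈⇒≲ (E.sym (·-homo _ _)))
        ; join = λ {x} {y} {a} {b} {c} p → disj (point a b c) x y p
        ; none = λ e p → N-𝟘 _ (≲-trans p (≈⇒≲ (E.trans (⟦⟧-cong e) 𝟘-homo)))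
        ; indep₀ = λ {_} {_} {a′} → replace #0 a′ λ { zero → refl ; (suc zero) → refl ; (suc (suc zero)) → refl ; (suc (suc (suc r))) → refl }
        ; indep₁ = λ {_} {_} {_} {b′} → replace #1 b′ λ { zero → refl ; (suc zero) → refl ; (suc (suc zero)) → refl ; (suc (suc (suc r))) → refl }
        ; indep₂ = λ {_} {_} {_} {_} {c′} → replace #2 c′ λ { zero → refl ; (suc zero) → refl ; (suc (suc zero)) → refl ; (suc (suc (suc r))) → refl }
        ; v₀ = into #0 ; v₁ = into #1 ; v₁⁰ = into #1
        ; x⁰ = spot ; x¹ = spot ; x² = spot
        ; apexes = at-spot
        ; link01 = λ c → linked #0 #1 e01 (λ {p} → e01-sub {p}) (λ {p} → e01-dia {p}) (point (into #1) (into #1) c) _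
            λ { zero → refl ; (suc zero) → refl ; (suc (suc zero)) → refl ; (suc (suc (suc r))) → refl }
        ; link02 = λ s b → linked #0 #2 e02 (λ {p} → e02-sub {p}) (λ {p} → e02-dia {p}) (point b b (spot s)) _
            λ { zero → refl ; (suc zero) → refl ; (suc (suc zero)) → refl ; (suc (suc (suc r))) → refl }
        ; link12 = λ s a → linked #1 #2 e12 (λ {p} → e12-sub {p}) (λ {p} → e12-dia {p}) (point a a (spot s)) _
            λ { zero → refl ; (suc zero) → refl ; (suc (suc zero)) → refl ; (suc (suc (suc r))) → refl }
        }
        where
        disj : ∀ δ x y → N M δ ≲ ⟦ Algebra._+_ C x y ⟧ → N M δ ≲ ⟦ x ⟧ ⊎ N M δ ≲ ⟦ y ⟧
        disj δ x y p with atom-or (proj₂ (label M δ)) ⟦ x ⟧ | atom-or (proj₂ (label M δ)) ⟦ y ⟧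
        ... | inj₁ q | _ = inj₁ q
        ... | inj₂ _ | inj₁ q = inj₂ q
        ... | inj₂ q | inj₂ q′ = ⊥-elim (N-𝟘 δ (≲-trans (·-glb ≲-refl (≲-trans p (≈⇒≲ (+-homo x y))))
                (≲-trans (≈⇒≲ (distribˡ _ _ _)) (+-lub (≈⇒≲ q) (≈⇒≲ q′)))))

    Step : Network B m → Fin 4 → ∀ j → j < 3 → Set _
    Step M t j lt = Σ[ M′ ∈ Network B m ] M′ ∈ H × (∀ z → z ≢ extra j lt → N M′ (base z) ≈ N M (base z)) ×
                                          N M′ (base (extra j lt)) ≲ ⟦ apex t ⟧

    third-step : ∀ {M₀ M₁ M₂} → N M₀ (base (into #2)) ≲ ⟦ apex #0 ⟧ →
                 (∀ z → z ≢ extra 1 (s<s z<s) → N M₂ (base z) ≈ N M₁ (base z)) →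
                 N M₂ (base (into #2)) ≈ N M₀ (base (into #2)) →
                 N M₁ (base (spot #1)) ≲ ⟦ apex #1 ⟧ → N M₂ (base (spot #2)) ≲ ⟦ apex #2 ⟧ →
                 Step M₂ (suc (suc (suc zero))) 2 (s<s (s<s z<s)) → ⊥
    third-step {M₀} {M₁} {M₂} l₀ a₂ e₂ l₁ l₂ (M , _ , a₃ , l₃) = finish M λ
      { zero → ≲-trans (≈⇒≲ (E.trans (a₃ (into #2) (into≢extra #2 2 (s<s (s<s z<s)))) e₂)) l₀
      ; (suc zero) → ≲-trans (≈⇒≲ (E.trans (a₃ (spot #1) (extra-≢ {0} {2} z<s (s<s (s<s z<s)) (λ ())))
                                           (a₂ (spot #1) (extra-≢ {0} {1} z<s (s<s z<s) (λ ()))))) l₁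
      ; (suc (suc zero)) → ≲-trans (≈⇒≲ (a₃ (spot #2) (extra-≢ {1} {2} (s<s z<s) (s<s (s<s z<s)) (λ ())))) l₂
      ; (suc (suc (suc zero))) → l₃ }

    second-step : ∀ {M₀ M₁} → N M₀ (base (into #2)) ≲ ⟦ apex #0 ⟧ → N M₁ (base (into #2)) ≈ N M₀ (base (into #2)) →
                  N M₁ (base (spot #1)) ≲ ⟦ apex #1 ⟧ → Step M₁ #2 1 (s<s z<s) → ⊥
    second-step {M₀} {M₁} l₀ e₁ l₁ (M₂ , M₂∈ , a₂ , l₂) =
      third-step {M₀} {M₁} {M₂} l₀ a₂ e₂ l₁ l₂ (step M₂ M₂∈ (≲-trans (≈⇒≲ e₂) l₀) (suc (suc (suc zero))) 2 (s<s (s<s z<s)))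
      where
      e₂ : N M₂ (base (into #2)) ≈ N M₀ (base (into #2))
      e₂ = E.trans (a₂ (into #2) (into≢extra #2 1 (s<s z<s))) e₁

    first-step : ∀ {M₀} → N M₀ (base (into #2)) ≲ ⟦ apex #0 ⟧ → Step M₀ #1 0 z<s → ⊥
    first-step {M₀} l₀ (M₁ , M₁∈ , a₁ , l₁) =
      second-step {M₀} {M₁} l₀ e₁ l₁ (step M₁ M₁∈ (≲-trans (≈⇒≲ e₁) l₀) #2 1 (s<s z<s))
      where
      e₁ : N M₁ (base (into #2)) ≈ N M₀ (base (into #2))
      e₁ = a₁ (into #2) (into≢extra #2 0 z<s)

    contra : Σ[ x ∈ Carrier ] IsAtom x × x ≲ ⟦ apex #0 ⟧ → ⊥
    contra (x , atx , x≲) = start (atoms x atx)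
      where
      start : Σ[ M ∈ Network B m ] M ∈ H × N M into ≈ x → ⊥
      start (M₀ , M₀∈ , e₀) = first-step {M₀} l₀ (step M₀ M₀∈ l₀ #1 0 z<s)
        where
        l₀ : N M₀ (base (into #2)) ≲ ⟦ apex #0 ⟧
        l₀ = ≲-trans (≈⇒≲ (E.trans (N-cong M₀ base-into) e₀)) x≲

module RefuteSNr (em : ∀ {ℓ} → ExcludedMiddle ℓ) (K : Kind) {k m a ℓ} {C : Algebra (type K) (3 ℕ.+ k) a ℓ} (F : Facts C)
                 (n≤m : 3 ℕ.+ k ≤ 3 ℕ.+ m) (room : 6 ℕ.+ k ≤ 3 ℕ.+ m) where
  open Facts F
  open Extras n≤m room

  -- The first three coordinates and three of the dilation.
  q : Fin 6 → Fin (3 ℕ.+ m)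
  q zero                = into #0
  q (suc zero)          = into #1
  q (suc (suc zero))    = into #2
  q (suc (suc (suc j))) = extra (toℕ j) (toℕ<n j)

  q-≢ : ∀ i j → i ≢ j → q i ≢ q j
  q-≢ zero zero ne = ⊥-elim (ne refl)
  q-≢ zero (suc zero) ne = into-≢ λ ()
  q-≢ zero (suc (suc zero)) ne = into-≢ λ ()
  q-≢ zero (suc (suc (suc j))) ne = into≢extra #0 (toℕ j) (toℕ<n j)
  q-≢ (suc zero) zero ne = into-≢ λ ()
  q-≢ (suc zero) (suc zero) ne = ⊥-elim (ne refl)
  q-≢ (suc zero) (suc (suc zero)) ne = into-≢ λ ()
  q-≢ (suc zero) (suc (suc (suc j))) ne = into≢extra #1 (toℕ j) (toℕ<n j)
  q-≢ (suc (suc zero)) zero ne = into-≢ λ ()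
  q-≢ (suc (suc zero)) (suc zero) ne = into-≢ λ ()
  q-≢ (suc (suc zero)) (suc (suc zero)) ne = ⊥-elim (ne refl)
  q-≢ (suc (suc zero)) (suc (suc (suc j))) ne = into≢extra #2 (toℕ j) (toℕ<n j)
  q-≢ (suc (suc (suc i))) zero ne = into≢extra #0 (toℕ i) (toℕ<n i) ∘ sym
  q-≢ (suc (suc (suc i))) (suc zero) ne = into≢extra #1 (toℕ i) (toℕ<n i) ∘ sym
  q-≢ (suc (suc (suc i))) (suc (suc zero)) ne = into≢extra #2 (toℕ i) (toℕ<n i) ∘ sym
  q-≢ (suc (suc (suc i))) (suc (suc (suc j))) ne =
    extra-≢ {toℕ i} {toℕ j} (toℕ<n i) (toℕ<n j) (λ e → ne (cong (λ x → suc (suc (suc x))) (toℕ-injective e)))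

  not-SNr : ¬ SNr K n≤m C
  not-SNr (B , isB , h , nr) = refined
    where
    open _↪_ h
    open EmbeddingKit h
    open Algebra B
    open Renaming (is-renaming K isB) hiding (cylindric)
    open CylKit (Renaming.cylindric (is-renaming K isB))
    module C = Algebra C
    module E = IsEquivalence isEquivalence
    open SetoidReasoning setoid

    extra-closed : ∀ x j → c (q (suc (suc (suc j)))) ⟦ x ⟧ ≈ ⟦ x ⟧
    extra-closed x j = nr x _ (subst (3 ℕ.+ k ≤_) (sym (toℕ-extra (toℕ j) (toℕ<n j))) (m≤n+m (3 ℕ.+ k) (toℕ j)))

    rename-⟦⟧ : ∀ i j → i ≢ j → ∀ x y → (∀ {p} → y C.≈ C.s {p} i j x) → (∀ {p} → y C.≈ C.c i (C.d {p} i j C.· x)) →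
                ⟦ y ⟧ ≈ r (into i) (into j) ⟦ x ⟧
    rename-⟦⟧ i j i≢j x y via-s via-d = by-kind K refl
      where
      sub-case : ∀ {p} → ⟦ y ⟧ ≈ s {p} (into i) (into j) ⟦ x ⟧
      sub-case {p} = E.trans (⟦⟧-cong (via-s {p})) (op-homo (sub {p = p} i j) x)
      by-kind : ∀ K′ → K ≡ K′ → ⟦ y ⟧ ≈ r (into i) (into j) ⟦ x ⟧
      by-kind Sc  refl = sub-case
      by-kind QA  refl = sub-case
      by-kind PEA refl = sub-case
      by-kind CA  refl = begin
        ⟦ y ⟧                                            ≈⟨ ⟦⟧-cong via-d ⟩
        ⟦ C.c i (C.d i j C.· x) ⟧                        ≈⟨ op-homo (cyl i) _ ⟩
        c (into i) ⟦ C.d i j C.· x ⟧                     ≈⟨ c-cong (into i) (·-homo _ x) ⟩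
        c (into i) (⟦ C.d i j ⟧ · ⟦ x ⟧)                 ≈⟨ c-cong (into i) (·-cong (con-homo (dia i j)) E.refl) ⟩
        c (into i) (d (into i) (into j) · ⟦ x ⟧)         ≈⟨ caSub-≢ isB (into i) (into j) ⟦ x ⟧ (into-≢ i≢j) ⟨
        caSub isB (into i) (into j) ⟦ x ⟧                ∎

    ρ : Fin 6 → Fin 6 → Carrier → Carrier
    ρ i j = r (q i) (q j)

    ρ-cong : ∀ i j {x y} → x ≈ y → ρ i j x ≈ ρ i j y
    ρ-cong i j = r-cong (q i) (q j)

    ρ-mono : ∀ i j {x y} → x ≲ y → ρ i j x ≲ ρ i j y
    ρ-mono i j {x} {y} p = E.trans (E.sym (r-· (q i) (q j) x y)) (ρ-cong i j p)

    τ : Fin 6 → Fin 6 → Fin 6 → Carrier → Carrier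
    τ i j l x = ρ #0 i (ρ #1 j (ρ #2 l x))

    τ-cong : ∀ i j l {x y} → x ≈ y → τ i j l x ≈ τ i j l y
    τ-cong i j l e = ρ-cong #0 i (ρ-cong #1 j (ρ-cong #2 l e))

    τ-mono : ∀ i j l {x y} → x ≲ y → τ i j l x ≲ τ i j l y
    τ-mono i j l p = ρ-mono #0 i (ρ-mono #1 j (ρ-mono #2 l p))

    τ-· : ∀ i j l x y → τ i j l (x · y) ≈ τ i j l x · τ i j l y
    τ-· i j l x y = E.trans (ρ-cong #0 i (E.trans (ρ-cong #1 j (r-· _ _ x y)) (r-· _ _ _ _))) (r-· _ _ _ _)

    τ-+ : ∀ i j l x y → τ i j l (x + y) ≈ τ i j l x + τ i j l y
    τ-+ i j l x y = E.trans (ρ-cong #0 i (E.trans (ρ-cong #1 j (r-+ _ _ x y)) (r-+ _ _ _ _))) (r-+ _ _ _ _)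

    τ-𝟘 : ∀ i j l → τ i j l 𝟘 ≈ 𝟘
    τ-𝟘 i j l = E.trans (ρ-cong #0 i (E.trans (ρ-cong #1 j (r-𝟘 _ _)) (r-𝟘 _ _))) (r-𝟘 _ _)

    ρ-id : ∀ i x → ρ i i x ≈ x
    ρ-id i x = r-id (q i) x

    module _ (E : Bin) where
      X₀ : Carrier
      X₀ = ⟦ b01 E ⟧

      κ : Fin 6 → Fin 6 → Carrier
      κ i j = ρ #0 i (ρ #1 j X₀)

      X₀-closed : ∀ j → j ≢ #0 → j ≢ #1 → c (q j) X₀ ≈ X₀
      X₀-closed zero                ne _  = ⊥-elim (ne refl)
      X₀-closed (suc zero)          _  ne = ⊥-elim (ne refl)
      X₀-closed (suc (suc zero))    _  _  = ↪-closed #2 (b01-closed E)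
      X₀-closed (suc (suc (suc j))) _  _  = extra-closed (b01 E) j

      b02-≈ : ⟦ b02 E ⟧ ≈ ρ #1 #2 X₀
      b02-≈ = rename-⟦⟧ #1 #2 (λ ()) (b01 E) (b02 E) (λ {p} → b02-sub {p} E) (λ {p} → b02-dia {p} E)

      b12-≈ : ⟦ b12 E ⟧ ≈ ρ #0 #1 ⟦ b02 E ⟧
      b12-≈ = rename-⟦⟧ #0 #1 (λ ()) (b02 E) (b12 E) (λ {p} → b12-sub {p} E) (λ {p} → b12-dia {p} E)

      module _ (i j l : Fin 6) (i<j : toℕ i < toℕ j) (j<l : toℕ j < toℕ l) where
        private
          above : ∀ {a b : Fin 6} → toℕ a < toℕ b → b ≢ a
          above lt refl = <-irrefl refl lt
          1≤j : 0 < toℕ j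
          1≤j = ≤-<-trans z≤n i<j
          2≤l : 1 < toℕ l
          2≤l = ≤-<-trans 1≤j j<l

        τ-b01 : τ i j l ⟦ b01 E ⟧ ≈ κ i j
        τ-b01 = ρ-cong #0 i (ρ-cong #1 j (r-skip _ _ (X₀-closed #2 (λ ()) (λ ()))))

        moved : ρ #2 l ⟦ b02 E ⟧ ≈ ρ #1 l X₀
        moved with l ≟ᶠ #2
        ... | yes refl = E.trans (ρ-id #2 _) b02-≈
        ... | no l≢2 = E.trans (ρ-cong #2 l b02-≈) (r-r (q #1) (q #2) (q l) (q-≢ #1 #2 (λ ())) (q-≢ l #2 l≢2) (q-≢ #1 l (above 2≤l ∘ sym))
                (X₀-closed #2 (λ ()) (λ ())) (X₀-closed l (above (<-trans z<s 2≤l)) (above 2≤l)))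

        W : Carrier
        W = ρ #1 l X₀

        W-free : c (q #1) W ≈ W
        W-free = r-free (q #1) (q l) X₀ (q-≢ #1 l (above 2≤l ∘ sym))

        τ-b02 : τ i j l ⟦ b02 E ⟧ ≈ κ i l
        τ-b02 = ρ-cong #0 i (E.trans (ρ-cong #1 j moved) (r-skip (q #1) (q j) W-free))

        moved₂ : ρ #2 l ⟦ b12 E ⟧ ≈ ρ #0 #1 W
        moved₂ with l ≟ᶠ #2
        ... | yes refl = E.trans (ρ-id #2 _) (E.trans b12-≈ (ρ-cong #0 #1 b02-≈))
        ... | no l≢2 = E.trans (ρ-cong #2 l b12-≈) (E.trans
                (r-comm (q #2) (q l) (q #0) (q #1) (q-≢ #2 l (l≢2 ∘ sym)) (q-≢ #2 #0 (λ ())) (q-≢ #2 #1 (λ ()))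
                  (q-≢ l #0 (above (<-trans z<s 2≤l))) (q-≢ l #1 (above 2≤l)) (q-≢ #0 #1 (λ ()))
                  (b02-cl l l≢2 (above (<-trans z<s 2≤l)) (above 2≤l)) (↪-closed #1 (b02-closed E)))
                (ρ-cong #0 #1 moved))
          where
          b02-cl : ∀ l → l ≢ #2 → l ≢ #0 → l ≢ #1 → c (q l) ⟦ b02 E ⟧ ≈ ⟦ b02 E ⟧
          b02-cl zero                _ ne _ = ⊥-elim (ne refl)
          b02-cl (suc zero)          _ _ ne = ⊥-elim (ne refl)
          b02-cl (suc (suc zero))    ne _ _ = ⊥-elim (ne refl)
          b02-cl (suc (suc (suc j))) _ _ _  = extra-closed (b02 E) j

        moved₁ : ρ #1 j (ρ #0 #1 W) ≈ ρ #0 j W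
        moved₁ with j ≟ᶠ #1
        ... | yes refl = ρ-id #1 _
        ... | no j≢1 = r-r (q #0) (q #1) (q j) (q-≢ #0 #1 (λ ())) (q-≢ j #1 j≢1) (q-≢ #0 j (above 1≤j ∘ sym)) W-free
                (r-pres (q #1) (q l) (q j) (q-≢ j #1 j≢1) (q-≢ j l (above j<l ∘ sym)) (X₀-closed j (above 1≤j) j≢1))

        τ-b12 : τ i j l ⟦ b12 E ⟧ ≈ κ j l
        τ-b12 = E.trans (ρ-cong #0 i (E.trans (ρ-cong #1 j moved₂) moved₁))
                  (r-skip (q #0) (q i) (r-free (q #0) (q j) W (q-≢ #0 j (above 1≤j ∘ sym))))

    spot : Fin 4 → Fin 6
    spot s = suc (suc s)

    β : Fin 4 → Carrier
    β s = ρ #2 (spot s) ⟦ apex s ⟧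

    β-τ : ∀ s → β s ≈ τ #0 #1 (spot s) ⟦ apex s ⟧
    β-τ s = E.sym (E.trans (ρ-id #0 _) (ρ-id #1 _))

    β-on : ∀ γ s → β s ≲ κ (On γ s) (if γ then #1 else #0) (spot s)
    β-on false s = ≲-trans (≈⇒≲ (β-τ s)) (≲-trans (τ-mono #0 #1 (spot s) (↪-mono (apex-on₀ s)))
      (≈⇒≲ (τ-b02 (On false s) #0 #1 (spot s) z<s (s<s z<s))))
    β-on true s = ≲-trans (≈⇒≲ (β-τ s)) (≲-trans (τ-mono #0 #1 (spot s) (↪-mono (apex-on₁ s)))
      (≈⇒≲ (τ-b12 (On true s) #0 #1 (spot s) z<s (s<s z<s))))

    <⇒≢ᶠ : ∀ {s t : Fin 4} → toℕ s < toℕ t → s ≢ t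
    <⇒≢ᶠ lt refl = <-irrefl refl lt

    triple-≲ : ∀ E E′ E″ i j l → toℕ i < toℕ j → toℕ j < toℕ l → b01 E C.· b02 E′ C.≲ b12 E″ →
               κ E i j · κ E′ i l ≲ κ E″ j l
    triple-≲ E E′ E″ i j l i<j j<l p = ≲-trans (≈⇒≲ (E.trans
      (·-cong (E.sym (τ-b01 E i j l i<j j<l)) (E.sym (τ-b02 E′ i j l i<j j<l)))
      (E.trans (E.sym (τ-· i j l _ _)) (τ-cong i j l (E.sym (·-homo _ _))))))
      (≲-trans (τ-mono i j l (↪-mono p)) (≈⇒≲ (τ-b12 E″ i j l i<j j<l)))

    β-white : ∀ γ s t → toℕ s < toℕ t → β s · β t ≲ κ (NotW γ s t) (spot s) (spot t)
    β-white false s t lt = ≲-trans (·-mono (β-on false s) (β-on false t))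
      (triple-≲ _ _ _ #0 (spot s) (spot t) z<s (s<s (s<s lt)) (forced false (<⇒≢ᶠ lt)))
    β-white true s t lt = ≲-trans (·-mono (β-on true s) (β-on true t))
      (triple-≲ _ _ _ #1 (spot s) (spot t) (s<s z<s) (s<s (s<s lt)) (forced true (<⇒≢ᶠ lt)))

    β-red : ∀ s t → toℕ s < toℕ t → β s · β t ≲ κ (Rd false s t) (spot s) (spot t) + κ (Rd true s t) (spot s) (spot t)
    β-red s t lt = ≲-trans (·-glb (β-white false s t lt) (β-white true s t lt)) (≲-trans
      (≈⇒≲ (E.trans (·-cong (E.sym (b12τ (NotW false s t))) (E.sym (b12τ (NotW true s t))))
             (E.trans (E.sym (τ-· i j l _ _)) (τ-cong i j l (E.sym (·-homo _ _))))))
      (≲-trans (τ-mono i j l (↪-mono (reds (<⇒≢ᶠ lt))))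
      (≈⇒≲ (E.trans (τ-cong i j l (+-homo _ _)) (E.trans (τ-+ i j l _ _) (+-cong (b12τ (Rd false s t)) (b12τ (Rd true s t))))))))
      where
      i j l : Fin 6
      i = #0
      j = spot s
      l = spot t
      b12τ : ∀ E → τ i j l ⟦ b12 E ⟧ ≈ κ E j l
      b12τ E = τ-b12 E i j l z<s (s<s (s<s lt))

    red-parity : ∀ {i j m} s t u → toℕ s < toℕ t → toℕ t < toℕ u → i xor (j xor m) ≢ ε s t u →
                 κ (Rd i s t) (spot s) (spot t) · κ (Rd j s u) (spot s) (spot u) · κ (Rd m t u) (spot t) (spot u) ≈ 𝟘
    red-parity {i} {j} {m} s t u s<t t<u ne = begin
      κ E₁ (spot s) (spot t) · κ E₂ (spot s) (spot u) · κ E₃ (spot t) (spot u)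
        ≈⟨ ·-cong (·-cong (τ-b01 E₁ i₁ i₂ i₃ lt lt′) (τ-b02 E₂ i₁ i₂ i₃ lt lt′)) (τ-b12 E₃ i₁ i₂ i₃ lt lt′) ⟨
      θ ⟦ b01 E₁ ⟧ · θ ⟦ b02 E₂ ⟧ · θ ⟦ b12 E₃ ⟧
        ≈⟨ ·-cong (τ-· i₁ i₂ i₃ _ _) E.refl ⟨
      θ (⟦ b01 E₁ ⟧ · ⟦ b02 E₂ ⟧) · θ ⟦ b12 E₃ ⟧
        ≈⟨ τ-· i₁ i₂ i₃ _ _ ⟨
      θ (⟦ b01 E₁ ⟧ · ⟦ b02 E₂ ⟧ · ⟦ b12 E₃ ⟧)
        ≈⟨ τ-cong i₁ i₂ i₃ (E.trans (·-homo _ _) (·-cong (·-homo _ _) E.refl)) ⟨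
      θ ⟦ b01 E₁ C.· b02 E₂ C.· b12 E₃ ⟧
        ≈⟨ τ-cong i₁ i₂ i₃ (E.trans (⟦⟧-cong (parity ne)) 𝟘-homo) ⟩
      θ 𝟘
        ≈⟨ τ-𝟘 i₁ i₂ i₃ ⟩
      𝟘 ∎
      where
      i₁ i₂ i₃ : Fin 6
      i₁ = spot s
      i₂ = spot t
      i₃ = spot u
      E₁ E₂ E₃ : Bin
      E₁ = Rd i s t
      E₂ = Rd j s u
      E₃ = Rd m t u
      lt : toℕ (spot s) < toℕ (spot t)
      lt = s<s (s<s s<t)
      lt′ : toℕ (spot t) < toℕ (spot u)
      lt′ = s<s (s<s t<u)
      θ : Carrier → Carrier
      θ = τ (spot s) (spot t) (spot u)

    -- Adding an apex: the new coordinate is free in what is there already.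
    adjoin : ∀ j u → u ≲ ⟦ apex #0 ⟧ → c (q (spot (suc j))) u ≈ u → ¬ (u ≈ 𝟘) → ¬ (u · β (suc j) ≈ 𝟘)
    adjoin j u le cl ne e = ne (≲𝟘 (≲-trans (·-glb ≲-refl (≲-trans le up)) (≈⇒≲ zero′)))
      where
      z : Fin (3 ℕ.+ m)
      z = q (spot (suc j))
      2≢z : q #2 ≢ z
      2≢z = q-≢ #2 (spot (suc j)) λ ()
      c-β : c z (β (suc j)) ≈ c (q #2) ⟦ apex (suc j) ⟧
      c-β = c-r (q #2) z 2≢z (extra-closed (apex (suc j)) j)
      up : ⟦ apex #0 ⟧ ≲ c z (β (suc j))
      up = ≲-trans (↪-mono (apex-c #0 (suc j))) (≈⇒≲ (E.trans (op-homo (cyl #2) _) (E.sym c-β)))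
      zero′ : u · c z (β (suc j)) ≈ 𝟘
      zero′ = E.trans (·-comm _ _) (E.trans (E.sym (c-·-closed z (β (suc j)) cl)) (E.trans (c-cong z (E.trans (·-comm _ _) e)) (c-𝟘 z)))

    β-closed : ∀ i j → i ≢ j → c (q (spot (suc i))) (β (suc j)) ≈ β (suc j)
    β-closed i j i≢j = r-pres (q #2) (q (spot (suc j))) (q (spot (suc i))) (q-≢ (spot (suc i)) #2 (λ ()))
      (q-≢ (spot (suc i)) (spot (suc j)) (λ e → i≢j (suc-injective (suc-injective (suc-injective e))))) (extra-closed (apex (suc j)) i)

    β₀ : β #0 ≈ ⟦ apex #0 ⟧
    β₀ = ρ-id #2 _

    all-apexes : ¬ (⟦ apex #0 ⟧ · β #1 · β #2 · β #3 ≈ 𝟘)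
    all-apexes = adjoin #2 _ (≲-trans ·-lbˡ ·-lbˡ)
      (c-closed-· _ (c-closed-· _ (extra-closed (apex #0) #2) (β-closed #2 #0 (λ ()))) (β-closed #2 #1 (λ ())))
      (adjoin #1 _ ·-lbˡ (c-closed-· _ (extra-closed (apex #0) #1) (β-closed #1 #0 (λ ())))
      (adjoin #0 _ ≲-refl (extra-closed (apex #0) #0) (↪-≉𝟘 (apex-≉𝟘 #0))))

    Over : Carrier → Set _
    Over u = ¬ (u ≈ 𝟘) × (∀ s → u ≲ β s)

    K-red : Bool → Fin 4 → Fin 4 → Carrier
    K-red i s t = κ (Rd i s t) (spot s) (spot t)

    choose : ∀ {u} → Over u → ∀ s t → toℕ s < toℕ t → Σ[ i ∈ Bool ] Σ[ u′ ∈ Carrier ] Over u′ × u′ ≲ u × u′ ≲ K-red i s t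
    choose {u} (ne , le) s t lt with em {P = u · K-red false s t ≈ 𝟘} | em {P = u · K-red true s t ≈ 𝟘}
    ... | no ne′ | _ = false , _ , (ne′ , λ s → ≲-trans ·-lbˡ (le s)) , ·-lbˡ , ·-lbʳ
    ... | yes _ | no ne′ = true , _ , (ne′ , λ s → ≲-trans ·-lbˡ (le s)) , ·-lbˡ , ·-lbʳ
    ... | yes e | yes e′ = ⊥-elim (ne (≲𝟘 (≲-trans (·-glb ≲-refl (≲-trans (·-glb (le s) (le t)) (β-red s t lt)))
            (≲-trans (≈⇒≲ (distribˡ _ _ _)) (+-lub (≈⇒≲ e) (≈⇒≲ e′))))))

    agree : ∀ {u i j m} → Over u → ∀ s t v → toℕ s < toℕ t → toℕ t < toℕ v →
            u ≲ K-red i s t → u ≲ K-red j s v → u ≲ K-red m t v → i xor (j xor m) ≡ ε s t v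
    agree {i = i} {j} {m} (ne , _) s t v s<t t<v p p′ p″ with (i xor (j xor m)) ≟ᵇ ε s t v
    ... | yes e = e
    ... | no ne′ = ⊥-elim (ne (≲𝟘 (≲-trans (·-glb (·-glb p p′) p″) (≈⇒≲ (red-parity s t v s<t t<v ne′)))))

    above-apexes : Over (⟦ apex #0 ⟧ · β #1 · β #2 · β #3)
    above-apexes = all-apexes , λ
      { zero → ≲-trans (≲-trans ·-lbˡ (≲-trans ·-lbˡ ·-lbˡ)) (≈⇒≲ (E.sym β₀))
      ; (suc zero) → ≲-trans ·-lbˡ (≲-trans ·-lbˡ ·-lbʳ)
      ; (suc (suc zero)) → ≲-trans ·-lbˡ ·-lbʳ
      ; (suc (suc (suc zero))) → ·-lbʳ }

    refined : ⊥
    refined =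
      let b01 , _ , o₁ , _  , r₁ = choose above-apexes #0 #1 z<s
          b02 , _ , o₂ , l₂ , r₂ = choose o₁ #0 #2 z<s
          b12 , _ , o₃ , l₃ , r₃ = choose o₂ #1 #2 (s<s z<s)
          b03 , _ , o₄ , l₄ , r₄ = choose o₃ #0 #3 z<s
          b13 , _ , o₅ , l₅ , r₅ = choose o₄ #1 #3 (s<s z<s)
          b23 , _ , o₆ , l₆ , r₆ = choose o₅ #2 #3 (s<s (s<s z<s))
          to5 = l₆
          to4 = ≲-trans l₆ l₅
          to3 = ≲-trans to4 l₄
          to2 = ≲-trans to3 l₃
          to1 = ≲-trans to2 l₂
      in parity-clash b01 b02 b12 b03 b13 b23
        (agree o₆ #0 #1 #2 z<s (s<s z<s) (≲-trans to1 r₁) (≲-trans to2 r₂) (≲-trans to3 r₃))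
        (agree o₆ #0 #1 #3 z<s (s<s z<s) (≲-trans to1 r₁) (≲-trans to4 r₄) (≲-trans to5 r₅))
        (agree o₆ #0 #2 #3 z<s (s<s (s<s z<s)) (≲-trans to2 r₂) (≲-trans to4 r₄) r₆)
        (agree o₆ #1 #2 #3 (s<s z<s) (s<s (s<s z<s)) (≲-trans to3 r₃) (≲-trans to5 r₅) r₆)

module _ (em : ∀ {ℓ} → ExcludedMiddle ℓ) (k : ℕ) where
  open CmBlur em k

  not-SNr-CmBlur : ∀ K j (4≤j : 4 ≤ j) → ¬ SNr K (m≤m+n n j) (Cm (At (Reduct (kind⊑pea K) id Blur)))
  not-SNr-CmBlur K j 4≤j = RefuteSNr.not-SNr em K (Cmσ.facts (kind⊑pea K)) (m≤m+n n j) room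
    where
    room : 6 ℕ.+ k ≤ n ℕ.+ j
    room = s≤s (s≤s (s≤s (≤-trans (≤-reflexive (ℕₚ.+-comm 3 k)) (+-monoʳ-≤ k (≤-trans (ℕₚ.n≤1+n 3) 4≤j)))))

  SNr-not-canonical : ∀ K j → 4 ≤ j → ¬ AtomCanonical (SNr K (m≤m+n n j)) 0ℓ 0ℓ
  SNr-not-canonical K j 4≤j ac = not-SNr-CmBlur K j 4≤j (ac (Reduct (kind⊑pea K) id Blur) (blur-SNr K (m≤m+n n j)) atomic)

  CB-not-canonical : ∀ K → ¬ AtomCanonical (CB K (m<m+n n {4} z<s)) 0ℓ 0ℓ
  CB-not-canonical K ac = RefuteCB.not-CB K (Cmσ.facts (kind⊑pea K)) (m<m+n n {4} z<s) room
    (ac (Reduct (kind⊑pea K) id Blur) (blur-CB K (m<m+n n {4} z<s)) atomic)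
    where
    room : 6 ℕ.+ k ≤ n ℕ.+ 4
    room = s≤s (s≤s (s≤s (≤-trans (≤-reflexive (ℕₚ.+-comm 3 k)) (+-monoʳ-≤ k (ℕₚ.n≤1+n 3)))))

theorem4p6 : (∀ {ℓ} → ExcludedMiddle ℓ) →
    (∀ n → 2 < n →
    (∀ K → ¬ AtomCanonical (SNr K (m≤m+n n 4)) 0ℓ 0ℓ)
    ×
    (Σ[ A ∈ Algebra peaType n 0ℓ 0ℓ ]
    IsPEA A × Algebra.Atomic A × Algebra.Countable A ×
    RPEA n (Tm (At A)) ×
    ¬ SNr Sc (m≤m+n n 4) (Rd-sc (Cm (At A))) ×
    ¬ RDf n (Rd-df (Cm (At A))))
    ×
    (∀ k → 4 ≤ k → ∀ K → ¬ AtomCanonical (SNr K (m≤m+n n k)) 0ℓ 0ℓ))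
    ×
    (∀ n → 2 < n →
    (¬ AtomCanonical (CB CA (m<m+n n {4} z<s)) 0ℓ 0ℓ)
    ×
    (∀ K → ¬ AtomCanonical (CB K (m<m+n n {4} z<s)) 0ℓ 0ℓ))
theorem4p6 em = neat-reducts , bases
  where
  neat-reducts : ∀ n → 2 < n →
    (∀ K → ¬ AtomCanonical (SNr K (m≤m+n n 4)) 0ℓ 0ℓ) ×
    (Σ[ A ∈ Algebra peaType n 0ℓ 0ℓ ]
      IsPEA A × Algebra.Atomic A × Algebra.Countable A × RPEA n (Tm (At A)) ×
      ¬ SNr Sc (m≤m+n n 4) (Rd-sc (Cm (At A))) × ¬ RDf n (Rd-df (Cm (At A)))) ×
    (∀ k → 4 ≤ k → ∀ K → ¬ AtomCanonical (SNr K (m≤m+n n k)) 0ℓ 0ℓ)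
  neat-reducts (suc (suc (suc k))) (s<s (s<s z<s)) =
    (λ K → SNr-not-canonical em k K 4 ≤-refl) ,
    (Blur , Clo-isPEA em types , atomic , countable , Blur-Tm ,
     not-SNr-CmBlur em k Sc 4 ≤-refl , RefuteDf.not-RDf em (Cmσ.facts df⊑pea)) ,
    (λ j 4≤j K → SNr-not-canonical em k K j 4≤j)
    where open CmBlur em k
  bases : ∀ n → 2 < n →
    (¬ AtomCanonical (CB CA (m<m+n n {4} z<s)) 0ℓ 0ℓ) ×
    (∀ K → ¬ AtomCanonical (CB K (m<m+n n {4} z<s)) 0ℓ 0ℓ)
  bases (suc (suc (suc k))) (s<s (s<s z<s)) = CB-not-canonical em k CA , CB-not-canonical em k
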